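{- Let $0<c<1$. Then for $n$ sufficiently large, \[ ex_3(n;\mathcal{L}_{n,cn}^{(3)})=\max\left\{\binom{cn}{3},\ \binom{n}{3}-\binom{n-\frac{cn}{3}}{3}\right\}+o(n^3). \]
   Context: A $3$-graph is a hypergraph all of whose edges have exactly $3$ vertices. A tight path is a $3$-graph whose vertices can be ordered $v_1,\dots,v_m$ so that its edges are exactly $\{v_i,v_{i+1},v_{i+2}\}$ for $i=1,\dots,m-2$. A tight linear forest is a $3$-graph each of whose connected components is a tight path or an isolated vertex. $\mathcal{L}_{n,k}^{(3)}$ is the family of all tight linear forests on $n$ vertices with $k$ edges. $ex_3(n;\mathcal{F})$ is the maximum number of edges in a $3$-graph on $n$ vertices containing no subgraph isomorphic to a member of $\mathcal{F}$. Quantities such as $cn$ and $cn/3$ are treated as integers (rounded); $o(n^3)$ is as $n\to\infty$ with $c$ fixed. -}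

module Defs where

open import Level using (0ℓ)
open import Data.Nat using (ℕ; zero; suc; _+_; _*_; _∸_; _^_; _≤_; _⊔_)
open import Data.Nat.Combinatorics using (_C_)
open import Data.Integer using (ℤ; +_)
import Data.Integer as ℤ
open import Data.Rational using (ℚ; 0ℚ; 1ℚ; _/_) renaming (_<_ to _<ℚ_)
open import Data.Fin using (Fin)
open import Data.Fin.Subset using (Subset; ⁅_⁆; _∪_; ∣_∣)
open import Data.List using (List; []; _∷_; length; concat; map)
open import Data.Nat.ListAction using (sum)
open import Data.Unit using (⊤)
open import Data.List.Membership.Propositional using (_∈_)
open import Data.List.Relation.Unary.All using (All)
open import Data.List.Relation.Unary.Unique.Propositional using (Unique)
open import Data.Product using (Σ; ∃; _×_; _,_)
open import Data.Sum using (_⊎_)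
open import Data.Empty using (⊥)
open import Relation.Nullary using (¬_)
open import Relation.Binary.PropositionalEquality using (_≡_)

record ℝ : Set₁ where
  field
    Lower Upper : ℚ → Set
    lower-inhabited : ∃ λ q → Lower q
    upper-inhabited : ∃ λ q → Upper q
    lower-down  : ∀ {p q} → p <ℚ q → Lower q → Lower p
    upper-up    : ∀ {p q} → p <ℚ q → Upper p → Upper q
    lower-open  : ∀ {q} → Lower q → ∃ λ r → q <ℚ r × Lower r
    upper-open  : ∀ {q} → Upper q → ∃ λ r → r <ℚ q × Upper r
    disjoint    : ∀ {q} → Lower q → Upper q → ⊥
    located     : ∀ {p q} → p <ℚ q → Lower p ⊎ Upper q
open ℝ public

-- | a - c·(suc m)/d | < 1 , i.e. a is cn/d "rounded" (n = suc m),
-- expressed as (d·a - d)/n < c < (d·a + d)/n.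
RoundsTo : ℝ → (d : ℕ) → (n a : ℕ) → Set
RoundsTo c d zero a = a ≡ 0
RoundsTo c d (suc m) a =
  Lower c ((+ (d * a) ℤ.- + d) / suc m) × Upper c ((+ (d * a + d)) / suc m)

record 3Graph (n : ℕ) : Set where
  field
    edges   : List (Subset n)
    size3   : All (λ e → ∣ e ∣ ≡ 3) edges
    nodup   : Unique edges
open 3Graph public

numEdges : ∀ {n} → 3Graph n → ℕ
numEdges H = length (edges H)

triple : ∀ {n} → Fin n → Fin n → Fin n → Subset n
triple x y z = ⁅ x ⁆ ∪ (⁅ y ⁆ ∪ ⁅ z ⁆)

TightPathIn : ∀ {n} → 3Graph n → List (Fin n) → Set
TightPathIn H (x ∷ y ∷ z ∷ rest) = triple x y z ∈ edges H × TightPathIn H (y ∷ z ∷ rest)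
TightPathIn H _ = ⊤

pathEdges : ∀ {A : Set} → List A → ℕ
pathEdges xs = length xs ∸ 2

-- H contains (as a subgraph) a member of L^{(3)}_{n,k}: a tight linear
-- forest with k edges on the n vertices, i.e. vertex-disjoint tight paths
-- (all remaining vertices isolated) whose edge counts sum to k.
ContainsTLF : ∀ {n} → 3Graph n → ℕ → Set
ContainsTLF {n} H k =
  Σ (List (List (Fin n))) λ paths →
    Unique (concat paths) ×
    All (TightPathIn H) paths ×
    sum (map pathEdges paths) ≡ k

bound : (n a b : ℕ) → ℕ
bound n a b = (a C 3) ⊔ ((n C 3) ∸ ((n ∸ b) C 3))

{-# OPTIONS --safe #-}
module Submission where

-- Upper bound. The vertices are coloured with boundedly many colours so that, apart from o(n³) triples,
-- every box of colour classes is either of density o(1) or regular in the weak sense that all its large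
-- sub-boxes are dense and hence contain a complete tripartite 3-graph, a tight path with 3ℓ vertices.
-- The colouring is obtained by splitting along witnesses of irregularity: every split marks sparse
-- sub-boxes, and the total marked volume can only grow boundedly often.
-- A fractional matching of regular boxes then turns into disjoint tight paths with almost as many edges
-- as vertices, so for an H without the forest it has size at most about cn/3. A local optimum of a convex
-- penalty supplies, next to the matching, vertex weights such that every regular box weighs at least 1,
-- every matched triple weighs 1, and unmatched vertices weigh 0. Choosing three matched triples
-- T₁, T₂, T₃ and counting the singletons, pairs and transversals of weight at least 1 gives linear
-- inequalities between t₁, t₂, t₃ that are tight only for the clique and for the star, whence the
-- number of triples of weight at least 1 is at most the maximum of the two.
--
-- Lower bound. In a clique on cn vertices there is no room for a forest with cn edges; in the star over
-- fewer than cn/3 vertices each of these vertices lies on at most three edges of a tight linear forest.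

open import Defs
open import Data.Bool using (Bool; true; false; T; _∧_; _∨_; not; if_then_else_)
open import Data.Bool.ListAction using (all; any)
open import Data.Bool.Properties using (T-∧; T?; ∧-assoc)
import Data.Bool.Properties as Bool
open import Data.Empty using (⊥; ⊥-elim)
open import Data.Fin using (Fin; zero; suc; toℕ; #_; combine; remQuot; funToFin; finToFun)
import Data.Fin.Properties as F
open import Data.Fin.Subset using (Subset; ⁅_⁆; _∪_; ∣_∣; inside; outside; _-_; _⊆_) renaming (_∈_ to _∈ˢ_; ⊥ to ∅)
open import Data.Fin.Subset.Properties using (_∈?_; anySubset?; ∪-comm; ∪-assoc; ∪-idem; ∣⊥∣≡0; ∉⊥; ∣⁅x⁆∣≡1; x∈p⇒∣p-x∣<∣p∣; ⊆-antisym; x∈p∪q⁻; x∈p∪q⁺; x∈⁅x⁆; x∈⁅y⁆⇒x≡y; x∈p∧x≢y⇒x∈p-y; p─q⊆p; p⊆q⇒∣p∣≤∣q∣)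
open import Data.Integer using () renaming (+_ to pos)
import Data.Integer as ℤ
import Data.Integer.Properties as ℤ
open import Data.List using (List; []; _∷_; _++_; length; map; concat; concatMap; allFin; tabulate; filterᵇ)
open import Data.List.Membership.Propositional using (_∈_; find)
open import Data.List.Membership.Propositional.Properties using (∈-∃++; ∈-++⁻; ∈-map⁻)
open import Data.List.Properties using (length-++; length-map; length-tabulate)
open import Data.List.Relation.Binary.Disjoint.Propositional using (Disjoint)
open import Data.List.Relation.Binary.Permutation.Propositional using (_↭_; ↭-sym; ↭-trans; ↭-refl; ↭⇒↭ₛ)
import Data.List.Relation.Binary.Permutation.Propositional as Perm
open import Data.List.Relation.Binary.Permutation.Propositional.Properties using (shift; ↭-length; All-resp-↭; ++⁺ˡ)
import Data.List.Relation.Binary.Permutation.Setoid.Properties as Permₛ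
open import Data.List.Relation.Unary.All as All using (All; []; _∷_)
import Data.List.Relation.Unary.All.Properties as All
open import Data.List.Relation.Unary.AllPairs using ([]; _∷_)
open import Data.List.Relation.Unary.Any as Any using (Any; here; there)
open import Data.List.Relation.Unary.Unique.Propositional using (Unique)
import Data.List.Relation.Unary.Unique.Propositional.Properties as Unique
open import Data.Nat hiding (∣_-_∣)
open import Data.Nat.Combinatorics using (nC1≡n; nCk+nC[k+1]≡[n+1]C[k+1]) renaming (_C_ to _choose_)
open import Data.Nat.DivMod using (m/n*n≤m; m≡m%n+[m/n]*n; m%n<n; 0/n≡0; /-monoˡ-≤; m*n/n≡m)
open import Data.Nat.ListAction using (sum)
open import Data.Nat.Properties
open import Data.Nat.Tactic.RingSolver using (solve-∀)
open import Data.Product using (Σ; ∃; _×_; _,_; proj₁; proj₂)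
open import Data.Rational using (0ℚ; 1ℚ; mkℚ; ↥_; ↧_) renaming (_<_ to _<ℚ_; _/_ to _/ℚ_)
import Data.Rational.Properties as ℚ
open import Data.Rational.Unnormalised using (mkℚᵘ)
import Data.Rational.Unnormalised.Properties as ℚᵘ
open import Data.Sum as Sum using (_⊎_; inj₁; inj₂; [_,_]′)
open import Data.Unit using (tt)
open import Data.Vec as Vec using (Vec; []; _∷_; here; there; lookup; zipWith; replicate)
open import Data.Vec.Properties using (≡-dec; lookup∘tabulate; ∷-injectiveʳ)
open import Function using (_∘_; id)
open import Function.Bundles using (Equivalence)
open import Relation.Binary using (tri<; tri≈; tri>)
open import Relation.Binary.PropositionalEquality hiding ([_])
open import Relation.Nullary
open import Relation.Nullary.Decidable using (_×-dec_; dec-true; dec-false)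

-- Linear arithmetic by certificates

-- The derivative of the penalty in the direction of a colour triple is the sum of its three
-- excesses over capacity. If neither adding nor removing a triple pays, these sums are at least
-- about B on every admissible triple and at most about B on every chosen one. Divided by B, the
-- excesses are therefore a fractional cover with complementary slackness, obtained without any
-- theory of linear programs. No excess is larger than B, a constant, so the chosen triples still
-- fit into the colour classes once each class gives up a constant number of vertices. B only has to
-- make the rounding errors 3 and 6 small against the gaps in the case analysis of three triples.
-- One integer D, independent of n, serves as inverse density, inverse relative size and tile
-- length. A tile on 3D vertices has 3D - 2 edges, so this loss too is of order 1/D. The colours of
-- a box may coincide, so edges inside a single class need no separate treatment.

infixl 6 _⊕_
infixl 7 _⊗_
infix 4 _⊑_

data Lin (k : ℕ) : Set where
  var : Fin k → Lin k
  con : ℕ → Lin k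
  _⊕_ : Lin k → Lin k → Lin k
  _⊗_ : ℕ → Lin k → Lin k

record Ineq (k : ℕ) : Set where
  constructor _⊑_
  field lhs rhs : Lin k
open Ineq

⟦_⟧ : ∀ {k} → Lin k → Vec ℕ k → ℕ
⟦ var i ⟧ ρ = lookup ρ i
⟦ con c ⟧ ρ = c
⟦ e ⊕ f ⟧ ρ = ⟦ e ⟧ ρ + ⟦ f ⟧ ρ
⟦ c ⊗ e ⟧ ρ = c * ⟦ e ⟧ ρ

Holds : ∀ {k} → Vec ℕ k → Ineq k → Set
Holds ρ (l ⊑ r) = ⟦ l ⟧ ρ ≤ ⟦ r ⟧ ρ

dot : ∀ {k} → Vec ℕ k → Vec ℕ k → ℕ
dot [] [] = 0
dot (c ∷ cs) (x ∷ xs) = c * x + dot cs xs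

unit : ∀ {k} → Fin k → Vec ℕ k
unit {suc k} zero = 1 ∷ replicate k 0
unit {suc k} (suc i) = 0 ∷ unit i

_⊞_ : ∀ {k} → Vec ℕ k → Vec ℕ k → Vec ℕ k
_⊞_ = zipWith _+_

scale : ∀ {k} → ℕ → Vec ℕ k → Vec ℕ k
scale c [] = []
scale c (x ∷ xs) = c * x ∷ scale c xs

dot-0 : ∀ {k} (ρ : Vec ℕ k) → dot (replicate k 0) ρ ≡ 0
dot-0 [] = refl
dot-0 (x ∷ ρ) = dot-0 ρ

dot-unit : ∀ {k} (i : Fin k) ρ → dot (unit i) ρ ≡ lookup ρ i
dot-unit zero (x ∷ ρ) rewrite dot-0 ρ = trans (+-identityʳ (x + 0)) (+-identityʳ x)
dot-unit (suc i) (x ∷ ρ) = dot-unit i ρ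

dot-⊞ : ∀ {k} (u v ρ : Vec ℕ k) → dot (u ⊞ v) ρ ≡ dot u ρ + dot v ρ
dot-⊞ [] [] [] = refl
dot-⊞ (u ∷ us) (v ∷ vs) (x ∷ ρ) rewrite dot-⊞ us vs ρ =
  e u v x (dot us ρ) (dot vs ρ)
  where
  e : ∀ u v x a b → (u + v) * x + (a + b) ≡ (u * x + a) + (v * x + b)
  e = solve-∀

dot-scale : ∀ {k} c (u ρ : Vec ℕ k) → dot (scale c u) ρ ≡ c * dot u ρ
dot-scale c [] [] = sym (*-zeroʳ c)
dot-scale c (u ∷ us) (x ∷ ρ) rewrite dot-scale c us ρ =
  e c u x (dot us ρ)
  where
  e : ∀ c u x a → c * u * x + c * a ≡ c * (u * x + a)
  e = solve-∀

coeffs : ∀ {k} → Lin k → Vec ℕ (suc k)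
coeffs {k} (var i) = 0 ∷ unit i
coeffs {k} (con c) = c ∷ replicate k 0
coeffs (e ⊕ f) = coeffs e ⊞ coeffs f
coeffs (c ⊗ e) = scale c (coeffs e)

coeffs-sound : ∀ {k} (e : Lin k) ρ → dot (coeffs e) (1 ∷ ρ) ≡ ⟦ e ⟧ ρ
coeffs-sound (var i) ρ = dot-unit i ρ
coeffs-sound (con c) ρ rewrite dot-0 ρ = trans (+-identityʳ (c * 1)) (*-identityʳ c)
coeffs-sound (e ⊕ f) ρ = trans (dot-⊞ (coeffs e) (coeffs f) (1 ∷ ρ)) (cong₂ _+_ (coeffs-sound e ρ) (coeffs-sound f ρ))
coeffs-sound (c ⊗ e) ρ = trans (dot-scale c (coeffs e) (1 ∷ ρ)) (cong (c *_) (coeffs-sound e ρ))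

-- A certificate may be shorter than the list of inequalities: the missing multipliers are 0.
combination : ∀ {k} → List ℕ → List (Ineq k) → Ineq k
combination (c ∷ cs) ((l ⊑ r) ∷ is) = let (l' ⊑ r') = combination cs is in (c ⊗ l ⊕ l') ⊑ (c ⊗ r ⊕ r')
combination _ _ = con 0 ⊑ con 0

combination-sound : ∀ {k} {ρ : Vec ℕ k} cs {is} → All (Holds ρ) is → Holds ρ (combination cs is)
combination-sound [] _ = ≤-refl
combination-sound (c ∷ cs) [] = ≤-refl
combination-sound (c ∷ cs) (p ∷ ps) = +-mono-≤ (*-monoʳ-≤ c p) (combination-sound cs ps)

_≤ᵛ_ : ∀ {k} → Vec ℕ k → Vec ℕ k → Bool
[] ≤ᵛ [] = true
(x ∷ xs) ≤ᵛ (y ∷ ys) = (x ≤ᵇ y) ∧ (xs ≤ᵛ ys)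

≤ᵛ-sound : ∀ {k} (u v ρ : Vec ℕ k) → T (u ≤ᵛ v) → dot u ρ ≤ dot v ρ
≤ᵛ-sound [] [] [] _ = z≤n
≤ᵛ-sound (u ∷ us) (v ∷ vs) (x ∷ ρ) t =
  let (a , b) = Equivalence.to T-∧ t in
  +-mono-≤ (*-monoˡ-≤ x (≤ᵇ⇒≤ u v a)) (≤ᵛ-sound us vs ρ b)

-- The variables are natural numbers, so a coefficientwise comparison gives 1 + r ≤ l, which is
-- incompatible with l ≤ r.
contradictory : ∀ {k} → Ineq k → Bool
contradictory (l ⊑ r) = coeffs (con 1 ⊕ r) ≤ᵛ coeffs l

refute : ∀ {k} (ρ : Vec ℕ k) cs is → {_ : T (contradictory (combination cs is))} → All (Holds ρ) is → ⊥
refute ρ cs is {t} ps = let (l ⊑ r) = combination cs is in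
  <-irrefl refl (begin-strict
    ⟦ r ⟧ ρ                         <⟨ ≤-refl ⟩
    ⟦ con 1 ⊕ r ⟧ ρ                 ≡⟨ coeffs-sound (con 1 ⊕ r) ρ ⟨
    dot (coeffs (con 1 ⊕ r)) (1 ∷ ρ) ≤⟨ ≤ᵛ-sound (coeffs (con 1 ⊕ r)) (coeffs l) (1 ∷ ρ) t ⟩
    dot (coeffs l) (1 ∷ ρ)           ≡⟨ coeffs-sound l ρ ⟩
    ⟦ l ⟧ ρ                          ≤⟨ combination-sound cs ps ⟩
    ⟦ r ⟧ ρ                          ∎)
  where open ≤-Reasoning

-- The coefficient lists are Farkas certificates, found by solving the dual linear programs;
-- the first coefficient multiplies the negated goal.
linarith : ∀ {k} (ρ : Vec ℕ k) g cs is → {_ : T (contradictory (combination cs ((con 1 ⊕ rhs g ⊑ lhs g) ∷ is)))} →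
  All (Holds ρ) is → Holds ρ g
linarith ρ g cs is {t} ps = ≮⇒≥ λ lt → refute ρ cs _ {t} (lt ∷ ps)

-- Finite sums

private variable
  𝓐 𝓑 : Set

∑ : List 𝓐 → (𝓐 → ℕ) → ℕ
∑ [] f = 0
∑ (x ∷ xs) f = f x + ∑ xs f

infixr 1 ∑
syntax ∑ xs (λ x → e) = ∑[ x ∈ xs ] e

∑-cong : ∀ (xs : List 𝓐) {f g : 𝓐 → ℕ} → (∀ x → f x ≡ g x) → ∑ xs f ≡ ∑ xs g
∑-cong [] p = refl
∑-cong (x ∷ xs) p = cong₂ _+_ (p x) (∑-cong xs p)

∑-mono-∈ : ∀ (xs : List 𝓐) {f g : 𝓐 → ℕ} → (∀ {x} → x ∈ xs → f x ≤ g x) → ∑ xs f ≤ ∑ xs g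
∑-mono-∈ [] p = z≤n
∑-mono-∈ (x ∷ xs) p = +-mono-≤ (p (here refl)) (∑-mono-∈ xs (p ∘ there))

∑-mono : ∀ (xs : List 𝓐) {f g : 𝓐 → ℕ} → (∀ x → f x ≤ g x) → ∑ xs f ≤ ∑ xs g
∑-mono xs p = ∑-mono-∈ xs λ {x} _ → p x

∑-+ : ∀ (xs : List 𝓐) (f g : 𝓐 → ℕ) → (∑[ x ∈ xs ] (f x + g x)) ≡ ∑ xs f + ∑ xs g
∑-+ [] f g = refl
∑-+ (x ∷ xs) f g rewrite ∑-+ xs f g =
  e (f x) (g x) (∑ xs f) (∑ xs g)
  where
  e : ∀ a b c d → (a + b) + (c + d) ≡ (a + c) + (b + d)
  e = solve-∀

∑-*ˡ : ∀ (xs : List 𝓐) c (f : 𝓐 → ℕ) → (∑[ x ∈ xs ] c * f x) ≡ c * ∑ xs f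
∑-*ˡ [] c f = sym (*-zeroʳ c)
∑-*ˡ (x ∷ xs) c f rewrite ∑-*ˡ xs c f = sym (*-distribˡ-+ c (f x) (∑ xs f))

∑-*ʳ : ∀ (xs : List 𝓐) c (f : 𝓐 → ℕ) → (∑[ x ∈ xs ] f x * c) ≡ ∑ xs f * c
∑-*ʳ xs c f = trans (∑-cong xs (λ x → *-comm (f x) c)) (trans (∑-*ˡ xs c f) (*-comm c (∑ xs f)))

∑-const : ∀ (xs : List 𝓐) c → (∑[ x ∈ xs ] c) ≡ length xs * c
∑-const [] c = refl
∑-const (x ∷ xs) c = cong (c +_) (∑-const xs c)

∑-0 : ∀ (xs : List 𝓐) → (∑[ x ∈ xs ] 0) ≡ 0
∑-0 xs = trans (∑-const xs 0) (*-zeroʳ (length xs))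

∑-swap : ∀ (xs : List 𝓐) (ys : List 𝓑) (f : 𝓐 → 𝓑 → ℕ) →
  (∑[ x ∈ xs ] ∑[ y ∈ ys ] f x y) ≡ (∑[ y ∈ ys ] ∑[ x ∈ xs ] f x y)
∑-swap [] ys f = sym (∑-0 ys)
∑-swap (x ∷ xs) ys f = trans (cong (∑ ys (f x) +_) (∑-swap xs ys f)) (sym (∑-+ ys (f x) (λ y → ∑[ x ∈ xs ] f x y)))

∑-++ : ∀ (xs ys : List 𝓐) f → ∑ (xs ++ ys) f ≡ ∑ xs f + ∑ ys f
∑-++ [] ys f = refl
∑-++ (x ∷ xs) ys f = trans (cong (f x +_) (∑-++ xs ys f)) (sym (+-assoc (f x) (∑ xs f) (∑ ys f)))

∑-map : ∀ (g : 𝓐 → 𝓑) xs f → ∑ (map g xs) f ≡ ∑ xs (f ∘ g)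
∑-map g [] f = refl
∑-map g (x ∷ xs) f = cong (f (g x) +_) (∑-map g xs f)

∑-concatMap : ∀ (g : 𝓐 → List 𝓑) xs f → ∑ (concatMap g xs) f ≡ (∑[ x ∈ xs ] ∑ (g x) f)
∑-concatMap g [] f = refl
∑-concatMap g (x ∷ xs) f = trans (∑-++ (g x) (concatMap g xs) f) (cong (∑ (g x) f +_) (∑-concatMap g xs f))

∑-↭ : ∀ {xs ys : List 𝓐} f → xs ↭ ys → ∑ xs f ≡ ∑ ys f
∑-↭ f Perm.refl = refl
∑-↭ f (Perm.prep x p) = cong (f x +_) (∑-↭ f p)
∑-↭ f (Perm.swap {xs} {ys} x y p) rewrite ∑-↭ f p =
  e (f x) (f y) (∑ ys f)
  where
  e : ∀ a b c → a + (b + c) ≡ b + (a + c)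
  e = solve-∀
∑-↭ f (Perm.trans p q) = trans (∑-↭ f p) (∑-↭ f q)

∑-attained : ∀ (xs : List 𝓐) f m → 0 < length xs → length xs * m ≤ ∑ xs f →
  Σ 𝓐 λ x → x ∈ xs × m ≤ f x
∑-attained (x ∷ xs) f m _ p with m ≤? f x
... | yes q = x , here refl , q
... | no q =
  let z , z∈ , r = ∑-attained xs f m (nonempty xs lt) (<⇒≤ lt) in z , there z∈ , r
  where
  lt : length xs * m < ∑ xs f
  lt = ≰⇒> λ le → <⇒≱ (+-mono-<-≤ (≰⇒> q) le) p
  nonempty : ∀ ys → length ys * m < ∑ ys f → 0 < length ys
  nonempty (y ∷ ys) _ = s≤s z≤n

𝟙 : Bool → ℕ
𝟙 false = 0
𝟙 true = 1

𝟙≤1 : ∀ b → 𝟙 b ≤ 1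
𝟙≤1 false = z≤n
𝟙≤1 true = ≤-refl

𝟙-∧ : ∀ a b → 𝟙 (a ∧ b) ≡ 𝟙 a * 𝟙 b
𝟙-∧ false b = refl
𝟙-∧ true b = sym (+-identityʳ (𝟙 b))

∑-filterᵇ : ∀ (p : 𝓐 → Bool) xs f → ∑ (filterᵇ p xs) f ≡ (∑[ x ∈ xs ] 𝟙 (p x) * f x)
∑-filterᵇ p [] f = refl
∑-filterᵇ p (x ∷ xs) f with p x
... | false = ∑-filterᵇ p xs f
... | true rewrite +-identityʳ (f x) = cong (f x +_) (∑-filterᵇ p xs f)

length-∑ : ∀ (xs : List 𝓐) → length xs ≡ (∑[ x ∈ xs ] 1)
length-∑ xs = sym (trans (∑-const xs 1) (*-identityʳ (length xs)))

length-filterᵇ : ∀ (p : 𝓐 → Bool) xs → length (filterᵇ p xs) ≡ (∑[ x ∈ xs ] 𝟙 (p x))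
length-filterᵇ p xs = trans (length-∑ (filterᵇ p xs)) (trans (∑-filterᵇ p xs (λ _ → 1)) (∑-cong xs λ x → *-identityʳ (𝟙 (p x))))

infix 5 _==_
_==_ : ∀ {n} → Fin n → Fin n → Bool
i == j = does (i F.≟ j)

==-refl : ∀ {n} (i : Fin n) → (i == i) ≡ true
==-refl i = dec-true (i F.≟ i) refl

==-≢ : ∀ {n} {i j : Fin n} → i ≢ j → (i == j) ≡ false
==-≢ {i = i} {j} p = dec-false (i F.≟ j) p

==-suc : ∀ {n} (i j : Fin n) → (Fin.suc i == suc j) ≡ (i == j)
==-suc i j with i F.≟ j
... | yes refl = refl
... | no p = refl

does⇒ : ∀ {P : Set} (d : Dec P) → T (does d) → P
does⇒ (yes p) _ = p

∑-tabulate : ∀ {n} (g : Fin n → 𝓐) f → ∑ (tabulate g) f ≡ ∑ (allFin n) (f ∘ g)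
∑-tabulate {n = zero} g f = refl
∑-tabulate {n = suc n} g f = cong (f (g zero) +_)
  (trans (∑-tabulate (g ∘ suc) f) (sym (∑-tabulate suc (f ∘ g))))

∑-δ : ∀ {n} (i : Fin n) (f : Fin n → ℕ) → (∑[ j ∈ allFin n ] 𝟙 (i == j) * f j) ≡ f i
∑-δ {suc n} zero f = trans
  (cong (f zero + 0 +_) (trans (∑-tabulate {n = n} suc (λ j → 𝟙 (zero == j) * f j)) (∑-0 (allFin n))))
  (trans (+-identityʳ _) (+-identityʳ _))
∑-δ {suc n} (suc i) f = trans (∑-tabulate {n = n} suc (λ j → 𝟙 (suc i == j) * f j))
  (trans (∑-cong (allFin n) λ j → cong (λ b → 𝟙 b * f (suc j)) (==-suc i j)) (∑-δ i (f ∘ suc)))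

-- Used to pass from sums over vertices to sums over colour classes: inside the fibre of c the
-- colour is the constant c.
∑-fibres : ∀ {K} (κ : 𝓐 → Fin K) xs (f : Fin K → 𝓐 → ℕ) →
  (∑[ x ∈ xs ] f (κ x) x) ≡ (∑[ c ∈ allFin K ] ∑[ x ∈ xs ] 𝟙 (κ x == c) * f c x)
∑-fibres {K = K} κ xs f = trans (∑-cong xs λ x → sym (∑-δ (κ x) (λ c → f c x)))
  (∑-swap xs (allFin K) (λ x c → 𝟙 (κ x == c) * f c x))

-- Complete boxes in dense tripartite 3-graphs

-- The permutation lets the chosen part inherit distinctness and membership from `xs`.
record Choice {A : Set} (ℓ : ℕ) (xs : List A) : Set where
  field
    chosen others : List A
    splits : xs ↭ chosen ++ others
    size≡  : length chosen ≡ ℓ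
open Choice

choose-none : ∀ {A : Set} (xs : List A) → Choice 0 xs
choose-none xs = record { chosen = [] ; others = xs ; splits = ↭-refl ; size≡ = refl }

choose-cons : ∀ {A : Set} {ℓ x} {xs ys : List A} → xs ↭ x ∷ ys → Choice ℓ ys → Choice (suc ℓ) xs
choose-cons {x = x} p c = record { chosen = x ∷ chosen c ; others = others c
  ; splits = ↭-trans p (Perm.prep x (splits c)) ; size≡ = cong suc (size≡ c) }

choose-satisfying : ∀ {A : Set} ℓ (xs : List A) (p : A → Bool) → ℓ ≤ (∑[ x ∈ xs ] 𝟙 (p x)) →
  Σ (Choice ℓ xs) λ c → All (λ x → T (p x)) (chosen c)
choose-satisfying zero xs p _ = choose-none xs , []
choose-satisfying (suc ℓ) (x ∷ xs) p le with p x in eq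
... | true = let c , al = choose-satisfying ℓ xs p (≤-pred le) in
  choose-cons ↭-refl c , subst T (sym eq) _ ∷ al
... | false = let c , al = choose-satisfying (suc ℓ) xs p le in
  record { chosen = chosen c ; others = x ∷ others c ; size≡ = size≡ c
         ; splits = ↭-trans (Perm.prep x (splits c)) (↭-sym (shift x (chosen c) (others c))) } , al

-- The product of D, 2D, 4D, ... with ℓ factors: one factor is lost per chosen vertex, and the
-- inverse density doubles after each choice.
loss : ℕ → ℕ → ℕ
loss zero D = 1
loss (suc ℓ) D = D * loss ℓ (2 * D)

-- Greedy choice: by averaging, some x is joined to a fraction 1/D of the marked y; keep only these
-- and continue in the rest of `xs`. Deleting x lowers a degree by 1, which at most halves it unless
-- the degree was 1, and then `xs` would have at most D elements.
common-neighbours : ∀ {S Y : Set} ℓ D (xs : List S) (ys : List Y) (R : S → Y → Bool) (m : Y → Bool) →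
  (∀ y → T (m y) → length xs ≤ D * (∑[ x ∈ xs ] 𝟙 (R x y))) → ℓ + 2 ^ ℓ * D ≤ length xs →
  Σ (Choice ℓ xs) λ c → (∑[ y ∈ ys ] 𝟙 (m y)) ≤ loss ℓ D * (∑[ y ∈ ys ] 𝟙 (m y ∧ all (λ x → R x y) (chosen c)))
common-neighbours zero D xs ys R m deg _ = choose-none xs , ≤-trans (∑-mono ys λ y → ≤-reflexive (and-true (m y)))
  (≤-reflexive (sym (*-identityˡ _)))
  where
  and-true : ∀ b → 𝟙 b ≡ 𝟙 (b ∧ true)
  and-true false = refl
  and-true true = refl
common-neighbours {S} {Y} (suc ℓ) D xs ys R m deg big
  with ∑-attained xs (λ x → D * (∑[ y ∈ ys ] 𝟙 (m y ∧ R x y))) (∑[ y ∈ ys ] 𝟙 (m y))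
         (≤-trans (s≤s z≤n) big) average
  where
  open ≤-Reasoning
  average : length xs * (∑[ y ∈ ys ] 𝟙 (m y)) ≤ (∑[ x ∈ xs ] D * (∑[ y ∈ ys ] 𝟙 (m y ∧ R x y)))
  average = begin
    length xs * (∑[ y ∈ ys ] 𝟙 (m y))              ≡⟨ ∑-*ˡ ys (length xs) (λ y → 𝟙 (m y)) ⟨
    (∑[ y ∈ ys ] length xs * 𝟙 (m y))              ≤⟨ ∑-mono ys (λ y → pointwise (m y) (deg y)) ⟩
    (∑[ y ∈ ys ] D * (𝟙 (m y) * (∑[ x ∈ xs ] 𝟙 (R x y)))) ≡⟨ ∑-*ˡ ys D _ ⟩
    D * (∑[ y ∈ ys ] 𝟙 (m y) * (∑[ x ∈ xs ] 𝟙 (R x y)))   ≡⟨ cong (D *_) (∑-cong ys λ y → trans (sym (∑-*ˡ xs (𝟙 (m y)) _)) (∑-cong xs λ x → sym (𝟙-∧ (m y) (R x y)))) ⟩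
    D * (∑[ y ∈ ys ] ∑[ x ∈ xs ] 𝟙 (m y ∧ R x y))         ≡⟨ cong (D *_) (∑-swap ys xs _) ⟩
    D * (∑[ x ∈ xs ] ∑[ y ∈ ys ] 𝟙 (m y ∧ R x y))         ≡⟨ ∑-*ˡ xs D _ ⟨
    (∑[ x ∈ xs ] D * (∑[ y ∈ ys ] 𝟙 (m y ∧ R x y)))       ∎
    where
    pointwise : ∀ b {n d} → (T b → n ≤ D * d) → n * 𝟙 b ≤ D * (𝟙 b * d)
    pointwise false {n} _ = ≤-trans (≤-reflexive (*-zeroʳ n)) z≤n
    pointwise true {n} {d} f = subst₂ _≤_ (sym (*-identityʳ n)) (cong (D *_) (sym (*-identityˡ d))) (f _)
... | s , s∈ , popular with ∈-∃++ s∈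
...   | us , vs , refl = choose-cons perm (proj₁ tail) , final
  where
  open ≤-Reasoning
  perm : us ++ s ∷ vs ↭ s ∷ us ++ vs
  perm = shift s us vs
  m′ : Y → Bool
  m′ y = m y ∧ R s y
  degree : ∀ n d → n ≤ D * suc d → suc ℓ + 2 ^ suc ℓ * D ≤ n → n ≤ 2 * D * d
  degree n zero le gr = ⊥-elim (<⇒≱ (begin-strict
    n ≤⟨ le ⟩ D * 1 ≡⟨ *-identityʳ D ⟩ D ≤⟨ m≤n*m D (2 ^ suc ℓ) {{m^n≢0 2 (suc ℓ)}} ⟩ 2 ^ suc ℓ * D <⟨ m<n+m (2 ^ suc ℓ * D) (s≤s z≤n) ⟩ suc ℓ + 2 ^ suc ℓ * D ∎) gr)
  degree n (suc d) le _ = begin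
    n                   ≤⟨ le ⟩
    D * suc (suc d)     ≤⟨ *-monoʳ-≤ D (s≤s (m≤n+m (suc d) d)) ⟩
    D * (suc d + suc d) ≡⟨ e D (suc d) ⟩
    2 * D * suc d       ∎
    where e : ∀ D d → D * (d + d) ≡ 2 * D * d
          e = solve-∀
  deg′ : ∀ y → T (m′ y) → length (us ++ vs) ≤ 2 * D * (∑[ x ∈ us ++ vs ] 𝟙 (R x y))
  deg′ y t = ≤-trans (≤-trans (n≤1+n _) (≤-reflexive (sym (↭-length perm))))
    (degree (length (us ++ s ∷ vs)) _ (subst (λ d → length (us ++ s ∷ vs) ≤ D * d) split (deg y (proj₁ (Equivalence.to T-∧ t)))) big)
    where
    T⇒𝟙 : ∀ {b} → T b → 𝟙 b ≡ 1
    T⇒𝟙 {true} _ = refl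
    split : (∑[ x ∈ us ++ s ∷ vs ] 𝟙 (R x y)) ≡ suc (∑[ x ∈ us ++ vs ] 𝟙 (R x y))
    split = trans (∑-↭ (λ x → 𝟙 (R x y)) perm) (cong (_+ _) (T⇒𝟙 (proj₂ (Equivalence.to (T-∧ {m y}) t))))
  tail = common-neighbours ℓ (2 * D) (us ++ vs) ys R m′ deg′ (≤-pred (begin
    suc ℓ + 2 ^ ℓ * (2 * D) ≡⟨ cong (suc ℓ +_) (e (2 ^ ℓ) D) ⟩
    suc ℓ + 2 ^ suc ℓ * D   ≤⟨ big ⟩
    length (us ++ s ∷ vs)   ≡⟨ ↭-length perm ⟩
    suc (length (us ++ vs)) ∎))
    where e : ∀ p D → p * (2 * D) ≡ 2 * p * D
          e = solve-∀
  final : (∑[ y ∈ ys ] 𝟙 (m y)) ≤ loss (suc ℓ) D * (∑[ y ∈ ys ] 𝟙 (m y ∧ (R s y ∧ all (λ x → R x y) (chosen (proj₁ tail)))))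
  final = begin
    (∑[ y ∈ ys ] 𝟙 (m y))                    ≤⟨ popular ⟩
    D * (∑[ y ∈ ys ] 𝟙 (m′ y))               ≤⟨ *-monoʳ-≤ D (proj₂ tail) ⟩
    D * (loss ℓ (2 * D) * _)                 ≡⟨ *-assoc D _ _ ⟨
    loss (suc ℓ) D * (∑[ y ∈ ys ] 𝟙 (m′ y ∧ all (λ x → R x y) (chosen (proj₁ tail))))
      ≡⟨ cong (loss (suc ℓ) D *_) (∑-cong ys λ y → cong 𝟙 (∧-assoc (m y) (R s y) _)) ⟩
    loss (suc ℓ) D * _ ∎
  
-- Vertices y of degree below n / 2D account for at most half of the required edges, so the other
-- ones, marked by `m`, make up at least a fraction 1 / 2D of `ys`.
dense-common-neighbours : ∀ {S Y : Set} ℓ D (xs : List S) (ys : List Y) (R : S → Y → Bool) →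
  length xs * length ys ≤ D * (∑[ y ∈ ys ] ∑[ x ∈ xs ] 𝟙 (R x y)) → suc ℓ + 2 ^ ℓ * (2 * D) ≤ length xs →
  Σ (Choice ℓ xs) λ c → length ys ≤ 2 * D * loss ℓ (2 * D) * (∑[ y ∈ ys ] 𝟙 (all (λ x → R x y) (chosen c)))
dense-common-neighbours ℓ D xs ys R dense big = proj₁ found , (begin
    length ys                                                        ≤⟨ many ⟩
    2 * D * (∑[ y ∈ ys ] 𝟙 (m y))                                    ≤⟨ *-monoʳ-≤ (2 * D) (proj₂ found) ⟩
    2 * D * (loss ℓ (2 * D) * (∑[ y ∈ ys ] 𝟙 (m y ∧ _)))             ≡⟨ *-assoc (2 * D) _ _ ⟨
    2 * D * loss ℓ (2 * D) * (∑[ y ∈ ys ] 𝟙 (m y ∧ _))               ≤⟨ *-monoʳ-≤ (2 * D * loss ℓ (2 * D)) (∑-mono ys λ y → drop (m y) _) ⟩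
    2 * D * loss ℓ (2 * D) * (∑[ y ∈ ys ] 𝟙 (all (λ x → R x y) (chosen (proj₁ found)))) ∎)
  where
  open ≤-Reasoning
  n = length xs
  deg = λ y → ∑[ x ∈ xs ] 𝟙 (R x y)
  m = λ y → n ≤ᵇ 2 * D * deg y
  drop : ∀ a b → 𝟙 (a ∧ b) ≤ 𝟙 b
  drop false b = z≤n
  drop true b = ≤-refl
  found = common-neighbours ℓ (2 * D) xs ys R m (λ y → ≤ᵇ⇒≤ n _) (≤-trans (n≤1+n _) big)
  instance
    n≢0 : NonZero n
    n≢0 = >-nonZero (≤-trans (s≤s z≤n) big)
  pointwise : ∀ y → 2 * D * deg y ≤ 2 * D * n * 𝟙 (m y) + n
  pointwise y with n ≤ᵇ 2 * D * deg y in eq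
  ... | true = ≤-trans (*-monoʳ-≤ (2 * D) (≤-trans (∑-mono xs λ x → 𝟙≤1 (R x y)) (≤-reflexive (sym (length-∑ xs)))))
    (≤-trans (≤-reflexive (sym (*-identityʳ _))) (m≤m+n _ n))
  ... | false = ≤-trans (<⇒≤ (≰⇒> λ le → subst T eq (≤⇒≤ᵇ le))) (m≤n+m n _)
  many : length ys ≤ 2 * D * (∑[ y ∈ ys ] 𝟙 (m y))
  many = *-cancelˡ-≤ n (+-cancelʳ-≤ (n * length ys) _ _ (begin
    n * length ys + n * length ys                    ≡⟨ e₀ (n * length ys) ⟩
    2 * (n * length ys)                              ≤⟨ *-monoʳ-≤ 2 dense ⟩
    2 * (D * ∑ ys deg)                               ≡⟨ *-assoc 2 D (∑ ys deg) ⟨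
    2 * D * ∑ ys deg                                 ≡⟨ ∑-*ˡ ys (2 * D) deg ⟨
    (∑[ y ∈ ys ] 2 * D * deg y)                      ≤⟨ ∑-mono ys pointwise ⟩
    (∑[ y ∈ ys ] (2 * D * n * 𝟙 (m y) + n))          ≡⟨ ∑-+ ys (λ y → 2 * D * n * 𝟙 (m y)) (λ _ → n) ⟩
    (∑[ y ∈ ys ] 2 * D * n * 𝟙 (m y)) + (∑[ y ∈ ys ] n) ≡⟨ cong₂ _+_ (∑-*ˡ ys (2 * D * n) (λ y → 𝟙 (m y))) (∑-const ys n) ⟩
    2 * D * n * (∑[ y ∈ ys ] 𝟙 (m y)) + length ys * n   ≡⟨ e₁ D n (∑[ y ∈ ys ] 𝟙 (m y)) (length ys) ⟩
    n * (2 * D * (∑[ y ∈ ys ] 𝟙 (m y))) + n * length ys ∎))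
    where
    e₀ : ∀ a → a + a ≡ 2 * a
    e₀ = solve-∀
    e₁ : ∀ D n s l → 2 * D * n * s + l * n ≡ n * (2 * D * s) + n * l
    e₁ = solve-∀

-- The inverse densities that survive the choice of the first and of the second side. `box-size`
-- adds the requirements on the three sides, so that a single bound serves all of them.
loss₁ loss₂ box-size : ℕ → ℕ → ℕ
loss₁ ℓ D = 2 * D * loss ℓ (2 * D)
loss₂ ℓ D = loss₁ ℓ (loss₁ ℓ D)
box-size ℓ D = (suc ℓ + 2 ^ ℓ * (2 * D)) + ((suc ℓ + 2 ^ ℓ * (2 * loss₁ ℓ D)) + suc (loss₂ ℓ D * ℓ))

record Box {V : Set} (ℓ : ℕ) (h : V → V → V → Bool) (xs ys zs : List V) : Set where
  field
    X : Choice ℓ xs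
    Y : Choice ℓ ys
    Z : Choice ℓ zs
    complete : All (λ z → All (λ y → All (λ x → T (h x y z)) (chosen X)) (chosen Y)) (chosen Z)

-- The theorem of Erdős on complete tripartite 3-graphs. The first side is chosen against all pairs
-- from the other two; the pairs completely joined to it form a dense bipartite graph, in which the
-- second side is chosen; ℓ of the remaining common neighbours form the third.
dense-box′ : ∀ {V : Set} ℓ D (h : V → V → V → Bool) (xs ys zs : List V) →
  length xs * (length ys * length zs) ≤ D * (∑[ x ∈ xs ] ∑[ y ∈ ys ] ∑[ z ∈ zs ] 𝟙 (h x y z)) →
  box-size ℓ D ≤ length xs → box-size ℓ D ≤ length ys → box-size ℓ D ≤ length zs →
  Box ℓ h xs ys zs
dense-box′ {V} ℓ D h xs ys zs dense bx by bz = record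
  { X = X ; Y = Y ; Z = proj₁ Z
  ; complete = All.map (λ {z} t → All.map (λ {y} t → All.all⁺ (λ x → h x y z) (chosen X) t)
      (All.all⁺ (λ y → all (λ x → h x y z) (chosen X)) (chosen Y) t)) (proj₂ Z) }
  where
  open ≤-Reasoning
  pairs : List (V × V)
  pairs = concatMap (λ y → map (y ,_) zs) ys
  ∑-pairs : ∀ f → ∑ pairs f ≡ (∑[ y ∈ ys ] ∑[ z ∈ zs ] f (y , z))
  ∑-pairs f = trans (∑-concatMap _ ys f) (∑-cong ys λ y → ∑-map (y ,_) zs f)
  length-pairs : length pairs ≡ length ys * length zs
  length-pairs = trans (length-∑ pairs) (trans (∑-pairs (λ _ → 1)) (trans (∑-cong ys λ y → sym (length-∑ zs)) (∑-const ys (length zs))))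
  R₁ : V → V × V → Bool
  R₁ x (y , z) = h x y z
  first = dense-common-neighbours ℓ D xs pairs R₁ (begin
    length xs * length pairs                        ≡⟨ cong (length xs *_) length-pairs ⟩
    length xs * (length ys * length zs)             ≤⟨ dense ⟩
    D * (∑[ x ∈ xs ] ∑[ y ∈ ys ] ∑[ z ∈ zs ] 𝟙 (h x y z)) ≡⟨ cong (D *_) (∑-cong xs λ x → sym (∑-pairs λ p → 𝟙 (R₁ x p))) ⟩
    D * (∑[ x ∈ xs ] ∑[ p ∈ pairs ] 𝟙 (R₁ x p))     ≡⟨ cong (D *_) (∑-swap xs pairs λ x p → 𝟙 (R₁ x p)) ⟩
    D * (∑[ p ∈ pairs ] ∑[ x ∈ xs ] 𝟙 (R₁ x p))     ∎) (≤-trans (m≤m+n _ _) bx)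
  X = proj₁ first
  R₂ : V → V → Bool
  R₂ y z = all (λ x → h x y z) (chosen X)
  second = dense-common-neighbours ℓ (loss₁ ℓ D) ys zs R₂ (begin
    length ys * length zs ≡⟨ length-pairs ⟨
    length pairs          ≤⟨ proj₂ first ⟩
    loss₁ ℓ D * (∑[ p ∈ pairs ] 𝟙 (all (λ x → R₁ x p) (chosen X))) ≡⟨ cong (loss₁ ℓ D *_) (∑-pairs _) ⟩
    loss₁ ℓ D * (∑[ y ∈ ys ] ∑[ z ∈ zs ] 𝟙 (R₂ y z)) ≡⟨ cong (loss₁ ℓ D *_) (∑-swap ys zs _) ⟩
    loss₁ ℓ D * (∑[ z ∈ zs ] ∑[ y ∈ ys ] 𝟙 (R₂ y z)) ∎)
    (≤-trans (≤-trans (m≤m+n _ _) (m≤n+m _ (suc ℓ + 2 ^ ℓ * (2 * D)))) by)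
  Y = proj₁ second
  Z = choose-satisfying ℓ zs (λ z → all (λ y → R₂ y z) (chosen Y))
    (<⇒≤ (*-cancelˡ-< (loss₂ ℓ D) ℓ _ (≤-trans (≤-trans (m≤n+m _ (suc ℓ + 2 ^ ℓ * (2 * loss₁ ℓ D))) (m≤n+m _ (suc ℓ + 2 ^ ℓ * (2 * D)))) (≤-trans bz (proj₂ second)))))

abstract
  dense-box : ∀ {V : Set} ℓ D (h : V → V → V → Bool) (xs ys zs : List V) →
    length xs * (length ys * length zs) ≤ D * (∑[ x ∈ xs ] ∑[ y ∈ ys ] ∑[ z ∈ zs ] 𝟙 (h x y z)) →
    box-size ℓ D ≤ length xs → box-size ℓ D ≤ length ys → box-size ℓ D ≤ length zs →
    Box ℓ h xs ys zs
  dense-box = dense-box′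

-- Pairs and transversals of three matched triples

-- Scaled by 1000, a matched triple has total weight at most 1 and a covered triple at least 1; the
-- bounds 1009 and 1000 leave room for the rounding error of the local search. A pair that is not near
-- has weight at most 972, so it misses together with any third weight up to 27.
hit near miss : ℕ → ℕ
hit s = 𝟙 (1000 ≤ᵇ s)
near s = 𝟙 (973 ≤ᵇ s)
miss s = 𝟙 (s <ᵇ 1000)

𝟙-true : ∀ {b} → T b → 1 ≤ 𝟙 b
𝟙-true {true} _ = ≤-refl

𝟙-false : ∀ {b} → ¬ T b → 𝟙 b ≤ 0
𝟙-false {false} _ = z≤n
𝟙-false {true} n = ⊥-elim (n _)

𝟙-mono : ∀ {a b} → (T a → T b) → 𝟙 a ≤ 𝟙 b
𝟙-mono {false} f = z≤n
𝟙-mono {true} f = 𝟙-true (f _)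

hit-0 : ∀ {s} → s ≤ 999 → hit s ≤ 0
hit-0 le = 𝟙-false λ t → <⇒≱ (s≤s le) (≤ᵇ⇒≤ 1000 _ t)

𝟙≤ : ∀ {b m} → (T b → 1 ≤ m) → 𝟙 b ≤ m
𝟙≤ {false} f = z≤n
𝟙≤ {true} f = f _

hit-1 : ∀ {s} → 1000 ≤ s → 1 ≤ hit s
hit-1 le = 𝟙-true (≤⇒≤ᵇ le)

near-0 : ∀ {s} → s ≤ 972 → near s ≤ 0
near-0 le = 𝟙-false λ t → <⇒≱ (s≤s le) (≤ᵇ⇒≤ 973 _ t)

miss-1 : ∀ {s} → s ≤ 999 → 1 ≤ miss s
miss-1 le = 𝟙-true (<⇒<ᵇ (s≤s le))

hit-miss : ∀ s → hit s + miss s ≤ 1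
hit-miss s with s <? 1000
... | yes lt = +-mono-≤ (hit-0 (≤-pred lt)) (𝟙≤1 (s <ᵇ 1000))
... | no ge = subst (_≤ 1) (+-comm (miss s) (hit s))
  (+-mono-≤ {miss s} {0} (𝟙-false λ t → ge (<ᵇ⇒< s 1000 t)) (𝟙≤1 (1000 ≤ᵇ s)))

hit≤near : ∀ s → hit s ≤ near s
hit≤near s = 𝟙-mono λ t → ≤⇒≤ᵇ (≤-trans (m≤m+n 973 27) (≤ᵇ⇒≤ 1000 s t))

near-or-miss : ∀ s w → w ≤ 27 → 1 ≤ near s + miss (s + w)
near-or-miss s w le with 973 ≤? s
... | yes p = ≤-trans (𝟙-true (≤⇒≤ᵇ p)) (m≤m+n (near s) _)
... | no p = ≤-trans (miss-1 {s + w} (+-mono-≤ (≤-pred (≰⇒> p)) le)) (m≤n+m _ (near s))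

miss-antipodal : ∀ s t → s + t ≤ 1999 → 1 ≤ miss s + miss t
miss-antipodal s t le with s ≤? 999
... | yes p = ≤-trans (miss-1 p) (m≤m+n (miss s) _)
... | no p = ≤-trans (miss-1 {t} (+-cancelˡ-≤ 1000 t 999 (≤-trans (+-monoˡ-≤ t (≰⇒> p)) le))) (m≤n+m _ (miss s))

triple-sum : ℕ → ℕ → ℕ → (ℕ → ℕ) → ℕ
triple-sum a b c f = ∑ (a ∷ b ∷ c ∷ []) f

-- Associated exactly as the double sum over two three-element lists computes, so that `pairs f` is
-- the value of `grid` at `cells f` by definition.
grid : Lin 9
grid = row 0 ⊕ (row 1 ⊕ (row 2 ⊕ con 0)) where
  row : ℕ → Lin 9
  row 0 = var (# 0) ⊕ (var (# 1) ⊕ (var (# 2) ⊕ con 0))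
  row 1 = var (# 3) ⊕ (var (# 4) ⊕ (var (# 5) ⊕ con 0))
  row _ = var (# 6) ⊕ (var (# 7) ⊕ (var (# 8) ⊕ con 0))

-- The local search runs with B = 1006: a chosen triple then has weight at most 1006 + 3 and an
-- admissible one at least 1006 - 6.
record Sorted (a b c : ℕ) : Set where
  constructor sorted
  field
    total : a + b + c ≤ 1009
    fst≥ : b ≤ a
    snd≥ : c ≤ b

-- The inequalities hits-pairs and hits-singles are tight for three triples of weights (1/3, 1/3, 1/3)
-- and for three triples (1, 0, 0), which correspond to the clique and to the star.
module Heart {a₁ b₁ c₁ a₂ b₂ c₂ a₃ b₃ c₃}
  (S₁ : Sorted a₁ b₁ c₁) (S₂ : Sorted a₂ b₂ c₂) (S₃ : Sorted a₃ b₃ c₃) where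

  A₁ B₁ C₁ A₂ B₂ C₂ A₃ B₃ C₃ : Lin 9
  A₁ = var (# 0)
  B₁ = var (# 1)
  C₁ = var (# 2)
  A₂ = var (# 3)
  B₂ = var (# 4)
  C₂ = var (# 5)
  A₃ = var (# 6)
  B₃ = var (# 7)
  C₃ = var (# 8)

  ρ : Vec ℕ 9
  ρ = a₁ ∷ b₁ ∷ c₁ ∷ a₂ ∷ b₂ ∷ c₂ ∷ a₃ ∷ b₃ ∷ c₃ ∷ []

  known : List (Ineq 9)
  known = (A₁ ⊕ B₁ ⊕ C₁ ⊑ con 1009) ∷ (B₁ ⊑ A₁) ∷ (C₁ ⊑ B₁)
        ∷ (A₂ ⊕ B₂ ⊕ C₂ ⊑ con 1009) ∷ (B₂ ⊑ A₂) ∷ (C₂ ⊑ B₂)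
        ∷ (A₃ ⊕ B₃ ⊕ C₃ ⊑ con 1009) ∷ (B₃ ⊑ A₃) ∷ (C₃ ⊑ B₃) ∷ []

  known-holds : All (Holds ρ) known
  known-holds = S₁.total ∷ S₁.fst≥ ∷ S₁.snd≥ ∷ S₂.total ∷ S₂.fst≥ ∷ S₂.snd≥ ∷ S₃.total ∷ S₃.fst≥ ∷ S₃.snd≥ ∷ []
    where
    module S₁ = Sorted S₁
    module S₂ = Sorted S₂
    module S₃ = Sorted S₃

  by : ∀ g cs is → {_ : T (contradictory (combination cs ((con 1 ⊕ Ineq.rhs g ⊑ Ineq.lhs g) ∷ is)))} →
    All (Holds ρ) is → Holds ρ g
  by g cs is {t} = linarith ρ g cs is {t}

  pairs : (ℕ → ℕ) → ℕ
  pairs f = triple-sum a₁ b₁ c₁ λ u → triple-sum a₂ b₂ c₂ λ v → f (u + v)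

  missing : ℕ → ℕ
  missing w = pairs λ s → miss (s + w)

  cells : (ℕ → ℕ) → Vec ℕ 9
  cells f = f (a₁ + a₂) ∷ f (a₁ + b₂) ∷ f (a₁ + c₂) ∷ f (b₁ + a₂) ∷ f (b₁ + b₂) ∷ f (b₁ + c₂)
          ∷ f (c₁ + a₂) ∷ f (c₁ + b₂) ∷ f (c₁ + c₂) ∷ []

  AA AB AC BA BB BC CA CB CC : Lin 9
  AA = var (# 0)
  AB = var (# 1)
  AC = var (# 2)
  BA = var (# 3)
  BB = var (# 4)
  BC = var (# 5)
  CA = var (# 6)
  CB = var (# 7)
  CC = var (# 8)

  near≤1 : ∀ s → near s ≤ 1
  near≤1 s = 𝟙≤1 (973 ≤ᵇ s)

  pairs-mono : ∀ f g → (∀ s → f s ≤ g s) → pairs f ≤ pairs g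
  pairs-mono f g p = ∑-mono (a₁ ∷ b₁ ∷ c₁ ∷ []) λ u → ∑-mono (a₂ ∷ b₂ ∷ c₂ ∷ []) λ v → p (u + v)

  -- Both triples are close to (1/2, 1/2, 0): each middle weight is at most 504, hence at least 469,
  -- which leaves at most 71 for each smallest one. No pair with a smallest weight is near.
  square : 973 ≤ b₁ + b₂ → pairs near ≤ 4
  square h = linarith (cells near) (grid ⊑ con 4) (1 ∷ 1 ∷ 1 ∷ 1 ∷ 1 ∷ 1 ∷ 1 ∷ 1 ∷ 1 ∷ 1 ∷ [])
    ((AA ⊑ con 1) ∷ (AB ⊑ con 1) ∷ (BA ⊑ con 1) ∷ (BB ⊑ con 1)
      ∷ (AC ⊑ con 0) ∷ (BC ⊑ con 0) ∷ (CA ⊑ con 0) ∷ (CB ⊑ con 0) ∷ (CC ⊑ con 0) ∷ [])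
    (near≤1 (a₁ + a₂) ∷ near≤1 (a₁ + b₂) ∷ near≤1 (b₁ + a₂) ∷ near≤1 (b₁ + b₂)
      ∷ near-0 ((λ h0 → by (A₁ ⊕ C₂ ⊑ con 972) (2 ∷ 4 ∷ 3 ∷ 1 ∷ 0 ∷ 2 ∷ 2 ∷ []) ((con 973 ⊑ B₁ ⊕ B₂) ∷ known) (h0 ∷ known-holds)) h)
      ∷ near-0 ((λ h0 → by (B₁ ⊕ C₂ ⊑ con 972) (2 ∷ 4 ∷ 3 ∷ 3 ∷ 0 ∷ 2 ∷ 2 ∷ []) ((con 973 ⊑ B₁ ⊕ B₂) ∷ known) (h0 ∷ known-holds)) h)
      ∷ near-0 ((λ h0 → by (C₁ ⊕ A₂ ⊑ con 972) (3 ∷ 3 ∷ 2 ∷ 2 ∷ 1 ∷ 3 ∷ []) ((con 973 ⊑ B₁ ⊕ B₂) ∷ known) (h0 ∷ known-holds)) h)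
      ∷ near-0 ((λ h0 → by (C₁ ⊕ B₂ ⊑ con 972) (2 ∷ 4 ∷ 2 ∷ 2 ∷ 0 ∷ 3 ∷ 3 ∷ []) ((con 973 ⊑ B₁ ⊕ B₂) ∷ known) (h0 ∷ known-holds)) h)
      ∷ near-0 ((λ h0 → by (C₁ ⊕ C₂ ⊑ con 972) (1 ∷ 2 ∷ 1 ∷ 1 ∷ 0 ∷ 1 ∷ 1 ∷ []) ((con 973 ⊑ B₁ ⊕ B₂) ∷ known) (h0 ∷ known-holds)) h) ∷ [])

  -- Every pair that avoids a₁ and a₂ is dominated by b₁ + b₂. What remains is the row of a₁
  -- together with the column of a₂.
  hook : b₁ + b₂ ≤ 972 → pairs near ≤ near (a₁ + a₂) + near (a₁ + b₂) + near (a₁ + c₂) + near (b₁ + a₂) + near (c₁ + a₂)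
  hook h = linarith (cells near) (grid ⊑ AA ⊕ AB ⊕ AC ⊕ BA ⊕ CA) (1 ∷ 1 ∷ 1 ∷ 1 ∷ 1 ∷ [])
    ((BB ⊑ con 0) ∷ (BC ⊑ con 0) ∷ (CB ⊑ con 0) ∷ (CC ⊑ con 0) ∷ [])
    (near-0 h ∷ near-0 ((λ h0 → by (B₁ ⊕ C₂ ⊑ con 972) (1 ∷ 1 ∷ 0 ∷ 0 ∷ 0 ∷ 0 ∷ 0 ∷ 1 ∷ []) ((B₁ ⊕ B₂ ⊑ con 972) ∷ known) (h0 ∷ known-holds)) h) ∷ near-0 ((λ h0 → by (C₁ ⊕ B₂ ⊑ con 972) (1 ∷ 1 ∷ 0 ∷ 0 ∷ 1 ∷ []) ((B₁ ⊕ B₂ ⊑ con 972) ∷ known) (h0 ∷ known-holds)) h)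
      ∷ near-0 ((λ h0 → by (C₁ ⊕ C₂ ⊑ con 972) (1 ∷ 1 ∷ 0 ∷ 0 ∷ 1 ∷ 0 ∷ 0 ∷ 1 ∷ []) ((B₁ ⊕ B₂ ⊑ con 972) ∷ known) (h0 ∷ known-holds)) h) ∷ [])

  hook≤5 : b₁ + b₂ ≤ 972 → pairs near ≤ 5
  hook≤5 h = ≤-trans (hook h) (+-mono-≤ (+-mono-≤ (+-mono-≤ (+-mono-≤ (near≤1 (a₁ + a₂)) (near≤1 (a₁ + b₂)))
    (near≤1 (a₁ + c₂))) (near≤1 (b₁ + a₂))) (near≤1 (c₁ + a₂)))

  pairs-near≤5 : pairs near ≤ 5
  pairs-near≤5 with 973 ≤? b₁ + b₂
  ... | yes p = ≤-trans (square p) (n≤1+n 4)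
  ... | no p = hook≤5 (≤-pred (≰⇒> p))

  -- The excluded hooks are those with one arm of length 2 and a nonempty other arm. Otherwise the
  -- two arms have together at most 2 cells, and the corner is the third.
  short-hook≤3 : b₁ + b₂ ≤ 972 → ¬ (973 ≤ a₁ + c₂ × 973 ≤ b₁ + a₂) → ¬ (973 ≤ a₁ + b₂ × 973 ≤ c₁ + a₂) → pairs near ≤ 3
  short-hook≤3 h n₁ n₂ = ≤-trans (hook h) (arms (a₁ + c₂ ≤? 972) (c₁ + a₂ ≤? 972))
    where
    arms : Dec (a₁ + c₂ ≤ 972) → Dec (c₁ + a₂ ≤ 972) →
      near (a₁ + a₂) + near (a₁ + b₂) + near (a₁ + c₂) + near (b₁ + a₂) + near (c₁ + a₂) ≤ 3
    arms (no p) _ = +-mono-≤ (+-mono-≤ (+-mono-≤ (+-mono-≤ (near≤1 (a₁ + a₂)) (near≤1 (a₁ + b₂)))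
      (near≤1 (a₁ + c₂))) (near-0 q)) (near-0 ((λ h0 → by (C₁ ⊕ A₂ ⊑ con 972) (1 ∷ 1 ∷ 0 ∷ 0 ∷ 1 ∷ []) ((B₁ ⊕ A₂ ⊑ con 972) ∷ known) (h0 ∷ known-holds)) q))
      where q = ≤-pred (≰⇒> λ q → n₁ (≰⇒> p , q))
    arms (yes p) (no r) = +-mono-≤ (+-mono-≤ (+-mono-≤ (+-mono-≤ (near≤1 (a₁ + a₂))
      (near-0 (≤-pred (≰⇒> λ q → n₂ (q , ≰⇒> r))))) (near-0 p)) (near≤1 (b₁ + a₂))) (near≤1 (c₁ + a₂))
    arms (yes p) (yes r) = +-mono-≤ (+-mono-≤ (+-mono-≤ (+-mono-≤ (near≤1 (a₁ + a₂)) (near≤1 (a₁ + b₂)))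
      (near-0 p)) (near≤1 (b₁ + a₂))) (near-0 r)

  private
    b₁≤a₁ = Sorted.fst≥ S₁
    c₁≤b₁ = Sorted.snd≥ S₁
    b₂≤a₂ = Sorted.fst≥ S₂
    c₂≤b₂ = Sorted.snd≥ S₂

    shrink : ∀ {w u u′ v v′} → u′ ≤ u → v′ ≤ v → u + v + w ≤ 999 → u′ + v′ + w ≤ 999
    shrink {w} p q = ≤-trans (+-monoˡ-≤ w (+-mono-≤ p q))

  four-missing : ∀ w → b₁ + b₂ + w ≤ 999 → 4 ≤ missing w
  four-missing w p = linarith (cells λ s → miss (s + w)) (con 4 ⊑ grid) (1 ∷ 1 ∷ 1 ∷ 1 ∷ 1 ∷ [])
    ((con 1 ⊑ BB) ∷ (con 1 ⊑ BC) ∷ (con 1 ⊑ CB) ∷ (con 1 ⊑ CC) ∷ [])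
    (miss-1 p ∷ miss-1 (shrink (≤-refl {b₁}) c₂≤b₂ p) ∷ miss-1 (shrink c₁≤b₁ (≤-refl {b₂}) p) ∷ miss-1 (shrink c₁≤b₁ c₂≤b₂ p) ∷ [])

  five-missing : ∀ w → a₁ + c₂ + w ≤ 999 → c₁ + a₂ + w ≤ 999 → 5 ≤ missing w
  five-missing w p q = linarith (cells λ s → miss (s + w)) (con 5 ⊑ grid) (1 ∷ 1 ∷ 1 ∷ 1 ∷ 1 ∷ 1 ∷ [])
    ((con 1 ⊑ AC) ∷ (con 1 ⊑ BC) ∷ (con 1 ⊑ CC) ∷ (con 1 ⊑ CA) ∷ (con 1 ⊑ CB) ∷ [])
    (miss-1 p ∷ miss-1 (shrink b₁≤a₁ (≤-refl {c₂}) p) ∷ miss-1 (shrink (≤-trans c₁≤b₁ b₁≤a₁) (≤-refl {c₂}) p)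
      ∷ miss-1 q ∷ miss-1 (shrink (≤-refl {c₁}) b₂≤a₂ q) ∷ [])

  one-missing : ∀ w → c₁ + c₂ + w ≤ 999 → 1 ≤ missing w
  one-missing w p = linarith (cells λ s → miss (s + w)) (con 1 ⊑ grid) (1 ∷ 1 ∷ [])
    ((con 1 ⊑ CC) ∷ []) (miss-1 p ∷ [])

  -- Of the total 2018, at most 1018 is left for the four smaller weights. Two opposite cells of
  -- their square, each increased by w, thus sum to at most 1018 + 2w ≤ 1999 and cannot both hit;
  -- there are two such pairs of cells.
  two-missing : 1000 ≤ a₁ + a₂ → ∀ w → 2 * w + 18 ≤ 999 → 2 ≤ missing w
  two-missing h w le = linarith (cells λ s → miss (s + w)) (con 2 ⊑ grid) (1 ∷ 1 ∷ 1 ∷ [])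
    ((con 1 ⊑ BB ⊕ CC) ∷ (con 1 ⊑ BC ⊕ CB) ∷ [])
    (miss-antipodal (b₁ + b₂ + w) (c₁ + c₂ + w) (small b₁ b₂ c₁ c₂ ((λ h0 → by (B₁ ⊕ B₂ ⊕ C₁ ⊕ C₂ ⊑ con 1018) (1 ∷ 1 ∷ 1 ∷ 0 ∷ 0 ∷ 1 ∷ []) ((con 1000 ⊑ A₁ ⊕ A₂) ∷ known) (h0 ∷ known-holds)) h))
    ∷ miss-antipodal (b₁ + c₂ + w) (c₁ + b₂ + w) (small b₁ c₂ c₁ b₂ ((λ h0 → by (B₁ ⊕ C₂ ⊕ C₁ ⊕ B₂ ⊑ con 1018) (1 ∷ 1 ∷ 1 ∷ 0 ∷ 0 ∷ 1 ∷ []) ((con 1000 ⊑ A₁ ⊕ A₂) ∷ known) (h0 ∷ known-holds)) h)) ∷ [])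
    where
    small : ∀ p q r s → p + q + r + s ≤ 1018 → (p + q + w) + (r + s + w) ≤ 1999
    small p q r s k = linarith (p ∷ q ∷ r ∷ s ∷ w ∷ [])
      (var (# 0) ⊕ var (# 1) ⊕ var (# 4) ⊕ (var (# 2) ⊕ var (# 3) ⊕ var (# 4)) ⊑ con 1999) (1 ∷ 1 ∷ 1 ∷ [])
      ((var (# 0) ⊕ var (# 1) ⊕ var (# 2) ⊕ var (# 3) ⊑ con 1018) ∷ (2 ⊗ var (# 4) ⊕ con 18 ⊑ con 999) ∷ [])
      (k ∷ le ∷ [])

  total-missing : ℕ
  total-missing = triple-sum a₃ b₃ c₃ missing

  missing-square : 973 ≤ b₁ + b₂ → 7 ≤ total-missing
  -- From b₁ + b₂ ≥ 973 follows c₁ + c₂ ≤ 2018 - 1946 = 72, and 927 + 72 = 999. A larger a₃ makes b₃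
  -- so small that its layer already misses five cells.
  missing-square h with a₃ ≤? 927
  ... | yes p = +-mono-≤ {1} (one-missing a₃ ((λ h0 h1 → by (C₁ ⊕ C₂ ⊕ A₃ ⊑ con 999) (1 ∷ 1 ∷ 2 ∷ 1 ∷ 1 ∷ 0 ∷ 1 ∷ 1 ∷ []) ((A₃ ⊑ con 927) ∷ (con 973 ⊑ B₁ ⊕ B₂) ∷ known) (h0 ∷ h1 ∷ known-holds)) p h))
    (+-mono-≤ {1} (one-missing b₃ ((λ h0 → by (C₁ ⊕ C₂ ⊕ B₃ ⊑ con 999) (2 ∷ 4 ∷ 2 ∷ 2 ∷ 0 ∷ 2 ∷ 2 ∷ 0 ∷ 1 ∷ 1 ∷ []) ((con 973 ⊑ B₁ ⊕ B₂) ∷ known) (h0 ∷ known-holds)) h)) (≤-trans five (m≤m+n _ 0)))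
    where five = five-missing c₃ ((λ h0 → by (A₁ ⊕ C₂ ⊕ C₃ ⊑ con 999) (6 ∷ 12 ∷ 9 ∷ 3 ∷ 0 ∷ 6 ∷ 6 ∷ 0 ∷ 2 ∷ 2 ∷ 4 ∷ []) ((con 973 ⊑ B₁ ⊕ B₂) ∷ known) (h0 ∷ known-holds)) h) ((λ h0 → by (C₁ ⊕ A₂ ⊕ C₃ ⊑ con 999) (6 ∷ 12 ∷ 6 ∷ 6 ∷ 0 ∷ 9 ∷ 3 ∷ 0 ∷ 2 ∷ 2 ∷ 4 ∷ []) ((con 973 ⊑ B₁ ⊕ B₂) ∷ known) (h0 ∷ known-holds)) h)
  ... | no p = ≤-trans (m≤m+n 7 3) (≤-trans (+-mono-≤ {5}
    (five-missing b₃ ((λ h0 h1 → by (A₁ ⊕ C₂ ⊕ B₃ ⊑ con 999) (2 ∷ 2 ∷ 4 ∷ 3 ∷ 1 ∷ 0 ∷ 2 ∷ 2 ∷ 0 ∷ 2 ∷ []) ((con 928 ⊑ A₃) ∷ (con 973 ⊑ B₁ ⊕ B₂) ∷ known) (h0 ∷ h1 ∷ known-holds)) q h) ((λ h0 h1 → by (C₁ ⊕ A₂ ⊕ B₃ ⊑ con 999) (2 ∷ 2 ∷ 4 ∷ 2 ∷ 2 ∷ 0 ∷ 3 ∷ 1 ∷ 0 ∷ 2 ∷ []) ((con 928 ⊑ A₃) ∷ (con 973 ⊑ B₁ ⊕ B₂) ∷ known) (h0 ∷ h1 ∷ known-holds)) q h))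
    (≤-trans (five-missing c₃ ((λ h0 → by (A₁ ⊕ C₂ ⊕ C₃ ⊑ con 999) (6 ∷ 12 ∷ 9 ∷ 3 ∷ 0 ∷ 6 ∷ 6 ∷ 0 ∷ 2 ∷ 2 ∷ 4 ∷ []) ((con 973 ⊑ B₁ ⊕ B₂) ∷ known) (h0 ∷ known-holds)) h) ((λ h0 → by (C₁ ⊕ A₂ ⊕ C₃ ⊑ con 999) (6 ∷ 12 ∷ 6 ∷ 6 ∷ 0 ∷ 9 ∷ 3 ∷ 0 ∷ 2 ∷ 2 ∷ 4 ∷ []) ((con 973 ⊑ B₁ ⊕ B₂) ∷ known) (h0 ∷ known-holds)) h)) (m≤m+n _ 0)))
    (m≤n+m _ (missing a₃)))
    where q = ≰⇒> p

  missing-four-four : 4 ≤ missing b₃ → 4 ≤ missing c₃ → 8 ≤ total-missing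
  missing-four-four p q = ≤-trans (+-mono-≤ p (≤-trans q (m≤m+n _ 0))) (m≤n+m _ (missing a₃))

  -- A full arm and a nonempty other arm force both triples to be close to (1, 0, 0). Then b₁ + b₂
  -- is small, and in the layers of b₃ and c₃ the four cells without a₁ and a₂ miss.
  missing-hook₁ : 973 ≤ a₁ + c₂ → 973 ≤ b₁ + a₂ → 8 ≤ total-missing
  missing-hook₁ h k = missing-four-four
    (four-missing b₃ ((λ h0 h1 → by (B₁ ⊕ B₂ ⊕ B₃ ⊑ con 999) (2 ∷ 6 ∷ 4 ∷ 6 ∷ 0 ∷ 0 ∷ 4 ∷ 0 ∷ 2 ∷ 1 ∷ 1 ∷ []) ((con 973 ⊑ A₁ ⊕ C₂) ∷ (con 973 ⊑ B₁ ⊕ A₂) ∷ known) (h0 ∷ h1 ∷ known-holds)) h k)) (four-missing c₃ ((λ h0 h1 → by (B₁ ⊕ B₂ ⊕ C₃ ⊑ con 999) (3 ∷ 9 ∷ 6 ∷ 9 ∷ 0 ∷ 0 ∷ 6 ∷ 0 ∷ 3 ∷ 1 ∷ 1 ∷ 2 ∷ []) ((con 973 ⊑ A₁ ⊕ C₂) ∷ (con 973 ⊑ B₁ ⊕ A₂) ∷ known) (h0 ∷ h1 ∷ known-holds)) h k))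

  missing-hook₂ : 973 ≤ a₁ + b₂ → 973 ≤ c₁ + a₂ → 8 ≤ total-missing
  missing-hook₂ h k = missing-four-four
    (four-missing b₃ ((λ h0 h1 → by (B₁ ⊕ B₂ ⊕ B₃ ⊑ con 999) (2 ∷ 4 ∷ 6 ∷ 4 ∷ 0 ∷ 2 ∷ 6 ∷ 0 ∷ 0 ∷ 1 ∷ 1 ∷ []) ((con 973 ⊑ A₁ ⊕ B₂) ∷ (con 973 ⊑ C₁ ⊕ A₂) ∷ known) (h0 ∷ h1 ∷ known-holds)) h k)) (four-missing c₃ ((λ h0 h1 → by (B₁ ⊕ B₂ ⊕ C₃ ⊑ con 999) (3 ∷ 6 ∷ 9 ∷ 6 ∷ 0 ∷ 3 ∷ 9 ∷ 0 ∷ 0 ∷ 1 ∷ 1 ∷ 2 ∷ []) ((con 973 ⊑ A₁ ⊕ B₂) ∷ (con 973 ⊑ C₁ ⊕ A₂) ∷ known) (h0 ∷ h1 ∷ known-holds)) h k))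

  missing-near : ∀ w → w ≤ 27 → 9 ≤ pairs near + missing w
  missing-near w le = subst (9 ≤_)
    (trans (∑-cong T₁ λ u → ∑-+ T₂ (λ v → near (u + v)) (λ v → miss (u + v + w)))
      (∑-+ T₁ (λ u → ∑[ v ∈ T₂ ] near (u + v)) (λ u → ∑[ v ∈ T₂ ] miss (u + v + w))))
    (pairs-mono (λ _ → 1) (λ s → near s + miss (s + w)) λ s → near-or-miss s w le)
    where
    T₁ = a₁ ∷ b₁ ∷ c₁ ∷ []
    T₂ = a₂ ∷ b₂ ∷ c₂ ∷ []

  -- Here a₃ is at least 491, so c₃ is at most 259. If the cell of b₁ and c₂ nevertheless hits in
  -- the layer of c₃, then c₁ is so small that the whole row of c₁ misses; symmetrically for c₁ and
  -- b₂. If neither hits, these two cells and that of c₁ and c₂ are the three.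
  three-missing : 1000 ≤ a₁ + a₂ → 1000 ≤ 2 * a₃ + 18 → 3 ≤ missing c₃
  three-missing h k with b₁ + c₂ + c₃ ≤? 999 | c₁ + b₂ + c₃ ≤? 999
  ... | no p | _ = linarith (cells λ s → miss (s + c₃)) (con 3 ⊑ grid) (1 ∷ 1 ∷ 1 ∷ 1 ∷ [])
    ((con 1 ⊑ CA) ∷ (con 1 ⊑ CB) ∷ (con 1 ⊑ CC) ∷ [])
    (miss-1 ((λ h0 h1 h2 → by (C₁ ⊕ A₂ ⊕ C₃ ⊑ con 999) (4 ∷ 8 ∷ 0 ∷ 3 ∷ 4 ∷ 4 ∷ 0 ∷ 4 ∷ 0 ∷ 4 ∷ 6 ∷ 0 ∷ 6 ∷ []) ((con 1000 ⊑ B₁ ⊕ C₂ ⊕ C₃) ∷ (con 1000 ⊑ A₁ ⊕ A₂) ∷ (con 1000 ⊑ 2 ⊗ A₃ ⊕ con 18) ∷ known) (h0 ∷ h1 ∷ h2 ∷ known-holds)) (≰⇒> p) h k)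
    ∷ miss-1 ((λ h0 h1 h2 → by (C₁ ⊕ B₂ ⊕ C₃ ⊑ con 999) (2 ∷ 2 ∷ 2 ∷ 1 ∷ 2 ∷ 0 ∷ 0 ∷ 2 ∷ 0 ∷ 0 ∷ 2 ∷ 0 ∷ 2 ∷ []) ((con 1000 ⊑ B₁ ⊕ C₂ ⊕ C₃) ∷ (con 1000 ⊑ A₁ ⊕ A₂) ∷ (con 1000 ⊑ 2 ⊗ A₃ ⊕ con 18) ∷ known) (h0 ∷ h1 ∷ h2 ∷ known-holds)) (≰⇒> p) h k)
    ∷ miss-1 ((λ h0 h1 h2 → by (C₁ ⊕ C₂ ⊕ C₃ ⊑ con 999) (4 ∷ 0 ∷ 2 ∷ 1 ∷ 2 ∷ 0 ∷ 2 ∷ 2 ∷ 0 ∷ 2 ∷ 2 ∷ 0 ∷ 2 ∷ []) ((con 1000 ⊑ B₁ ⊕ C₂ ⊕ C₃) ∷ (con 1000 ⊑ A₁ ⊕ A₂) ∷ (con 1000 ⊑ 2 ⊗ A₃ ⊕ con 18) ∷ known) (h0 ∷ h1 ∷ h2 ∷ known-holds)) (≰⇒> p) h k) ∷ [])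
  ... | yes _ | no p = linarith (cells λ s → miss (s + c₃)) (con 3 ⊑ grid) (1 ∷ 1 ∷ 1 ∷ 1 ∷ [])
    ((con 1 ⊑ AC) ∷ (con 1 ⊑ BC) ∷ (con 1 ⊑ CC) ∷ [])
    (miss-1 ((λ h0 h1 h2 → by (A₁ ⊕ C₂ ⊕ C₃ ⊑ con 999) (4 ∷ 8 ∷ 0 ∷ 3 ∷ 4 ∷ 0 ∷ 4 ∷ 4 ∷ 4 ∷ 0 ∷ 6 ∷ 0 ∷ 6 ∷ []) ((con 1000 ⊑ C₁ ⊕ B₂ ⊕ C₃) ∷ (con 1000 ⊑ A₁ ⊕ A₂) ∷ (con 1000 ⊑ 2 ⊗ A₃ ⊕ con 18) ∷ known) (h0 ∷ h1 ∷ h2 ∷ known-holds)) (≰⇒> p) h k)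
    ∷ miss-1 ((λ h0 h1 h2 → by (B₁ ⊕ C₂ ⊕ C₃ ⊑ con 999) (2 ∷ 2 ∷ 2 ∷ 1 ∷ 2 ∷ 0 ∷ 0 ∷ 2 ∷ 0 ∷ 0 ∷ 2 ∷ 0 ∷ 2 ∷ []) ((con 1000 ⊑ C₁ ⊕ B₂ ⊕ C₃) ∷ (con 1000 ⊑ A₁ ⊕ A₂) ∷ (con 1000 ⊑ 2 ⊗ A₃ ⊕ con 18) ∷ known) (h0 ∷ h1 ∷ h2 ∷ known-holds)) (≰⇒> p) h k)
    ∷ miss-1 ((λ h0 h1 h2 → by (C₁ ⊕ C₂ ⊕ C₃ ⊑ con 999) (4 ∷ 0 ∷ 2 ∷ 1 ∷ 2 ∷ 0 ∷ 2 ∷ 2 ∷ 0 ∷ 2 ∷ 2 ∷ 0 ∷ 2 ∷ []) ((con 1000 ⊑ C₁ ⊕ B₂ ⊕ C₃) ∷ (con 1000 ⊑ A₁ ⊕ A₂) ∷ (con 1000 ⊑ 2 ⊗ A₃ ⊕ con 18) ∷ known) (h0 ∷ h1 ∷ h2 ∷ known-holds)) (≰⇒> p) h k) ∷ [])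
  ... | yes p | yes q = linarith (cells λ s → miss (s + c₃)) (con 3 ⊑ grid) (1 ∷ 1 ∷ 1 ∷ 1 ∷ [])
    ((con 1 ⊑ BC) ∷ (con 1 ⊑ CB) ∷ (con 1 ⊑ CC) ∷ [])
    (miss-1 p ∷ miss-1 q ∷ miss-1 ((λ h0 h1 → by (C₁ ⊕ C₂ ⊕ C₃ ⊑ con 999) (4 ∷ 2 ∷ 1 ∷ 2 ∷ 0 ∷ 2 ∷ 2 ∷ 0 ∷ 2 ∷ 2 ∷ 0 ∷ 2 ∷ []) ((con 1000 ⊑ A₁ ⊕ A₂) ∷ (con 1000 ⊑ 2 ⊗ A₃ ⊕ con 18) ∷ known) (h0 ∷ h1 ∷ known-holds)) h k) ∷ [])

  missing-short : pairs near ≤ 3 → 1000 ≤ a₁ + a₂ → 5 ≤ total-missing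
  missing-short t h with 2 * b₃ + 18 ≤? 999 | 2 * a₃ + 18 ≤? 999
  -- Now a₃ ≥ b₃ ≥ 491, and 1009 - 982 = 27 is left for c₃, exactly the margin between 973 and 1000.
  -- At most three cells are near, so at least six of the nine miss.
  ... | no p | _ = ≤-trans (+-cancelˡ-≤ (pairs near) 5 _ (≤-trans (+-monoˡ-≤ 5 t) (≤-trans (n≤1+n 8)
      (missing-near c₃ ((λ h0 → by (C₃ ⊑ con 27) (1 ∷ 1 ∷ 0 ∷ 0 ∷ 0 ∷ 0 ∷ 0 ∷ 0 ∷ 1 ∷ 1 ∷ []) ((con 1000 ⊑ 2 ⊗ B₃ ⊕ con 18) ∷ known) (h0 ∷ known-holds)) (≰⇒> p))))))
    (≤-trans (m≤m+n _ 0) (≤-trans (m≤n+m _ (missing b₃)) (m≤n+m _ (missing a₃))))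
  ... | yes p | yes q = ≤-trans (n≤1+n 5) (+-mono-≤ (two-missing h a₃ q) (+-mono-≤ (two-missing h b₃ p)
      (≤-trans (two-missing h c₃ ((λ h0 → by (2 ⊗ C₃ ⊕ con 18 ⊑ con 999) (1 ∷ 1 ∷ 0 ∷ 0 ∷ 0 ∷ 0 ∷ 0 ∷ 0 ∷ 0 ∷ 0 ∷ 2 ∷ []) ((2 ⊗ B₃ ⊕ con 18 ⊑ con 999) ∷ known) (h0 ∷ known-holds)) p)) (m≤m+n _ 0))))
  ... | yes p | no q = ≤-trans (+-mono-≤ (two-missing h b₃ p) (≤-trans (three-missing h (≰⇒> q)) (m≤m+n _ 0)))
      (m≤n+m _ (missing a₃))

  pairs-none : a₁ + a₂ ≤ 999 → pairs hit ≤ 0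
  pairs-none h = linarith (cells hit) (grid ⊑ con 0) (1 ∷ 1 ∷ 1 ∷ 1 ∷ 1 ∷ 1 ∷ 1 ∷ 1 ∷ 1 ∷ 1 ∷ [])
    ((AA ⊑ con 0) ∷ (AB ⊑ con 0) ∷ (AC ⊑ con 0) ∷ (BA ⊑ con 0) ∷ (BB ⊑ con 0) ∷ (BC ⊑ con 0)
      ∷ (CA ⊑ con 0) ∷ (CB ⊑ con 0) ∷ (CC ⊑ con 0) ∷ [])
    (no-hit a a′ ∷ no-hit a b′ ∷ no-hit a c′ ∷ no-hit b₁≤a₁ a′ ∷ no-hit b₁≤a₁ b′ ∷ no-hit b₁≤a₁ c′
      ∷ no-hit c a′ ∷ no-hit c b′ ∷ no-hit c c′ ∷ [])
    where
    no-hit : ∀ {u v} → u ≤ a₁ → v ≤ a₂ → hit (u + v) ≤ 0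
    no-hit p q = hit-0 (≤-trans (+-mono-≤ p q) h)
    a = ≤-refl {a₁}
    c = ≤-trans c₁≤b₁ b₁≤a₁
    a′ = ≤-refl {a₂}
    b′ = b₂≤a₂
    c′ = ≤-trans c₂≤b₂ b₂≤a₂

  pairs-hit : ∀ {k} → pairs near ≤ k → pairs hit ≤ k
  pairs-hit = ≤-trans (pairs-mono hit near hit≤near)

  -- For three triples (1, 0, 0) five pairs hit and eight transversals miss, which fixes the ratio.
  -- The square gives at most 4 against 7 and a short hook at most 3 against 5, both strictly
  -- better.
  pairs-vs-missing : 8 * pairs hit ≤ 5 * total-missing
  pairs-vs-missing with 973 ≤? b₁ + b₂
  ... | yes p = ≤-trans (*-monoʳ-≤ 8 (pairs-hit (square p))) (≤-trans (m≤m+n 32 3) (*-monoʳ-≤ 5 (missing-square p)))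
  ... | no p with 973 ≤? a₁ + c₂ ×-dec 973 ≤? b₁ + a₂ | 973 ≤? a₁ + b₂ ×-dec 973 ≤? c₁ + a₂
  ...   | yes (q , r) | _ = ≤-trans (*-monoʳ-≤ 8 (pairs-hit pairs-near≤5)) (*-monoʳ-≤ 5 (missing-hook₁ q r))
  ...   | no _ | yes (q , r) = ≤-trans (*-monoʳ-≤ 8 (pairs-hit pairs-near≤5)) (*-monoʳ-≤ 5 (missing-hook₂ q r))
  ...   | no q | no r with a₁ + a₂ ≤? 999
  ...     | yes s = ≤-trans (*-monoʳ-≤ 8 (pairs-none s)) z≤n
  ...     | no s = ≤-trans (*-monoʳ-≤ 8 (pairs-hit short)) (≤-trans (n≤1+n 24) (*-monoʳ-≤ 5 (missing-short short (≰⇒> s))))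
    where
    short : pairs near ≤ 3
    short = short-hook≤3 (≤-pred (≰⇒> p)) q r

  hits : ℕ
  hits = triple-sum a₃ b₃ c₃ λ w → pairs λ s → hit (s + w)

  singles : ℕ
  singles = triple-sum a₃ b₃ c₃ hit

  hits+missing : hits + total-missing ≤ 27
  hits+missing = subst (_≤ 27) (∑-+ T₃ (λ w → pairs λ s → hit (s + w)) missing)
    (∑-mono T₃ {g = λ _ → 9} λ w → subst (_≤ 9)
      (trans (∑-cong T₁ λ u → ∑-+ T₂ (λ v → hit (u + v + w)) (λ v → miss (u + v + w)))
        (∑-+ T₁ (λ u → ∑[ v ∈ T₂ ] hit (u + v + w)) (λ u → ∑[ v ∈ T₂ ] miss (u + v + w))))
      (pairs-mono (λ s → hit (s + w) + miss (s + w)) (λ _ → 1) λ s → hit-miss (s + w)))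
    where
    T₁ = a₁ ∷ b₁ ∷ c₁ ∷ []
    T₂ = a₂ ∷ b₂ ∷ c₂ ∷ []
    T₃ = a₃ ∷ b₃ ∷ c₃ ∷ []

  hits-pairs : 5 * hits + 8 * pairs hit ≤ 135
  hits-pairs = ≤-trans (+-monoʳ-≤ (5 * hits) pairs-vs-missing)
    (subst (_≤ 135) (*-distribˡ-+ 5 hits total-missing) (*-monoʳ-≤ 5 hits+missing))

  singles-cases : (singles ≤ 0) ⊎ (singles ≤ 1 × b₃ ≤ 9)
  singles-cases with a₃ ≤? 999
  ... | yes p = inj₁ (+-mono-≤ (hit-0 p) (+-mono-≤ (hit-0 ((λ h0 → by (B₃ ⊑ con 999) (1 ∷ 1 ∷ 0 ∷ 0 ∷ 0 ∷ 0 ∷ 0 ∷ 0 ∷ 0 ∷ 1 ∷ []) ((A₃ ⊑ con 999) ∷ known) (h0 ∷ known-holds)) p)) (+-mono-≤ (hit-0 ((λ h0 → by (C₃ ⊑ con 999) (3 ∷ 0 ∷ 0 ∷ 0 ∷ 0 ∷ 0 ∷ 0 ∷ 0 ∷ 1 ∷ 1 ∷ 2 ∷ []) ((A₃ ⊑ con 999) ∷ known) (h0 ∷ known-holds)) p)) (z≤n {0}))))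
  ... | no p = inj₂ (+-mono-≤ (𝟙≤1 (1000 ≤ᵇ a₃)) (+-mono-≤ (hit-0 ((by (B₃ ⊑ con 999) (2 ∷ 0 ∷ 0 ∷ 0 ∷ 0 ∷ 0 ∷ 0 ∷ 1 ∷ 1 ∷ []) (known) (known-holds)))) (+-mono-≤ (hit-0 ((by (C₃ ⊑ con 999) (3 ∷ 0 ∷ 0 ∷ 0 ∷ 0 ∷ 0 ∷ 0 ∷ 1 ∷ 1 ∷ 2 ∷ []) (known) (known-holds)))) (z≤n {0})))
      , (λ h0 → by (B₃ ⊑ con 9) (1 ∷ 1 ∷ 0 ∷ 0 ∷ 0 ∷ 0 ∷ 0 ∷ 0 ∷ 1 ∷ []) ((con 1000 ⊑ A₃) ∷ known) (h0 ∷ known-holds)) (≰⇒> p))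

  singles≤1 : singles ≤ 1
  singles≤1 with singles-cases
  ... | inj₁ p = ≤-trans p z≤n
  ... | inj₂ (p , _) = p

  -- If a₃ alone reaches 1000, then b₃ and c₃ are at most 9. In their layers every pair that is not
  -- near misses, and at least 9 - 5 = 4 pairs are not near.
  hits-singles : hits + 8 * singles ≤ 27
  hits-singles with singles-cases
  ... | inj₁ p = ≤-trans (+-mono-≤ (m≤m+n hits total-missing) (*-monoʳ-≤ 8 p))
                   (subst (_≤ 27) (sym (+-identityʳ (hits + total-missing))) hits+missing)
  ... | inj₂ (p , q) = ≤-trans (+-monoʳ-≤ hits (≤-trans (*-monoʳ-≤ 8 p) (missing-four-four
          (four (≤-trans q (m≤m+n 9 18))) (four ((λ h0 → by (C₃ ⊑ con 27) (1 ∷ 1 ∷ 0 ∷ 0 ∷ 0 ∷ 0 ∷ 0 ∷ 0 ∷ 0 ∷ 0 ∷ 1 ∷ []) ((B₃ ⊑ con 9) ∷ known) (h0 ∷ known-holds)) q))))) hits+missing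
    where
    four : ∀ {w} → w ≤ 27 → 4 ≤ missing w
    four {w} le = +-cancelˡ-≤ 5 4 _ (≤-trans (missing-near w le) (+-monoˡ-≤ (missing w) pairs-near≤5))

-- Matchings and weights

Triple : Set → Set
Triple A = A × A × A

flat : ∀ {A : Set} → List (Triple A) → List A
flat [] = []
flat ((a , b , c) ∷ L) = a ∷ b ∷ c ∷ flat L

length-flat : ∀ {A : Set} (L : List (Triple A)) → length (flat L) ≡ 3 * length L
length-flat [] = refl
length-flat (T ∷ L) = trans (cong (3 +_) (length-flat L)) (sym (*-suc 3 (length L)))

flat-↭ : ∀ {A : Set} {L M : List (Triple A)} → L ↭ M → flat L ↭ flat M
flat-↭ Perm.refl = ↭-refl
flat-↭ (Perm.prep (a , b , c) p) = Perm.prep a (Perm.prep b (Perm.prep c (flat-↭ p)))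
flat-↭ (Perm.swap {xs} {ys} (a , b , c) (d , e , f) p) =
  ↭-trans (move a (↭-trans (move b (↭-trans (move c ↭-refl) ↭-refl)) ↭-refl))
    (Perm.prep d (Perm.prep e (Perm.prep f (Perm.prep a (Perm.prep b (Perm.prep c (flat-↭ p)))))))
  where
  move : ∀ x {us vs} → us ↭ d ∷ e ∷ f ∷ vs → x ∷ us ↭ d ∷ e ∷ f ∷ x ∷ vs
  move x {us} {vs} q = ↭-trans (Perm.prep x q) (↭-sym (shift x (d ∷ e ∷ f ∷ []) vs))
flat-↭ (Perm.trans p q) = ↭-trans (flat-↭ p) (flat-↭ q)

count : ∀ {K} → Fin K → List (Fin K) → ℕ
count c xs = ∑[ x ∈ xs ] 𝟙 (x == c)

∑-count : ∀ {K} (xs : List (Fin K)) (f : Fin K → ℕ) → (∑[ c ∈ allFin K ] count c xs * f c) ≡ ∑ xs f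
∑-count {K} xs f = sym (trans (∑-fibres (λ x → x) xs (λ c _ → f c))
  (∑-cong (allFin K) λ c → ∑-*ʳ xs (f c) (λ x → 𝟙 (x == c))))

length-counts : ∀ {K} (xs : List (Fin K)) → length xs ≡ (∑[ c ∈ allFin K ] count c xs)
length-counts {K} xs = trans (length-∑ xs) (trans (sym (∑-count xs (λ _ → 1)))
  (∑-cong (allFin K) λ c → *-identityʳ (count c xs)))

+-∸-≤ : ∀ m k q → (m + k) ∸ q ≤ (m ∸ q) + k
+-∸-≤ m k q = m≤n+o⇒m∸n≤o (m + k) q (≤-trans (+-monoˡ-≤ k (m≤n+m∸n m q)) (≤-reflexive (+-assoc q (m ∸ q) k)))

-- A discrete substitute for LP duality. Given capacities Q, a list L of admissible triples is improved
-- by adding a triple of marginal cost below B or removing one of marginal cost above B, where the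
-- convex penalty Ψ charges 1 + 2 + ... + e for exceeding a capacity by e.
module LocalSearch {K : ℕ} (Q : Fin K → ℕ) (B : ℕ) (admissible : Triple (Fin K) → Bool) where

  C = Fin K

  cost : C → List C → ℕ
  cost x xs = suc (count x xs) ∸ Q x

  Ψ : List C → ℕ
  Ψ [] = 0
  Ψ (x ∷ xs) = cost x xs + Ψ xs

  cost-swap : ∀ x y xs → cost x (y ∷ xs) + cost y xs ≡ cost y (x ∷ xs) + cost x xs
  cost-swap x y xs with x F.≟ y
  ... | yes refl rewrite ==-refl x = refl
  ... | no p rewrite ==-≢ (≢-sym p) = +-comm (cost x xs) (cost y xs)

  cost-↭ : ∀ x {xs ys} → xs ↭ ys → cost x xs ≡ cost x ys
  cost-↭ x p = cong (λ n → suc n ∸ Q x) (∑-↭ (λ y → 𝟙 (y == x)) p)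

  Ψ-↭ : ∀ {xs ys} → xs ↭ ys → Ψ xs ≡ Ψ ys
  Ψ-↭ Perm.refl = refl
  Ψ-↭ (Perm.prep x p) = cong₂ _+_ (cost-↭ x p) (Ψ-↭ p)
  Ψ-↭ (Perm.swap {xs} {ys} x y p) rewrite cost-↭ x (Perm.prep y p) | cost-↭ y p | Ψ-↭ p =
    trans (sym (+-assoc (cost x (y ∷ ys)) (cost y ys) (Ψ ys)))
      (trans (cong (_+ Ψ ys) (cost-swap x y ys)) (+-assoc (cost y (x ∷ ys)) (cost x ys) (Ψ ys)))
  Ψ-↭ (Perm.trans p q) = trans (Ψ-↭ p) (Ψ-↭ q)

  excess : List C → C → ℕ
  excess xs c = count c xs ∸ Q c

  weight : List C → Triple C → ℕ
  weight xs (a , b , c) = excess xs a + excess xs b + excess xs c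

  marginal : Triple C → List C → ℕ
  marginal (a , b , c) xs = cost a (b ∷ c ∷ xs) + (cost b (c ∷ xs) + cost c xs)

  count-∷ : ∀ (c x : C) xs → count c (x ∷ xs) ≤ suc (count c xs)
  count-∷ c x xs = +-monoˡ-≤ (count c xs) (𝟙≤1 (x == c))

  count-self : ∀ (c : C) xs → count c (c ∷ xs) ≡ suc (count c xs)
  count-self c xs rewrite ==-refl c = refl

  -- The colours are charged one after the other. If they coincide, the loads exceed those of `xs`
  -- by up to 3, 2 and 1, whence 6.
  marginal≤weight : ∀ T xs → marginal T xs ≤ weight xs T + 6
  marginal≤weight (a , b , c) xs = begin
    cost a (b ∷ c ∷ xs) + (cost b (c ∷ xs) + cost c xs)
      ≤⟨ +-mono-≤ (at-most a 3 (s≤s (≤-trans (count-∷ a b (c ∷ xs)) (s≤s (count-∷ a c xs)))))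
         (+-mono-≤ (at-most b 2 (s≤s (count-∷ b c xs))) (at-most c 1 ≤-refl)) ⟩
    (excess xs a + 3) + ((excess xs b + 2) + (excess xs c + 1))
      ≡⟨ e (excess xs a) (excess xs b) (excess xs c) ⟩
    weight xs (a , b , c) + 6 ∎
    where
    open ≤-Reasoning
    e : ∀ x y z → (x + 3) + ((y + 2) + (z + 1)) ≡ x + y + z + 6
    e = solve-∀
    at-most : ∀ x k {n} → n ≤ k + count x xs → n ∸ Q x ≤ excess xs x + k
    at-most x k le = ≤-trans (∸-monoˡ-≤ (Q x) (≤-trans le (≤-reflexive (+-comm k (count x xs)))))
      (+-∸-≤ (count x xs) k (Q x))

  -- Here the excess is measured after all three colours have been added: a was charged last and has
  -- its final load, while b and c may still have grown by 1 and 2 after they were charged.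
  weight≤marginal : ∀ a b c xs → weight (a ∷ b ∷ c ∷ xs) (a , b , c) ≤ marginal (a , b , c) xs + 3
  weight≤marginal a b c xs = begin
    excess (a ∷ b ∷ c ∷ xs) a + excess (a ∷ b ∷ c ∷ xs) b + excess (a ∷ b ∷ c ∷ xs) c
      ≤⟨ +-mono-≤ (+-mono-≤ (at-most a (b ∷ c ∷ xs) 0 (≤-reflexive (count-self a (b ∷ c ∷ xs))))
           (at-most b (c ∷ xs) 1 (≤-trans (count-∷ b a (b ∷ c ∷ xs)) (s≤s (≤-reflexive (count-self b (c ∷ xs)))))))
           (at-most c xs 2 (≤-trans (count-∷ c a (b ∷ c ∷ xs)) (s≤s (≤-trans (count-∷ c b (c ∷ xs)) (s≤s (≤-reflexive (count-self c xs))))))) ⟩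
    (cost a (b ∷ c ∷ xs) + 0) + (cost b (c ∷ xs) + 1) + (cost c xs + 2)
      ≡⟨ e (cost a (b ∷ c ∷ xs)) (cost b (c ∷ xs)) (cost c xs) ⟩
    marginal (a , b , c) xs + 3 ∎
    where
    open ≤-Reasoning
    e : ∀ x y z → (x + 0) + (y + 1) + (z + 2) ≡ (x + (y + z)) + 3
    e = solve-∀
    at-most : ∀ x ys k {n} → n ≤ k + suc (count x ys) → n ∸ Q x ≤ cost x ys + k
    at-most x ys k le = ≤-trans (∸-monoˡ-≤ (Q x) (≤-trans le (≤-reflexive (+-comm k (suc (count x ys))))))
      (+-∸-≤ (suc (count x ys)) k (Q x))

  Ψ-flat : ∀ T L → Ψ (flat (T ∷ L)) ≡ marginal T (flat L) + Ψ (flat L)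
  Ψ-flat (a , b , c) L = e (cost a (b ∷ c ∷ flat L)) (cost b (c ∷ flat L)) (cost c (flat L)) (Ψ (flat L))
    where
    e : ∀ x y z w → x + (y + (z + w)) ≡ (x + (y + z)) + w
    e = solve-∀

  record Bounded (xs : List C) : Set where
    constructor bounds
    field load≤ : ∀ c → count c xs ≤ Q c + B
  open Bounded

  bounded-∷ : ∀ x {xs} → Bounded xs → cost x xs ≤ B → Bounded (x ∷ xs)
  bounded-∷ x {xs} b le = bounds λ c → go c (x F.≟ c)
    where
    go : ∀ c → Dec (x ≡ c) → count c (x ∷ xs) ≤ Q c + B
    go c (yes refl) rewrite ==-refl x = ≤-trans (m≤n+m∸n (suc (count x xs)) (Q x)) (+-monoʳ-≤ (Q x) le)
    go c (no p) rewrite ==-≢ p = load≤ b c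

  bounded-drop : ∀ x {xs} → Bounded (x ∷ xs) → Bounded xs
  bounded-drop x b = bounds λ c → ≤-trans (m≤n+m _ (𝟙 (x == c))) (load≤ b c)

  bounded-↭ : ∀ {xs ys} → xs ↭ ys → Bounded xs → Bounded ys
  bounded-↭ p b = bounds λ c → subst (_≤ Q c + B) (∑-↭ (λ y → 𝟙 (y == c)) p) (load≤ b c)

  cap : ℕ
  cap = ∑[ c ∈ allFin K ] (Q c + B)

  length≤cap : ∀ L → Bounded (flat L) → length L ≤ cap
  length≤cap L b = ≤-trans (m≤n*m (length L) 3) (subst (_≤ cap) (trans (sym (length-counts (flat L))) (length-flat L))
    (∑-mono (allFin K) (load≤ b)))

  -- The objective is the penalty minus B for each chosen triple, shifted by `B * cap` to make it a
  -- natural number.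
  potential : List (Triple C) → ℕ
  potential L = Ψ (flat L) + B * (cap ∸ length L)

  potential-∷ : ∀ T L → Bounded (flat (T ∷ L)) →
    potential L + marginal T (flat L) ≡ potential (T ∷ L) + B
  potential-∷ T L b rewrite Ψ-flat T L | +-∸-assoc 1 (length≤cap (T ∷ L) b) =
    e (Ψ (flat L)) B (cap ∸ suc (length L)) (marginal T (flat L))
    where
    e : ∀ p b k m → (p + b * (1 + k)) + m ≡ ((m + p) + b * k) + b
    e = solve-∀

  record Optimum : Set where
    field
      L          : List (Triple C)
      allowed    : All (λ T₀ → T (admissible T₀)) L
      bounded    : Bounded (flat L)
      covers     : ∀ T₀ → T (admissible T₀) → B ≤ weight (flat L) T₀ + 6
      tight      : All (λ T₀ → weight (flat L) T₀ ≤ B + 3) L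

  -- Both moves strictly decrease `potential`. An addition preserves `Bounded` because a marginal
  -- cost below B charges each of the three colours at most B; a removal only lowers loads.
  search : ∀ fuel L → potential L < fuel → All (λ T₀ → T (admissible T₀)) L → Bounded (flat L) → Optimum
  search (suc fuel) L lt al bd
    with F.any? (λ a → F.any? λ b → F.any? λ c → T? (admissible (a , b , c)) ×-dec (marginal (a , b , c) (flat L) <? B))
  ... | yes (a , b , c , t , cheap) =
    search fuel ((a , b , c) ∷ L) (<-≤-trans dec (≤-pred lt)) (t ∷ al) bd′
    where
    m₁ = cost a (b ∷ c ∷ flat L)
    m₂ = cost b (c ∷ flat L)
    m₃ = cost c (flat L)
    le : m₁ + (m₂ + m₃) ≤ B
    le = <⇒≤ cheap
    bd′ = bounded-∷ a (bounded-∷ b (bounded-∷ c bd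
      (≤-trans (≤-trans (m≤n+m m₃ m₂) (m≤n+m (m₂ + m₃) m₁)) le))
      (≤-trans (≤-trans (m≤m+n m₂ m₃) (m≤n+m (m₂ + m₃) m₁)) le))
      (≤-trans (m≤m+n m₁ (m₂ + m₃)) le)
    dec : potential ((a , b , c) ∷ L) < potential L
    dec = +-cancelʳ-< B _ _ (subst (_< potential L + B) (potential-∷ (a , b , c) L bd′) (+-monoʳ-< (potential L) cheap))
  ... | no expensive with Any.any? (λ T₀ → B + 3 <? weight (flat L) T₀) L
  ...   | yes some with find some
  ...     | ((a , b , c) , T∈ , heavy) with ∈-∃++ T∈
  ...       | xs , ys , refl =
    search fuel (xs ++ ys) (<-≤-trans dec (≤-pred lt)) (All.tail (All-resp-↭ perm al)) (bounded-drop c (bounded-drop b (bounded-drop a bd′)))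
    where
    T₀ = a , b , c
    perm : xs ++ T₀ ∷ ys ↭ T₀ ∷ xs ++ ys
    perm = shift T₀ xs ys
    bd′ = bounded-↭ (flat-↭ perm) bd
    heavy′ : B < marginal T₀ (flat (xs ++ ys))
    heavy′ = +-cancelʳ-< 3 _ _ (<-≤-trans heavy (subst (_≤ marginal T₀ (flat (xs ++ ys)) + 3)
      (sym (cong₂ _+_ (cong₂ _+_ (same a) (same b)) (same c)))
      (weight≤marginal a b c (flat (xs ++ ys)))))
      where
      same : ∀ d → excess (flat (xs ++ T₀ ∷ ys)) d ≡ excess (flat (T₀ ∷ xs ++ ys)) d
      same d = cong (_∸ Q d) (∑-↭ (λ y → 𝟙 (y == d)) (flat-↭ perm))
    potential-perm : potential (xs ++ T₀ ∷ ys) ≡ potential (T₀ ∷ xs ++ ys)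
    potential-perm = cong₂ (λ x y → x + B * (cap ∸ y)) (Ψ-↭ (flat-↭ perm)) (trans (length-∑ (xs ++ T₀ ∷ ys))
      (trans (∑-↭ (λ _ → 1) perm) (sym (length-∑ (T₀ ∷ xs ++ ys)))))
    dec : potential (xs ++ ys) < potential (xs ++ T₀ ∷ ys)
    dec = subst (potential (xs ++ ys) <_) (sym potential-perm)
      (+-cancelʳ-< (marginal T₀ (flat (xs ++ ys))) _ _
        (subst (_< potential (T₀ ∷ xs ++ ys) + marginal T₀ (flat (xs ++ ys)))
          (sym (potential-∷ T₀ (xs ++ ys) bd′)) (+-monoʳ-< (potential (T₀ ∷ xs ++ ys)) heavy′)))
  search (suc fuel) L lt al bd | no expensive | no none = record
    { L = L ; allowed = al ; bounded = bd
    ; covers = λ (a , b , c) t → ≤-trans (≮⇒≥ λ lt′ → expensive (a , b , c , t , lt′)) (marginal≤weight (a , b , c) (flat L))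
    ; tight = All.map ≮⇒≥ (All.¬Any⇒All¬ L none) }

  abstract
    optimum : Optimum
    optimum = search (suc (potential [])) [] ≤-refl [] (bounds λ c → z≤n)

-- Volume of the heavy boxes

record Light (X : List ℕ) : Set where
  field
    {a b c} : ℕ
    order   : X ↭ a ∷ b ∷ c ∷ []
    ordered : Sorted a b c
open Light using (order; ordered)

light : ∀ a b c → a + b + c ≤ 1009 → Light (a ∷ b ∷ c ∷ [])
light a b c le with ≤-total a b | ≤-total b c | ≤-total a c
... | inj₂ ba | inj₂ cb | _ = record { order = ↭-refl ; ordered = sorted le ba cb }
... | inj₂ ba | inj₁ bc | inj₂ ca = record { order = Perm.prep a (Perm.swap b c ↭-refl)
  ; ordered = sorted (subst (_≤ 1009) (e a b c) le) ca bc }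
  where e : ∀ a b c → a + b + c ≡ a + c + b
        e = solve-∀
... | inj₂ ba | inj₁ bc | inj₁ ac = record { order = ↭-trans (Perm.prep a (Perm.swap b c ↭-refl)) (Perm.swap a c ↭-refl)
  ; ordered = sorted (subst (_≤ 1009) (e a b c) le) ac ba }
  where e : ∀ a b c → a + b + c ≡ c + a + b
        e = solve-∀
... | inj₁ ab | inj₁ bc | _ = record { order = ↭-trans (Perm.prep a (Perm.swap b c ↭-refl)) (↭-trans (Perm.swap a c ↭-refl) (Perm.prep c (Perm.swap a b ↭-refl)))
  ; ordered = sorted (subst (_≤ 1009) (e a b c) le) bc ab }
  where e : ∀ a b c → a + b + c ≡ c + b + a
        e = solve-∀
... | inj₁ ab | inj₂ cb | inj₁ ac = record { order = ↭-trans (Perm.swap a b ↭-refl) (Perm.prep b (Perm.swap a c ↭-refl))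
  ; ordered = sorted (subst (_≤ 1009) (e a b c) le) cb ac }
  where e : ∀ a b c → a + b + c ≡ b + c + a
        e = solve-∀
... | inj₁ ab | inj₂ cb | inj₂ ca = record { order = Perm.swap a b ↭-refl
  ; ordered = sorted (subst (_≤ 1009) (e a b c) le) ab ca }
  where e : ∀ a b c → a + b + c ≡ b + a + c
        e = solve-∀

hits₃ : List ℕ → List ℕ → List ℕ → ℕ
hits₃ Z X Y = ∑[ z ∈ Z ] ∑[ x ∈ X ] ∑[ y ∈ Y ] hit (x + y + z)

hits₂ : List ℕ → List ℕ → ℕ
hits₂ X Y = ∑[ x ∈ X ] ∑[ y ∈ Y ] hit (x + y)

hits₁ : List ℕ → ℕ
hits₁ X = ∑[ x ∈ X ] hit x

∑∑-↭ : ∀ {X Y X′ Y′ : List ℕ} (f : ℕ → ℕ → ℕ) → X ↭ X′ → Y ↭ Y′ →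
  (∑[ x ∈ X ] ∑[ y ∈ Y ] f x y) ≡ (∑[ x ∈ X′ ] ∑[ y ∈ Y′ ] f x y)
∑∑-↭ {X} {Y} {X′} {Y′} f p q = trans (∑-cong X λ x → ∑-↭ (f x) q) (∑-↭ (λ x → ∑ Y′ (f x)) p)

module _ {X Y Z : List ℕ} (lx : Light X) (ly : Light Y) (lz : Light Z) where
  private
    module H = Heart (ordered lx) (ordered ly) (ordered lz)

    hits₃-sorted : hits₃ Z X Y ≡ H.hits
    hits₃-sorted = trans (∑-cong Z λ z → ∑∑-↭ (λ x y → hit (x + y + z)) (order lx) (order ly)) (∑-↭ _ (order lz))

    hits₂-sorted : hits₂ X Y ≡ H.pairs hit
    hits₂-sorted = ∑∑-↭ (λ x y → hit (x + y)) (order lx) (order ly)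

  heart-pairs : 5 * hits₃ Z X Y + 8 * hits₂ X Y ≤ 135
  heart-pairs = subst₂ (λ h p → 5 * h + 8 * p ≤ 135) (sym hits₃-sorted) (sym hits₂-sorted) H.hits-pairs

  heart-singles : hits₃ Z X Y + 8 * hits₁ Z ≤ 27
  heart-singles = subst₂ (λ h p → h + 8 * p ≤ 27) (sym hits₃-sorted) (sym (∑-↭ hit (order lz))) H.hits-singles

  hits₂≤5 : hits₂ X Y ≤ 5
  hits₂≤5 = subst (_≤ 5) (sym hits₂-sorted) (H.pairs-hit H.pairs-near≤5)

  hits₁≤1 : hits₁ Z ≤ 1
  hits₁≤1 = subst (_≤ 1) (sym (∑-↭ hit (order lz))) H.singles≤1

-- 19k³ + 15Zk² + 3Z²k is (3k + Z)³ - (2k + Z)³.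
star-bound : ℕ → ℕ → ℕ
star-bound k Z = 19 * (k * k * k) + (15 * (Z * (k * k)) + 3 * (Z * Z * k))

-- The averages of S₂ and S₁ are controlled by the deficiency D = 27k³ - S₃, so the left side is
-- essentially linear in D and therefore largest at D = 0 or at D = 8k³.
clique-or-star⁺ : ∀ k .{{_ : NonZero k}} Z S₁ S₂ S₃ →
  5 * S₃ + 8 * (k * S₂) ≤ 135 * (k * k * k) → S₃ + 8 * (k * k * S₁) ≤ 27 * (k * k * k) →
  S₂ ≤ 5 * (k * k) → S₁ ≤ k →
  S₃ + (3 * (Z * S₂) + 3 * (Z * Z * S₁)) ≤ 27 * (k * k * k) ⊎
  S₃ + (3 * (Z * S₂) + 3 * (Z * Z * S₁)) ≤ star-bound k Z
clique-or-star⁺ k Z S₁ S₂ S₃ h₁ h₂ h₃ h₄ = cases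
  where
  open ≤-Reasoning
  instance
    k²≢0 : NonZero (8 * (k * k))
    k²≢0 = m*n≢0 8 (k * k) {{_}} {{m*n≢0 k k}}
  c = k * k * k
  P = 15 * (Z * k) + 3 * (Z * Z)
  rest = 3 * (Z * S₂) + 3 * (Z * Z * S₁)
  D = 27 * c ∸ S₃

  S₃+D : S₃ + D ≡ 27 * c
  S₃+D = m+[n∸m]≡n (m+n≤o⇒m≤o S₃ h₂)

  pairs≤ : 8 * (k * S₂) ≤ 5 * D
  pairs≤ = +-cancelˡ-≤ (5 * S₃) _ _ (≤-trans h₁ (≤-reflexive (trans (e c) (trans (cong (5 *_) (sym S₃+D)) (*-distribˡ-+ 5 S₃ D)))))
    where e : ∀ c → 135 * c ≡ 5 * (27 * c)
          e = solve-∀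

  singles≤ : 8 * (k * k * S₁) ≤ D
  singles≤ = +-cancelˡ-≤ S₃ _ _ (≤-trans h₂ (≤-reflexive (sym S₃+D)))

  rest≤ : 8 * (k * k) * rest ≤ P * D
  rest≤ = begin
    8 * (k * k) * rest                                                     ≡⟨ e₁ k Z S₁ S₂ ⟩
    3 * (Z * k) * (8 * (k * S₂)) + 3 * (Z * Z) * (8 * (k * k * S₁))        ≤⟨ +-mono-≤ (*-monoʳ-≤ (3 * (Z * k)) pairs≤) (*-monoʳ-≤ (3 * (Z * Z)) singles≤) ⟩
    3 * (Z * k) * (5 * D) + 3 * (Z * Z) * D                                ≡⟨ e₂ k Z D ⟩
    P * D                                                                  ∎
    where
    e₁ : ∀ k Z S₁ S₂ → 8 * (k * k) * (3 * (Z * S₂) + 3 * (Z * Z * S₁)) ≡ 3 * (Z * k) * (8 * (k * S₂)) + 3 * (Z * Z) * (8 * (k * k * S₁))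
    e₁ = solve-∀
    e₂ : ∀ k Z D → 3 * (Z * k) * (5 * D) + 3 * (Z * Z) * D ≡ (15 * (Z * k) + 3 * (Z * Z)) * D
    e₂ = solve-∀

  cases : S₃ + rest ≤ 27 * c ⊎ S₃ + rest ≤ star-bound k Z
  -- The left side is at most 27k³ - D + P D / 8k². If P ≤ 8k², this is largest at D = 0 and the
  -- clique wins. Otherwise it grows up to D = 8k³, the value of the star; beyond that point the
  -- trivial bounds on S₂ and S₁ are used instead.
  cases with ≤-total P (8 * (k * k)) | ≤-total (8 * c) D
  ... | inj₁ p | _ = inj₁ (≤-trans (+-monoʳ-≤ S₃ (*-cancelˡ-≤ (8 * (k * k)) (≤-trans rest≤ (*-monoˡ-≤ D p)))) (≤-reflexive S₃+D))
  ... | inj₂ p | inj₁ q = inj₂ (+-mono-≤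
      (+-cancelʳ-≤ (8 * c) S₃ (19 * c) (≤-trans (+-monoʳ-≤ S₃ q) (≤-reflexive (trans S₃+D (*-distribʳ-+ c 19 8)))))
      (+-mono-≤ (≤-trans (*-monoʳ-≤ 3 (*-monoʳ-≤ Z h₃)) (≤-reflexive (e Z (k * k)))) (*-monoʳ-≤ 3 (*-monoʳ-≤ (Z * Z) h₄))))
    where e : ∀ Z q → 3 * (Z * (5 * q)) ≡ 15 * (Z * q)
          e = solve-∀
  ... | inj₂ p | inj₂ q = inj₂ (begin
      S₃ + rest              ≡⟨ cong (_+ rest) S₃≡ ⟩
      19 * c + g + rest      ≡⟨ +-assoc (19 * c) g rest ⟩
      19 * c + (g + rest)    ≤⟨ +-monoʳ-≤ (19 * c) (*-cancelˡ-≤ (8 * (k * k)) scaled) ⟩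
      star-bound k Z         ∎)
    where
    g = 8 * c ∸ D
    g+D : g + D ≡ 8 * c
    g+D = m∸n+n≡m q
    S₃≡ : S₃ ≡ 19 * c + g
    S₃≡ = +-cancelʳ-≡ D S₃ (19 * c + g) (trans S₃+D (trans (*-distribʳ-+ c 19 8)
      (trans (cong (19 * c +_) (sym g+D)) (sym (+-assoc (19 * c) g D)))))
    scaled : 8 * (k * k) * (g + rest) ≤ 8 * (k * k) * (15 * (Z * (k * k)) + 3 * (Z * Z * k))
    scaled = begin
      8 * (k * k) * (g + rest)                      ≡⟨ *-distribˡ-+ (8 * (k * k)) g rest ⟩
      8 * (k * k) * g + 8 * (k * k) * rest          ≤⟨ +-mono-≤ (*-monoˡ-≤ g p) rest≤ ⟩
      P * g + P * D                                 ≡⟨ *-distribˡ-+ P g D ⟨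
      P * (g + D)                                   ≡⟨ cong (P *_) g+D ⟩
      P * (8 * c)                                   ≡⟨ e k Z ⟩
      8 * (k * k) * (15 * (Z * (k * k)) + 3 * (Z * Z * k)) ∎
      where
      e : ∀ k Z → (15 * (Z * k) + 3 * (Z * Z)) * (8 * (k * k * k)) ≡ 8 * (k * k) * (15 * (Z * (k * k)) + 3 * (Z * Z * k))
      e = solve-∀

clique-or-star : ∀ k Z S₁ S₂ S₃ →
  5 * S₃ + 8 * (k * S₂) ≤ 135 * (k * k * k) → S₃ + 8 * (k * k * S₁) ≤ 27 * (k * k * k) →
  S₂ ≤ 5 * (k * k) → S₁ ≤ k →
  S₃ + (3 * (Z * S₂) + 3 * (Z * Z * S₁)) ≤ 27 * (k * k * k) ⊎
  S₃ + (3 * (Z * S₂) + 3 * (Z * Z * S₁)) ≤ star-bound k Z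
clique-or-star zero Z S₁ S₂ S₃ _ h₂ h₃ h₄ with n≤0⇒n≡0 h₃ | n≤0⇒n≡0 h₄ | n≤0⇒n≡0 (m+n≤o⇒m≤o S₃ h₂)
... | refl | refl | refl rewrite *-zeroʳ Z | *-zeroʳ (Z * Z) = inj₁ z≤n
clique-or-star (suc n) = clique-or-star⁺ (suc n)

module Counting {K : ℕ} (Q : Fin K → ℕ) (admissible : Triple (Fin K) → Bool)
  (O : LocalSearch.Optimum Q 1006 admissible) where
  open LocalSearch Q 1006 admissible
  open Optimum O

  k : ℕ
  k = length L

  w : C → ℕ
  w = excess (flat L)

  slack : ℕ
  slack = ∑[ c ∈ allFin K ] (Q c ∸ count c (flat L))

  load : ∀ c → count c (flat L) ≤ Q c + 1006
  load = Bounded.load≤ bounded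

  private
    ws : Triple C → List ℕ
    ws (a , b , c) = w a ∷ w b ∷ w c ∷ []

    all-light : All (λ t → Light (ws t)) L
    all-light = All.map (λ {t} → lt t) tight
      where lt : ∀ t → weight (flat L) t ≤ 1009 → Light (ws t)
            lt (a , b , c) = light (w a) (w b) (w c)

    ∑-flat : ∀ (L : List (Triple C)) (f : ℕ → ℕ) → (∑[ x ∈ flat L ] f (w x)) ≡ (∑[ t ∈ L ] ∑ (ws t) f)
    ∑-flat [] f = refl
    ∑-flat ((a , b , c) ∷ L) f = trans (cong (λ s → f (w a) + (f (w b) + (f (w c) + s))) (∑-flat L f)) (e (f (w a)) (f (w b)) (f (w c)) _)
      where e : ∀ a b c s → a + (b + (c + s)) ≡ a + (b + (c + 0)) + s
            e = solve-∀

    -- Summation over all points of the weighted colour space: the matched points with their weights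
    -- and `slack` further points of weight 0.
    E : (ℕ → ℕ) → ℕ
    E f = (∑[ x ∈ flat L ] f (w x)) + slack * f 0

    -- An unsaturated colour has weight 0, so the unused capacity may be counted at weight 0.
    transfer : ∀ f → (∑[ c ∈ allFin K ] Q c * f (w c)) ≤ E f
    transfer f = begin
      (∑[ c ∈ allFin K ] Q c * f (w c))
        ≤⟨ ∑-mono (allFin K) pointwise ⟩
      (∑[ c ∈ allFin K ] (count c (flat L) * f (w c) + (Q c ∸ count c (flat L)) * f 0))
        ≡⟨ ∑-+ (allFin K) (λ c → count c (flat L) * f (w c)) (λ c → (Q c ∸ count c (flat L)) * f 0) ⟩
      (∑[ c ∈ allFin K ] count c (flat L) * f (w c)) + (∑[ c ∈ allFin K ] (Q c ∸ count c (flat L)) * f 0)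
        ≡⟨ cong₂ _+_ (∑-count (flat L) (λ c → f (w c))) (∑-*ʳ (allFin K) (f 0) (λ c → Q c ∸ count c (flat L))) ⟩
      E f ∎
      where
      open ≤-Reasoning
      pointwise : ∀ c → Q c * f (w c) ≤ count c (flat L) * f (w c) + (Q c ∸ count c (flat L)) * f 0
      pointwise c with ≤-total (count c (flat L)) (Q c)
      ... | inj₁ le rewrite m≤n⇒m∸n≡0 le = ≤-reflexive (trans (cong (_* f 0) (sym (m+[n∸m]≡n le))) (*-distribʳ-+ (f 0) (count c (flat L)) (Q c ∸ count c (flat L))))
      ... | inj₂ ge = ≤-trans (*-monoˡ-≤ (f (w c)) ge) (m≤m+n _ _)

    S₁ S₂ S₃ : ℕ
    S₁ = ∑[ t ∈ L ] hits₁ (ws t)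
    S₂ = ∑[ t ∈ L ] ∑[ u ∈ L ] hits₂ (ws t) (ws u)
    S₃ = ∑[ v ∈ L ] ∑[ t ∈ L ] ∑[ u ∈ L ] hits₃ (ws v) (ws t) (ws u)

    ∑∑-flat : ∀ (f : ℕ → ℕ → ℕ) → (∑[ x ∈ flat L ] ∑[ y ∈ flat L ] f (w x) (w y)) ≡
      (∑[ t ∈ L ] ∑[ u ∈ L ] ∑[ x ∈ ws t ] ∑[ y ∈ ws u ] f x y)
    ∑∑-flat f = trans (∑-cong (flat L) λ x → ∑-flat L (f (w x)))
      (trans (∑-flat L λ x → ∑[ u ∈ L ] ∑[ y ∈ ws u ] f x y)
        (∑-cong L λ t → ∑-swap (ws t) L λ x u → ∑[ y ∈ ws u ] f x y))

    flat₁ : (∑[ x ∈ flat L ] hit (w x)) ≡ S₁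
    flat₁ = ∑-flat L hit

    flat₂ : (∑[ x ∈ flat L ] ∑[ y ∈ flat L ] hit (w x + w y)) ≡ S₂
    flat₂ = ∑∑-flat (λ x y → hit (x + y))

    flat₃ : (∑[ z ∈ flat L ] ∑[ x ∈ flat L ] ∑[ y ∈ flat L ] hit (w x + w y + w z)) ≡ S₃
    flat₃ = trans (∑-cong (flat L) λ z → ∑∑-flat (λ x y → hit (x + y + w z)))
      (trans (∑-flat L λ z → ∑[ t ∈ L ] ∑[ u ∈ L ] ∑[ x ∈ ws t ] ∑[ y ∈ ws u ] hit (x + y + z))
        (∑-cong L λ v → trans (∑-swap (ws v) L λ z t → ∑[ u ∈ L ] ∑[ x ∈ ws t ] ∑[ y ∈ ws u ] hit (x + y + z))
          (∑-cong L λ t → ∑-swap (ws v) L λ z u → ∑[ x ∈ ws t ] ∑[ y ∈ ws u ] hit (x + y + z))))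

    -- The terms are sorted by the number of coordinates of weight 0. One or two such coordinates
    -- can be placed in three ways, and three of them never hit.
    expand : E (λ z → E λ x → E λ y → hit (x + y + z)) ≡ S₃ + (3 * (slack * S₂) + 3 * (slack * slack * S₁))
    expand = begin
      E (λ z → E λ x → E λ y → hit (x + y + z))
        ≡⟨ cong₂ (λ a b → a + slack * b) (trans (∑-cong (flat L) λ z → E² (w z)) outer) E²-0 ⟩
      (S₃ + 2 * (slack * S₂) + slack * slack * S₁) + slack * (S₂ + 2 * (slack * S₁))
        ≡⟨ e slack S₁ S₂ S₃ ⟩
      S₃ + (3 * (slack * S₂) + 3 * (slack * slack * S₁)) ∎
      where
      open ≡-Reasoning
      e : ∀ Z a b c → (c + 2 * (Z * b) + Z * Z * a) + Z * (b + 2 * (Z * a)) ≡ c + (3 * (Z * b) + 3 * (Z * Z * a))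
      e = solve-∀
      F₂ F₁ : ℕ → ℕ
      F₂ z = ∑[ x ∈ flat L ] ∑[ y ∈ flat L ] hit (w x + w y + z)
      F₁ z = ∑[ x ∈ flat L ] hit (w x + z)
      E² : ∀ z → (E λ x → E λ y → hit (x + y + z)) ≡ F₂ z + 2 * (slack * F₁ z) + slack * slack * hit z
      E² z = trans (cong₂ (λ a b → a + slack * b)
          (trans (∑-+ (flat L) _ _) (cong (F₂ z +_) (trans (∑-*ˡ (flat L) slack _) (cong (slack *_)
            (∑-cong (flat L) λ x → cong (λ s → hit (s + z)) (+-identityʳ (w x)))))))
          refl) (e′ slack (F₂ z) (F₁ z) (hit z))
        where e′ : ∀ Z a b c → (a + Z * b) + Z * (b + Z * c) ≡ a + 2 * (Z * b) + Z * Z * c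
              e′ = solve-∀
      outer : (∑[ z ∈ flat L ] (F₂ (w z) + 2 * (slack * F₁ (w z)) + slack * slack * hit (w z))) ≡ S₃ + 2 * (slack * S₂) + slack * slack * S₁
      outer = trans (∑-+ (flat L) _ _) (cong₂ _+_
        (trans (∑-+ (flat L) _ _) (cong₂ _+_ flat₃
          (trans (∑-*ˡ (flat L) 2 _) (cong (2 *_) (trans (∑-*ˡ (flat L) slack _) (cong (slack *_)
            (trans (∑-swap (flat L) (flat L) (λ z x → hit (w x + w z))) flat₂)))))))
        (trans (∑-*ˡ (flat L) (slack * slack) _) (cong (slack * slack *_) flat₁)))
      E²-0 : (E λ x → E λ y → hit (x + y + 0)) ≡ S₂ + 2 * (slack * S₁)
      E²-0 = trans (E² 0) (trans (cong₂ _+_ (cong₂ (λ a b → a + 2 * (slack * b))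
          (trans (∑-cong (flat L) λ x → ∑-cong (flat L) λ y → cong hit (+-identityʳ (w x + w y))) flat₂)
          (trans (∑-cong (flat L) λ x → cong hit (+-identityʳ (w x))) flat₁))
          (*-zeroʳ (slack * slack))) (+-identityʳ _))

    ∑L-≤ : ∀ (f : Triple C → ℕ) m → (∀ {t} → Light (ws t) → f t ≤ m) → ∑ L f ≤ k * m
    ∑L-≤ f m p = ≤-trans (∑-mono-∈ L λ t∈ → p (All.lookup all-light t∈)) (≤-reflexive (∑-const L m))

    -- The local inequality summed over all k³ ordered choices of three matched triples. Repetitions
    -- are harmless, as it does not ask the three triples to be different.
    pairs-bound : 5 * S₃ + 8 * (k * S₂) ≤ 135 * (k * k * k)
    pairs-bound = subst₂ _≤_ left-side right-side
      (∑L-≤ _ (k * (k * 135)) λ lv → ∑L-≤ _ (k * 135) λ lt → ∑L-≤ _ 135 λ lu → heart-pairs lt lu lv)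
      where
      right-side : k * (k * (k * 135)) ≡ 135 * (k * k * k)
      right-side = e′ k
        where
        e′ : ∀ k → k * (k * (k * 135)) ≡ 135 * (k * k * k)
        e′ = solve-∀
      split : ∀ {A : Set} (xs : List A) (f g : A → ℕ) a b → (∑[ x ∈ xs ] (a * f x + b * g x)) ≡ a * ∑ xs f + b * ∑ xs g
      split xs f g a b = trans (∑-+ xs _ _) (cong₂ _+_ (∑-*ˡ xs a f) (∑-*ˡ xs b g))
      left-side : (∑[ v ∈ L ] ∑[ t ∈ L ] ∑[ u ∈ L ] (5 * hits₃ (ws v) (ws t) (ws u) + 8 * hits₂ (ws t) (ws u))) ≡ 5 * S₃ + 8 * (k * S₂)
      left-side = trans (∑-cong L λ v → trans (∑-cong L λ t → split L _ _ 5 8) (split L _ _ 5 8))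
        (trans (split L _ (λ _ → S₂) 5 8) (cong (λ s → 5 * S₃ + 8 * s) (∑-const L S₂)))

    singles-bound : S₃ + 8 * (k * k * S₁) ≤ 27 * (k * k * k)
    singles-bound = subst₂ _≤_ left-side right-side
      (∑L-≤ _ (k * (k * 27)) λ lv → ∑L-≤ _ (k * 27) λ lt → ∑L-≤ _ 27 λ lu → heart-singles lt lu lv)
      where
      right-side : k * (k * (k * 27)) ≡ 27 * (k * k * k)
      right-side = e′ k
        where
        e′ : ∀ k → k * (k * (k * 27)) ≡ 27 * (k * k * k)
        e′ = solve-∀
      add-const : ∀ (f : Triple C → ℕ) c → (∑[ t ∈ L ] (f t + c)) ≡ ∑ L f + k * c
      add-const f c = trans (∑-+ L f (λ _ → c)) (cong (∑ L f +_) (∑-const L c))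
      e : ∀ k h → k * (k * (8 * h)) ≡ 8 * (k * k) * h
      e = solve-∀
      left-side : (∑[ v ∈ L ] ∑[ t ∈ L ] ∑[ u ∈ L ] (hits₃ (ws v) (ws t) (ws u) + 8 * hits₁ (ws v))) ≡ S₃ + 8 * (k * k * S₁)
      left-side = trans (∑-cong L λ v → trans
          (∑-cong L λ t → add-const (λ u → hits₃ (ws v) (ws t) (ws u)) (8 * hits₁ (ws v)))
          (add-const (λ t → ∑[ u ∈ L ] hits₃ (ws v) (ws t) (ws u)) (k * (8 * hits₁ (ws v)))))
        (trans (∑-+ L (λ v → ∑[ t ∈ L ] ∑[ u ∈ L ] hits₃ (ws v) (ws t) (ws u)) (λ v → k * (k * (8 * hits₁ (ws v)))))
          (cong (S₃ +_) (trans (∑-cong L λ v → e k (hits₁ (ws v)))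
            (trans (∑-*ˡ L (8 * (k * k)) (λ v → hits₁ (ws v))) (*-assoc 8 (k * k) S₁)))))

    S₂≤ : S₂ ≤ 5 * (k * k)
    S₂≤ = subst (S₂ ≤_) (e k) (∑L-≤ _ (k * 5) λ lt → ∑L-≤ _ 5 λ lu → hits₂≤5 lt lu lt)
      where e : ∀ k → k * (k * 5) ≡ 5 * (k * k)
            e = solve-∀

    S₁≤ : S₁ ≤ k
    S₁≤ = subst (S₁ ≤_) (*-identityʳ k) (∑L-≤ _ 1 λ lt → hits₁≤1 lt lt lt)

  volume : ℕ
  volume = ∑[ c ∈ allFin K ] Q c * (∑[ a ∈ allFin K ] Q a * (∑[ b ∈ allFin K ] Q b * 𝟙 (admissible (a , b , c))))

  private
    volume≤ : volume ≤ S₃ + (3 * (slack * S₂) + 3 * (slack * slack * S₁))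
    volume≤ = ≤-trans (∑-mono (allFin K) λ c → *-monoʳ-≤ (Q c) (≤-trans (∑-mono (allFin K) λ a → *-monoʳ-≤ (Q a)
        (≤-trans (∑-mono (allFin K) λ b → *-monoʳ-≤ (Q b) (edge a b c)) (transfer λ y → hit (w a + y + w c))))
        (transfer λ x → E λ y → hit (x + y + w c))))
      (≤-trans (transfer λ z → E λ x → E λ y → hit (x + y + z)) (≤-reflexive expand))
      where
      edge : ∀ a b c → 𝟙 (admissible (a , b , c)) ≤ hit (w a + w b + w c)
      edge a b c = 𝟙≤ λ t → hit-1 {w a + w b + w c} (+-cancelʳ-≤ 6 1000 (w a + w b + w c) (covers (a , b , c) t))

  volume-bound : volume ≤ 27 * (k * k * k) ⊎ volume ≤ star-bound k slack
  volume-bound = Sum.map (≤-trans volume≤) (≤-trans volume≤)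
    (clique-or-star k slack S₁ S₂ S₃ pairs-bound singles-bound S₂≤ S₁≤)

  size-bound : 3 * k + slack ≤ (∑[ c ∈ allFin K ] Q c) + K * 1006
  size-bound = begin
    3 * k + slack
      ≡⟨ cong (_+ slack) (trans (sym (length-flat L)) (length-counts (flat L))) ⟩
    (∑[ c ∈ allFin K ] count c (flat L)) + slack
      ≡⟨ ∑-+ (allFin K) _ _ ⟨
    (∑[ c ∈ allFin K ] (count c (flat L) + (Q c ∸ count c (flat L))))
      ≤⟨ ∑-mono (allFin K) (λ c → pointwise (count c (flat L)) (Q c) (load c)) ⟩
    (∑[ c ∈ allFin K ] (Q c + 1006))
      ≡⟨ ∑-+ (allFin K) Q (λ _ → 1006) ⟩
    (∑[ c ∈ allFin K ] Q c) + (∑[ c ∈ allFin K ] 1006)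
      ≡⟨ cong ((∑[ c ∈ allFin K ] Q c) +_) (trans (∑-const (allFin K) 1006) (cong (_* 1006) (length-tabulate {n = K} id))) ⟩
    (∑[ c ∈ allFin K ] Q c) + K * 1006 ∎
    where
    open ≤-Reasoning
    pointwise : ∀ m q → m ≤ q + 1006 → m + (q ∸ m) ≤ q + 1006
    pointwise m q le with ≤-total m q
    ... | inj₁ p = ≤-trans (≤-reflexive (m+[n∸m]≡n p)) (m≤m+n q 1006)
    ... | inj₂ p rewrite m≤n⇒m∸n≡0 p = ≤-trans (≤-reflexive (+-identityʳ m)) le

-- Packing tight paths

∣p∪q∣≤∣p∣+∣q∣ : ∀ {n} (p q : Subset n) → ∣ p ∪ q ∣ ≤ ∣ p ∣ + ∣ q ∣
∣p∪q∣≤∣p∣+∣q∣ [] [] = z≤n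
∣p∪q∣≤∣p∣+∣q∣ (outside ∷ p) (outside ∷ q) = ∣p∪q∣≤∣p∣+∣q∣ p q
∣p∪q∣≤∣p∣+∣q∣ (outside ∷ p) (inside ∷ q) = ≤-trans (s≤s (∣p∪q∣≤∣p∣+∣q∣ p q)) (≤-reflexive (sym (+-suc ∣ p ∣ ∣ q ∣)))
∣p∪q∣≤∣p∣+∣q∣ (inside ∷ p) (outside ∷ q) = s≤s (∣p∪q∣≤∣p∣+∣q∣ p q)
∣p∪q∣≤∣p∣+∣q∣ (inside ∷ p) (inside ∷ q) = s≤s (≤-trans (∣p∪q∣≤∣p∣+∣q∣ p q) (+-monoʳ-≤ ∣ p ∣ (n≤1+n ∣ q ∣)))

∣pair∣≤2 : ∀ {n} (x y : Fin n) → ∣ ⁅ x ⁆ ∪ ⁅ y ⁆ ∣ ≤ 2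
∣pair∣≤2 x y = ≤-trans (∣p∪q∣≤∣p∣+∣q∣ ⁅ x ⁆ ⁅ y ⁆) (≤-reflexive (cong₂ _+_ (∣⁅x⁆∣≡1 x) (∣⁅x⁆∣≡1 y)))

triple-distinct : ∀ {n} {x y z : Fin n} → ∣ triple x y z ∣ ≡ 3 → x ≢ y × x ≢ z × y ≢ z
triple-distinct {x = x} {y} {z} e = (λ { refl → degenerate x z (trans (sym (∪-assoc ⁅ x ⁆ ⁅ x ⁆ ⁅ z ⁆)) (cong (_∪ ⁅ z ⁆) (∪-idem ⁅ x ⁆))) })
  , (λ { refl → degenerate x y (trans (cong (⁅ x ⁆ ∪_) (∪-comm ⁅ y ⁆ ⁅ x ⁆)) (trans (sym (∪-assoc ⁅ x ⁆ ⁅ x ⁆ ⁅ y ⁆)) (cong (_∪ ⁅ y ⁆) (∪-idem ⁅ x ⁆)))) })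
  , (λ { refl → degenerate x y (cong (⁅ x ⁆ ∪_) (∪-idem ⁅ y ⁆)) })
  where
  degenerate : ∀ u v → triple x y z ≡ ⁅ u ⁆ ∪ ⁅ v ⁆ → ⊥
  degenerate u v eq = <⇒≱ ≤-refl (subst (_≤ 2) (trans (cong ∣_∣ (sym eq)) e) (∣pair∣≤2 u v))

triple-rotate : ∀ {n} (x y z : Fin n) → triple y z x ≡ triple x y z
triple-rotate x y z = trans (sym (∪-assoc ⁅ y ⁆ ⁅ z ⁆ ⁅ x ⁆)) (∪-comm (⁅ y ⁆ ∪ ⁅ z ⁆) ⁅ x ⁆)

Unique-resp-↭ : ∀ {A : Set} {xs ys : List A} → xs ↭ ys → Unique xs → Unique ys
Unique-resp-↭ {A} p = Permₛ.Unique-resp-↭ (setoid A) (↭⇒↭ₛ p)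

Unique-++ˡ : ∀ {A : Set} (xs : List A) {ys} → Unique (xs ++ ys) → Unique xs
Unique-++ˡ [] u = []
Unique-++ˡ (x ∷ xs) (p ∷ u) = All.++⁻ˡ xs p ∷ Unique-++ˡ xs u

-- Taken from the sides of a complete tripartite 3-graph, this order gives a tight path: three
-- consecutive vertices come one from each side.
weave : ∀ {A : Set} → List A → List A → List A → List A
weave (x ∷ xs) (y ∷ ys) (z ∷ zs) = x ∷ y ∷ z ∷ weave xs ys zs
weave _ _ _ = []

weave-↭ : ∀ {A : Set} (xs ys zs : List A) → length xs ≡ length ys → length xs ≡ length zs →
  weave xs ys zs ↭ xs ++ ys ++ zs
weave-↭ [] [] [] _ _ = ↭-refl
weave-↭ (x ∷ xs) (y ∷ ys) (z ∷ zs) p q = Perm.prep x (↭-trans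
  (Perm.prep y (Perm.prep z (weave-↭ xs ys zs (suc-injective p) (suc-injective q))))
  (↭-trans (Perm.prep y (lift xs ys)) (↭-sym (shift y xs (ys ++ z ∷ zs)))))
  where
  lift : ∀ us vs → z ∷ us ++ vs ++ zs ↭ us ++ vs ++ z ∷ zs
  lift us vs = ↭-trans (↭-sym (shift z us (vs ++ zs))) (++⁺ˡ us (↭-sym (shift z vs zs)))

module _ {n : ℕ} (H : 3Graph n) where
  private V = Fin n

  vertices : List V
  vertices = allFin n

  edge? : ∀ e → Dec (e ∈ edges H)
  edge? e = Any.any? (≡-dec Bool._≟_ e) (edges H)

  edgeᵇ : V → V → V → Bool
  edgeᵇ u v w = does (edge? (triple u v w))

  edgeᵇ-sound : ∀ {u v w} → T (edgeᵇ u v w) → triple u v w ∈ edges H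
  edgeᵇ-sound {u} {v} {w} = does⇒ (edge? (triple u v w))

  edgeᵇ-distinct : ∀ {u v w} → T (edgeᵇ u v w) → u ≢ v × u ≢ w × v ≢ w
  edgeᵇ-distinct t = triple-distinct (All.lookup (size3 H) (edgeᵇ-sound t))

  weave-tight : ∀ xs ys zs → All (λ z → All (λ y → All (λ x → T (edgeᵇ x y z)) xs) ys) zs → TightPathIn H (weave xs ys zs)
  weave-tight [] ys zs _ = tt
  weave-tight (x ∷ xs) [] zs _ = tt
  weave-tight (x ∷ xs) (y ∷ ys) [] _ = tt
  weave-tight (x ∷ []) (y ∷ ys) (z ∷ zs) (((p ∷ _) ∷ _) ∷ _) = edgeᵇ-sound p , tt
  weave-tight (x ∷ x′ ∷ xs) (y ∷ []) (z ∷ zs) (((p ∷ _) ∷ _) ∷ _) = edgeᵇ-sound p , tt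
  weave-tight (x ∷ x′ ∷ xs) (y ∷ y′ ∷ ys) (z ∷ []) (((p ∷ _) ∷ _) ∷ _) = edgeᵇ-sound p , tt
  weave-tight (x ∷ x′ ∷ xs) (y ∷ y′ ∷ ys) (z ∷ z′ ∷ zs) (((p ∷ q ∷ _) ∷ (_ ∷ r ∷ _) ∷ _) ∷ rest) =
    edgeᵇ-sound p
    , subst (_∈ edges H) (sym (triple-rotate x′ y z)) (edgeᵇ-sound q)
    , subst (_∈ edges H) (triple-rotate z x′ y′) (edgeᵇ-sound r)
    , weave-tight (x′ ∷ xs) (y′ ∷ ys) (z′ ∷ zs) (All.map (λ al → All.map All.tail (All.tail al)) rest)

  size : (V → Bool) → ℕ
  size p = ∑[ v ∈ vertices ] 𝟙 (p v)

  boxEdges : (V → Bool) → (V → Bool) → (V → Bool) → ℕ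
  boxEdges A B C = ∑[ u ∈ vertices ] ∑[ v ∈ vertices ] ∑[ w ∈ vertices ] 𝟙 (A u) * (𝟙 (B v) * (𝟙 (C w) * 𝟙 (edgeᵇ u v w)))

  elements : (V → Bool) → List V
  elements p = filterᵇ p vertices

  length-elements : ∀ p → length (elements p) ≡ size p
  length-elements p = length-filterᵇ p vertices

  boxEdges-elements : ∀ A B C → boxEdges A B C ≡ (∑[ u ∈ elements A ] ∑[ v ∈ elements B ] ∑[ w ∈ elements C ] 𝟙 (edgeᵇ u v w))
  boxEdges-elements A B C = sym (trans (∑-filterᵇ A vertices _) (∑-cong vertices λ u →
    trans (cong (𝟙 (A u) *_) (trans (∑-filterᵇ B vertices _) (∑-cong vertices λ v →
      trans (cong (𝟙 (B v) *_) (∑-filterᵇ C vertices _)) (sym (∑-*ˡ vertices (𝟙 (B v)) _)))))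
    (trans (sym (∑-*ˡ vertices (𝟙 (A u)) _)) (∑-cong vertices λ v → sym (∑-*ˡ vertices (𝟙 (A u)) _)))))

  module Classes {K : ℕ} (χ : V → Fin K) where

    class : (V → Bool) → Fin K → V → Bool
    class U c v = U v ∧ (χ v == c)

    everything : V → Bool
    everything _ = true

    classSize : Fin K → ℕ
    classSize c = size (class everything c)

    Regular : ℕ → ℕ → Triple (Fin K) → Set
    Regular D e (a , b , c) = ∀ A B C →
      classSize a ≤ e * size (class A a) →
      classSize b ≤ e * size (class B b) →
      classSize c ≤ e * size (class C c) →
      size (class A a) * (size (class B b) * size (class C c)) ≤ D * boxEdges (class A a) (class B b) (class C c)

  module Packing {K : ℕ} (χ : V → Fin K) (ℓ D e : ℕ) (ℓ>0 : 0 < ℓ) where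
    open Classes χ

    record Large (reserve : Fin K → ℕ) (c : Fin K) : Set where
      field
        fraction : classSize c ≤ e * reserve c
        enough   : box-size ℓ D ≤ reserve c

    record TileIn (U : V → Bool) (T₀ : Triple (Fin K)) : Set where
      field
        path     : List V
        tight    : TightPathIn H path
        distinct : Unique path
        inU      : All (λ v → T (U v)) path
        length≡  : length path ≡ 3 * ℓ
        colours  : ∀ d → (∑[ x ∈ path ] 𝟙 (χ x == d)) ≡ ℓ * count d (flat (T₀ ∷ []))

    -- The three colours may coincide, so the colouring does not separate the sides. They are
    -- disjoint because a common vertex of two sides would occur twice in an edge of the box;
    -- positivity of ℓ supplies the third vertex of that edge.
    tile-of-box : ∀ U a b c → Box ℓ edgeᵇ (elements (class U a)) (elements (class U b)) (elements (class U c)) → TileIn U (a , b , c)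
    tile-of-box U a b c box = record
      { path = P ; tight = weave-tight xs ys zs complete
      ; distinct = Unique-resp-↭ (↭-sym perm) (Unique.++⁺ (unique X) (Unique.++⁺ (unique Y) (unique Z) disjoint-yz) disjoint-x)
      ; inU = All-resp-↭ (↭-sym perm) (All.++⁺ (All.map proj₁ (from X)) (All.++⁺ (All.map proj₁ (from Y)) (All.map proj₁ (from Z))))
      ; length≡ = trans (↭-length perm) (trans (length-++ xs) (trans (cong₂ _+_ (Choice.size≡ X) (trans (length-++ ys) (cong₂ _+_ (Choice.size≡ Y) (Choice.size≡ Z)))) (e₃ ℓ)))
      ; colours = λ d → trans (∑-↭ (λ x → 𝟙 (χ x == d)) perm) (trans (∑-++ xs _ _) (trans
          (cong₂ _+_ (monochrome X d) (trans (∑-++ ys zs _) (cong₂ _+_ (monochrome Y d) (monochrome Z d))))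
          (e₄ ℓ (𝟙 (a == d)) (𝟙 (b == d)) (𝟙 (c == d))))) }
      where
      e₃ : ∀ l → l + (l + l) ≡ 3 * l
      e₃ = solve-∀
      e₄ : ∀ l x y z → l * x + (l * y + l * z) ≡ l * (x + (y + (z + 0)))
      e₄ = solve-∀
      open Box box
      xs = chosen X
      ys = chosen Y
      zs = chosen Z
      P = weave xs ys zs
      perm : P ↭ xs ++ ys ++ zs
      perm = weave-↭ xs ys zs (trans (Choice.size≡ X) (sym (Choice.size≡ Y))) (trans (Choice.size≡ X) (sym (Choice.size≡ Z)))
      from : ∀ {d} (ch : Choice ℓ (elements (class U d))) → All (λ v → T (U v) × χ v ≡ d) (chosen ch)
      from {d} ch = All.map (λ {v} t → let p , q = Equivalence.to (T-∧ {U v}) t in p , does⇒ (χ v F.≟ d) q)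
        (All.++⁻ˡ (chosen ch) (All-resp-↭ (splits ch) (All.all-filter (T? ∘ class U d) vertices)))
      unique : ∀ {d} (ch : Choice ℓ (elements (class U d))) → Unique (chosen ch)
      unique {d} ch = Unique-++ˡ (chosen ch) (Unique-resp-↭ (splits ch) (Unique.filter⁺ (T? ∘ class U d) (Unique.allFin⁺ n)))
      monochrome : ∀ {d′} (ch : Choice ℓ (elements (class U d′))) d → (∑[ x ∈ chosen ch ] 𝟙 (χ x == d)) ≡ ℓ * 𝟙 (d′ == d)
      monochrome {d′} ch d = trans (constant (chosen ch) (from ch)) (cong (_* 𝟙 (d′ == d)) (Choice.size≡ ch))
        where
        constant : ∀ us → All (λ v → T (U v) × χ v ≡ d′) us → (∑[ x ∈ us ] 𝟙 (χ x == d)) ≡ length us * 𝟙 (d′ == d)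
        constant [] [] = refl
        constant (u ∷ us) ((_ , refl) ∷ al) = cong (𝟙 (χ u == d) +_) (constant us al)
      edge-at : ∀ {x y z} → x ∈ xs → y ∈ ys → z ∈ zs → T (edgeᵇ x y z)
      edge-at x∈ y∈ z∈ = All.lookup (All.lookup (All.lookup complete z∈) y∈) x∈
      member : ∀ {us : List V} → length us ≡ ℓ → ∃ (_∈ us)
      member {[]} refl = contradiction ℓ>0 λ ()
      member {u ∷ us} _ = u , here refl
      disjoint-yz : Disjoint ys zs
      disjoint-yz (p , q) = proj₂ (proj₂ (edgeᵇ-distinct (edge-at (proj₂ (member (Choice.size≡ X))) p q))) refl
      disjoint-x : Disjoint xs (ys ++ zs)
      disjoint-x (p , q) with ∈-++⁻ ys q
      ... | inj₁ r = proj₁ (edgeᵇ-distinct (edge-at p r (proj₂ (member (Choice.size≡ Z))))) refl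
      ... | inj₂ r = proj₁ (proj₂ (edgeᵇ-distinct (edge-at p (proj₂ (member (Choice.size≡ Y))) r))) refl

    abstract
      find-tile : ∀ {reserve} U a b c → Regular D e (a , b , c) → Large reserve a → Large reserve b → Large reserve c →
        reserve a ≤ size (class U a) → reserve b ≤ size (class U b) → reserve c ≤ size (class U c) → TileIn U (a , b , c)
      find-tile {reserve} U a b c reg la lb lc ra rb rc = tile-of-box U a b c box
        where
        enough : ∀ d → Large reserve d → reserve d ≤ size (class U d) → box-size ℓ D ≤ length (elements (class U d))
        enough d l r = ≤-trans (Large.enough l) (≤-trans r (≤-reflexive (sym (length-elements (class U d)))))
        fraction : ∀ d → Large reserve d → reserve d ≤ size (class U d) → classSize d ≤ e * size (class U d)
        fraction d l r = ≤-trans (Large.fraction l) (*-monoʳ-≤ e r)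
        box : Box ℓ edgeᵇ (elements (class U a)) (elements (class U b)) (elements (class U c))
        box = dense-box ℓ D edgeᵇ (elements (class U a)) (elements (class U b)) (elements (class U c))
          dense (enough a la ra) (enough b lb rb) (enough c lc rc)
          where
          open ≤-Reasoning
          dense : length (elements (class U a)) * (length (elements (class U b)) * length (elements (class U c))) ≤
            D * (∑[ u ∈ elements (class U a) ] ∑[ v ∈ elements (class U b) ] ∑[ w ∈ elements (class U c) ] 𝟙 (edgeᵇ u v w))
          dense = begin
            length (elements (class U a)) * (length (elements (class U b)) * length (elements (class U c)))
              ≡⟨ cong₂ _*_ (length-elements (class U a)) (cong₂ _*_ (length-elements (class U b)) (length-elements (class U c))) ⟩
            size (class U a) * (size (class U b) * size (class U c))
              ≤⟨ reg U U U (fraction a la ra) (fraction b lb rb) (fraction c lc rc) ⟩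
            D * boxEdges (class U a) (class U b) (class U c)
              ≡⟨ cong (D *_) (boxEdges-elements (class U a) (class U b) (class U c)) ⟩
            D * (∑[ u ∈ elements (class U a) ] ∑[ v ∈ elements (class U b) ] ∑[ w ∈ elements (class U c) ] 𝟙 (edgeᵇ u v w)) ∎

    infix 5 _∈ᵇ_
    _∈ᵇ_ : V → List V → Bool
    v ∈ᵇ P = any (λ x → x == v) P

    remove : List V → (V → Bool) → V → Bool
    remove P U v = U v ∧ not (v ∈ᵇ P)

    size-remove : ∀ P U d → size (class U d) ≤ (∑[ x ∈ P ] 𝟙 (χ x == d)) + size (class (remove P U) d)
    size-remove P U d = begin
      size (class U d)
        ≤⟨ ∑-mono vertices (λ v → ≤-trans (pointwise (U v) (v ∈ᵇ P) (χ v == d)) (+-monoˡ-≤ _ (hits v P))) ⟩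
      (∑[ v ∈ vertices ] ((∑[ x ∈ P ] 𝟙 (x == v) * 𝟙 (χ v == d)) + 𝟙 (class (remove P U) d v)))
        ≡⟨ ∑-+ vertices _ _ ⟩
      (∑[ v ∈ vertices ] ∑[ x ∈ P ] 𝟙 (x == v) * 𝟙 (χ v == d)) + size (class (remove P U) d)
        ≡⟨ cong (_+ size (class (remove P U) d)) (trans (∑-swap vertices P _) (∑-cong P λ x → ∑-δ x (λ v → 𝟙 (χ v == d)))) ⟩
      (∑[ x ∈ P ] 𝟙 (χ x == d)) + size (class (remove P U) d) ∎
      where
      open ≤-Reasoning
      pointwise : ∀ u p q → 𝟙 (u ∧ q) ≤ 𝟙 p * 𝟙 q + 𝟙 ((u ∧ not p) ∧ q)
      pointwise false p q = z≤n
      pointwise true true q = ≤-trans (≤-reflexive (sym (+-identityʳ (𝟙 q)))) (m≤m+n _ 0)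
      pointwise true false q = ≤-refl
      hits : ∀ v P → 𝟙 (v ∈ᵇ P) * 𝟙 (χ v == d) ≤ (∑[ x ∈ P ] 𝟙 (x == v) * 𝟙 (χ v == d))
      hits v [] = z≤n
      hits v (x ∷ P) with x == v
      ... | true = m≤m+n _ _
      ... | false = hits v P

    remove-sound : ∀ {P U v} → T (remove P U v) → T (U v) × ¬ (v ∈ P)
    remove-sound {P} {U} {v} t = let p , q = Equivalence.to (T-∧ {U v}) t in p , λ v∈ → absent P v∈ q
      where
      absent : ∀ P → v ∈ P → ¬ T (not (v ∈ᵇ P))
      absent (x ∷ P) (here refl) q rewrite ==-refl x = q
      absent (x ∷ P) (there v∈) q with x == v
      ... | true = q
      ... | false = absent P v∈ q

    record Forest (U : V → Bool) (m : ℕ) : Set where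
      field
        paths : List (List V)
        tight : All (TightPathIn H) paths
        distinct : Unique (concat paths)
        inU : All (λ v → T (U v)) (concat paths)
        total : sum (map pathEdges paths) ≡ m

    -- Greedy: the reserve guarantees the next tile, and deleting its vertices reduces the available
    -- room by exactly the share planned for it.
    pack : ∀ {reserve} L U →
      All (λ (a , b , c) → Regular D e (a , b , c) × Large reserve a × Large reserve b × Large reserve c) L →
      (∀ c → Large reserve c → ℓ * count c (flat L) + reserve c ≤ size (class U c)) →
      Forest U (length L * (3 * ℓ ∸ 2))
    pack [] U _ _ = record { paths = [] ; tight = [] ; distinct = [] ; inU = [] ; total = refl }
    pack {reserve} (t@(a , b , c) ∷ L) U ((reg , la , lb , lc) ∷ al) room = record
      { paths = tile.path ∷ rest.paths
      ; tight = tile.tight ∷ rest.tight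
      ; distinct = Unique.++⁺ tile.distinct rest.distinct λ (p , q) → proj₂ (remove-sound {tile.path} {U} (All.lookup rest.inU q)) p
      ; inU = All.++⁺ tile.inU (All.map (λ {v} t → proj₁ (remove-sound {tile.path} {U} t)) rest.inU)
      ; total = cong₂ _+_ (cong (_∸ 2) tile.length≡) rest.total }
      where
      eq : ∀ l x y z m → l * (x + (y + (z + 0))) + l * m ≡ l * (x + (y + (z + m)))
      eq = solve-∀
      avail : ∀ d → Large reserve d → reserve d ≤ size (class U d)
      avail d l = ≤-trans (m≤n+m (reserve d) _) (room d l)
      module tile = TileIn (find-tile U a b c reg la lb lc (avail a la) (avail b lb) (avail c lc))
      module rest = Forest (pack L (remove tile.path U) al λ d l →
        +-cancelˡ-≤ (ℓ * count d (flat (t ∷ []))) _ _ (≤-trans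
          (≤-reflexive (trans (sym (+-assoc (ℓ * count d (flat (t ∷ []))) (ℓ * count d (flat L)) (reserve d))) (cong (_+ reserve d)
            (eq ℓ (𝟙 (a == d)) (𝟙 (b == d)) (𝟙 (c == d)) (count d (flat L))))))
          (≤-trans (room d l) (≤-trans (size-remove tile.path U d) (≤-reflexive (cong (_+ size (class (remove tile.path U) d)) (tile.colours d)))))))

-- Regular partitions

triples : ∀ {A : Set} → List A → List (Triple A)
triples xs = concatMap (λ x → concatMap (λ y → map (λ z → x , y , z) xs) xs) xs

∑-triples : ∀ {A : Set} (xs : List A) (f : Triple A → ℕ) →
  ∑ (triples xs) f ≡ (∑[ x ∈ xs ] ∑[ y ∈ xs ] ∑[ z ∈ xs ] f (x , y , z))
∑-triples xs f = trans (∑-concatMap _ xs f) (∑-cong xs λ x → trans (∑-concatMap _ xs f) (∑-cong xs λ y → ∑-map _ xs f))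

∑-product : ∀ {A : Set} (xs : List A) (f g h : A → ℕ) →
  (∑[ x ∈ xs ] ∑[ y ∈ xs ] ∑[ z ∈ xs ] f x * (g y * h z)) ≡ ∑ xs f * (∑ xs g * ∑ xs h)
∑-product xs f g h = trans (∑-cong xs λ x → trans (∑-cong xs λ y → trans (∑-*ˡ xs (f x) _) (cong (f x *_) (∑-*ˡ xs (g y) h)))
    (trans (∑-*ˡ xs (f x) _) (cong (f x *_) (∑-*ʳ xs (∑ xs h) g))))
  (∑-*ʳ xs (∑ xs g * ∑ xs h) f)

δ³ : ∀ {K} → Triple (Fin K) → Triple (Fin K) → ℕ
δ³ (a , b , c) (a′ , b′ , c′) = 𝟙 (a == a′) * (𝟙 (b == b′) * 𝟙 (c == c′))

∑-δ³ : ∀ {K} (t : Triple (Fin K)) (f : Triple (Fin K) → ℕ) → (∑[ s ∈ triples (allFin K) ] δ³ t s * f s) ≡ f t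
∑-δ³ {K} (a , b , c) f = trans (∑-triples (allFin K) _) (trans
  (∑-cong (allFin K) λ x → trans
    (∑-cong (allFin K) λ y → trans
      (∑-cong (allFin K) λ z → e (𝟙 (a == x)) (𝟙 (b == y)) (𝟙 (c == z)) (f (x , y , z)))
      (trans (∑-δ c _) refl))
    (trans (∑-cong (allFin K) λ y → e′ (𝟙 (a == x)) (𝟙 (b == y)) (f (x , y , c))) (∑-δ b _)))
  (∑-δ a λ x → f (x , b , c)))
  where
  e : ∀ p q r s → p * (q * r) * s ≡ r * (p * (q * s))
  e = solve-∀
  e′ : ∀ p q s → p * (q * s) ≡ q * (p * s)
  e′ = solve-∀

map³ : ∀ {A B : Set} → (A → B) → Triple A → Triple B
map³ f (x , y , z) = f x , f y , f z

∑-boxes : ∀ {A : Set} {K} (χ : A → Fin K) (ys : List (Triple A)) (f : Triple (Fin K) → Triple A → ℕ) →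
  (∑[ y ∈ ys ] f (map³ χ y) y) ≡ (∑[ t ∈ triples (allFin K) ] ∑[ y ∈ ys ] δ³ (map³ χ y) t * f t y)
∑-boxes {K = K} χ ys f = trans (∑-cong ys λ y → sym (∑-δ³ (map³ χ y) (λ t → f t y)))
  (∑-swap ys (triples (allFin K)) _)

encode : ∀ {m K} → Fin m → Triple (Fin K) → Fin (m * (K * (K * K)))
encode p (a , b , c) = combine p (combine a (combine b c))

decode : ∀ m {K} → Fin (m * (K * (K * K))) → Fin m × Triple (Fin K)
decode m {K} i =
  let p , r = remQuot {m} (K * (K * K)) i
      a , r = remQuot {K} (K * K) r
  in p , a , remQuot {K} K r

decode-encode : ∀ {m K} (p : Fin m) (t : Triple (Fin K)) → decode m (encode p t) ≡ (p , t)
decode-encode {m} {K} p (a , b , c) = trans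
  (cong (λ (p , r) → let a , r = remQuot {K} (K * K) r in p , a , remQuot {K} K r)
    (F.remQuot-combine {m} {K * (K * K)} p (combine a (combine b c))))
  (trans (cong (λ (a , r) → p , a , remQuot {K} K r) (F.remQuot-combine {K} {K * K} a (combine b c)))
    (cong (λ r → p , a , r) (F.remQuot-combine {K} {K} b c)))

module Refinement {n K N : ℕ} (χ : Fin n → Fin K) (W : Fin N → Subset n) where

  bit : Bool → Fin 2
  bit false = zero
  bit true = suc zero

  unbit : Fin 2 → Bool
  unbit zero = false
  unbit (suc _) = true

  unbit-bit : ∀ b → unbit (bit b) ≡ b
  unbit-bit false = refl
  unbit-bit true = refl

  -- The common refinement of the old colouring and all N sets: a vertex remembers its colour and
  -- its membership vector.
  refined : Fin n → Fin (K * 2 ^ N)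
  refined v = combine (χ v) (funToFin λ i → bit (lookup (W i) v))

  coarse : Fin (K * 2 ^ N) → Fin K
  coarse c = proj₁ (remQuot {K} (2 ^ N) c)

  inside? : Fin (K * 2 ^ N) → Fin N → Bool
  inside? c i = unbit (finToFun (proj₂ (remQuot {K} (2 ^ N) c)) i)

  coarse-refined : ∀ v → coarse (refined v) ≡ χ v
  coarse-refined v = cong proj₁ (F.remQuot-combine {K} {2 ^ N} (χ v) _)

  inside?-refined : ∀ v i → inside? (refined v) i ≡ lookup (W i) v
  inside?-refined v i = trans (cong (λ r → unbit (finToFun (proj₂ r) i)) (F.remQuot-combine {K} {2 ^ N} (χ v) _))
    (trans (cong unbit (F.finToFun-funToFin (λ i → bit (lookup (W i) v)) i)) (unbit-bit _))

-- A refined box becomes marked if its coarse box was marked, or if the coarse box is irregular and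
-- the refined one lies inside the witnessing sparse sub-box.
extend : ∀ {A : Set} (mark irr p q r : A → Bool) → A → Bool
extend mark irr p q r t = mark t ∨ ((not (mark t) ∧ irr t) ∧ (p t ∧ (q t ∧ r t)))

𝟙-extend : ∀ {A : Set} (mark irr p q r : A → Bool) {s t : A} {x y z : Bool} → s ≡ t → p t ≡ x → q t ≡ y → r t ≡ z →
  𝟙 (extend mark irr p q r s) ≡ 𝟙 (mark t) + 𝟙 (not (mark t) ∧ irr t) * (𝟙 x * (𝟙 y * 𝟙 z))
𝟙-extend mark irr p q r {s} refl refl refl refl = split (mark s) (irr s) (p s) (q s) (r s)
  where
  split : ∀ m i a b c → 𝟙 (m ∨ ((not m ∧ i) ∧ (a ∧ (b ∧ c)))) ≡ 𝟙 m + 𝟙 (not m ∧ i) * (𝟙 a * (𝟙 b * 𝟙 c))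
  split true i a b c = refl
  split false i a b c = trans (𝟙-∧ i _) (cong (𝟙 i *_) (trans (𝟙-∧ a _) (cong (𝟙 a *_) (𝟙-∧ b c))))

module _ {n : ℕ} (H : 3Graph n) (D e : ℕ) where

  private
    V = Fin n
    vs = vertices H
    cube = triples vs
    _edge : Triple V → Bool
    _edge (u , v , w) = edgeᵇ H u v w

  n³ : ℕ
  n³ = n * (n * n)

  length-cube : length cube ≡ n³
  length-cube = trans (length-∑ cube) (trans (∑-triples vs (λ _ → 1)) (trans
    (∑-cong vs λ x → trans (∑-cong vs λ y → trans (sym (length-∑ vs)) |vs|) (trans (∑-const vs n) (cong (_* n) |vs|)))
    (trans (∑-const vs (n * n)) (cong (_* (n * n)) |vs|))))
    where |vs| = length-tabulate {n = n} id

  module _ {K : ℕ} (χ : V → Fin K) where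
    open Classes H χ

    Sparse : Triple (Fin K) → Subset n → Subset n → Subset n → Set
    Sparse (a , b , c) A B C =
      (classSize a ≤ e * size H (class (lookup A) a)) ×
      (classSize b ≤ e * size H (class (lookup B) b)) ×
      (classSize c ≤ e * size H (class (lookup C) c)) ×
      (D * boxEdges H (class (lookup A) a) (class (lookup B) b) (class (lookup C) c)
        ≤ size H (class (lookup A) a) * (size H (class (lookup B) b) * size H (class (lookup C) c)))

    irregular? : ∀ t → Dec (∃ λ A → ∃ λ B → ∃ λ C → Sparse t A B C)
    irregular? t = anySubset? λ A → anySubset? λ B → anySubset? λ C →
      _ ≤? _ ×-dec _ ≤? _ ×-dec _ ≤? _ ×-dec _ ≤? _

    irregular : Triple (Fin K) → Bool
    irregular t = does (irregular? t)

    -- Witnesses are sought among subsets, whereas `Regular` speaks of Boolean predicates;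
    -- tabulation translates between the two.
    regular⇒Regular : ∀ t → irregular t ≡ false → Regular D e t
    regular⇒Regular t@(a , b , c) eq A B C ha hb hc with irregular? t
    ... | no ¬sparse = ≮⇒≥ λ lt → ¬sparse (Vec.tabulate A , Vec.tabulate B , Vec.tabulate C ,
      subst (λ s → classSize a ≤ e * s) (same A a) ha ,
      subst (λ s → classSize b ≤ e * s) (same B b) hb ,
      subst (λ s → classSize c ≤ e * s) (same C c) hc ,
      subst₂ _≤_ (cong (D *_) sameEdges) (cong₂ _*_ (same A a) (cong₂ _*_ (same B b) (same C c))) (<⇒≤ lt))
      where
      at : ∀ U d v → class U d v ≡ class (lookup (Vec.tabulate U)) d v
      at U d v = cong (_∧ (χ v == d)) (sym (lookup∘tabulate U v))
      same : ∀ U d → size H (class U d) ≡ size H (class (lookup (Vec.tabulate U)) d)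
      same U d = ∑-cong vs λ v → cong 𝟙 (at U d v)
      sameEdges : boxEdges H (class A a) (class B b) (class C c) ≡
        boxEdges H (class (lookup (Vec.tabulate A)) a) (class (lookup (Vec.tabulate B)) b) (class (lookup (Vec.tabulate C)) c)
      sameEdges = ∑-cong vs λ u → ∑-cong vs λ v → ∑-cong vs λ w →
        cong₂ _*_ (cong 𝟙 (at A a u)) (cong₂ _*_ (cong 𝟙 (at B b v)) (cong (_* 𝟙 (edgeᵇ H u v w)) (cong 𝟙 (at C c w))))

  -- Marked boxes are unions of sparse sub-boxes found at earlier stages.
  record Marked (K : ℕ) : Set where
    field
      χ      : V → Fin K
      mark   : Triple (Fin K) → Bool
      sparse : D * (∑[ y ∈ cube ] 𝟙 (mark (map³ χ y)) * 𝟙 (y edge)) ≤ (∑[ y ∈ cube ] 𝟙 (mark (map³ χ y)))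

    volume : ℕ
    volume = ∑[ y ∈ cube ] 𝟙 (mark (map³ χ y))

    bad : Triple (Fin K) → Bool
    bad t = not (mark t) ∧ irregular χ t

    badVolume : ℕ
    badVolume = ∑[ y ∈ cube ] 𝟙 (bad (map³ χ y))

    volume+badVolume≤ : volume + badVolume ≤ n³
    volume+badVolume≤ = ≤-trans (≤-reflexive (sym (∑-+ cube _ _)))
      (≤-trans (∑-mono cube λ y → exclusive (mark (map³ χ y)) (irregular χ (map³ χ y)))
        (≤-reflexive (trans (sym (length-∑ cube)) length-cube)))
      where
      exclusive : ∀ a b → 𝟙 a + 𝟙 (not a ∧ b) ≤ 1
      exclusive false b = 𝟙≤1 b
      exclusive true b = ≤-refl

  module Step {K : ℕ} (M : Marked K) where
    open Marked M
    open Classes H χ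

    witness : Fin 3 → Triple (Fin K) → Subset n
    witness p t with irregular? χ t
    ... | yes (A , B , C , _) = select p
      where
      select : Fin 3 → Subset n
      select zero = A
      select (suc zero) = B
      select (suc (suc _)) = C
    -- A regular box contributes the empty set, which splits no class.
    ... | no _ = Vec.tabulate λ _ → false

    Witnessed : Triple (Fin K) → Set
    Witnessed t = Sparse χ t (witness zero t) (witness (suc zero) t) (witness (suc (suc zero)) t)

    witness-sparse : ∀ t → irregular χ t ≡ true → Witnessed t
    witness-sparse t eq with irregular? χ t
    ... | yes (A , B , C , s) = s

    N : ℕ
    N = 3 * (K * (K * K))

    index : Fin 3 → Triple (Fin K) → Fin N
    index = encode

    family : Fin N → Subset n
    family i = let p , t = decode 3 i in witness p t

    family-index : ∀ p t → family (index p t) ≡ witness p t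
    family-index p t = cong (λ (p , t) → witness p t) (decode-encode p t)

    open Refinement χ family

    side : Fin 3 → Triple (Fin K) → V → Bool
    side p t = lookup (witness p t)

    side₀ side₁ side₂ : Triple (Fin K) → V → Bool
    side₀ = side zero
    side₁ = side (suc zero)
    side₂ = side (suc (suc zero))

    new : Triple (Fin K) → Triple V → ℕ
    new t (u , v , w) = 𝟙 (bad t) * (𝟙 (side₀ t u) * (𝟙 (side₁ t v) * 𝟙 (side₂ t w)))

    mark′ : Triple (Fin (K * 2 ^ N)) → Bool
    mark′ (a , b , c) = extend mark (irregular χ) (inside? a ∘ index zero) (inside? b ∘ index (suc zero)) (inside? c ∘ index (suc (suc zero)))
      (coarse a , coarse b , coarse c)

    inside?-index : ∀ v p t → inside? (refined v) (index p t) ≡ side p t v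
    inside?-index v p t = trans (inside?-refined v (index p t)) (cong (λ A → lookup A v) (family-index p t))

    mark′-split : ∀ y → 𝟙 (mark′ (map³ refined y)) ≡ 𝟙 (mark (map³ χ y)) + new (map³ χ y) y
    mark′-split (u , v , w) = 𝟙-extend mark (irregular χ)
      (inside? (refined u) ∘ index zero) (inside? (refined v) ∘ index (suc zero)) (inside? (refined w) ∘ index (suc (suc zero)))
      (cong₂ _,_ (coarse-refined u) (cong₂ _,_ (coarse-refined v) (coarse-refined w)))
      (inside?-index u zero (χ u , χ v , χ w)) (inside?-index v (suc zero) (χ u , χ v , χ w)) (inside?-index w (suc (suc zero)) (χ u , χ v , χ w))

    gain gainEdges : ℕ
    gain = ∑[ y ∈ cube ] new (map³ χ y) y
    gainEdges = ∑[ y ∈ cube ] new (map³ χ y) y * 𝟙 (y edge)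

    A B C : Triple (Fin K) → V → Bool
    A t@(a , _ , _) = class (side₀ t) a
    B t@(_ , b , _) = class (side₁ t) b
    C t@(_ , _ , c) = class (side₂ t) c

    boxes = triples (allFin K)

    restrict : ∀ p q → 𝟙 (p ∧ q) ≡ 𝟙 q * 𝟙 p
    restrict p q = trans (𝟙-∧ p q) (*-comm (𝟙 p) (𝟙 q))

    gain-boxes : gain ≡ (∑[ t ∈ boxes ] 𝟙 (bad t) * (size H (A t) * (size H (B t) * size H (C t))))
    gain-boxes = trans (∑-boxes χ cube new) (∑-cong boxes λ t@(a , b , c) →
      trans (∑-triples vs _) (trans
        (∑-cong vs λ u → trans (∑-cong vs λ v → trans (∑-cong vs λ w → trans
            (eq (𝟙 (bad t)) (𝟙 (χ u == a)) (𝟙 (χ v == b)) (𝟙 (χ w == c)) (𝟙 (side₀ t u)) (𝟙 (side₁ t v)) (𝟙 (side₂ t w)))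
            (sym (cong (𝟙 (bad t) *_) (cong₂ _*_ (restrict (side₀ t u) (χ u == a)) (cong₂ _*_ (restrict (side₁ t v) (χ v == b)) (restrict (side₂ t w) (χ w == c)))))))
          (∑-*ˡ vs (𝟙 (bad t)) _)) (∑-*ˡ vs (𝟙 (bad t)) _))
        (trans (∑-*ˡ vs (𝟙 (bad t)) _) (cong (𝟙 (bad t) *_) (∑-product vs (𝟙 ∘ A t) (𝟙 ∘ B t) (𝟙 ∘ C t))))))
      where
      eq : ∀ m p q r x y z → p * (q * r) * (m * (x * (y * z))) ≡ m * ((p * x) * ((q * y) * (r * z)))
      eq = solve-∀

    gainEdges-boxes : gainEdges ≡ (∑[ t ∈ boxes ] 𝟙 (bad t) * boxEdges H (A t) (B t) (C t))
    gainEdges-boxes = trans (∑-boxes χ cube (λ t y → new t y * 𝟙 (y edge))) (∑-cong boxes λ t@(a , b , c) →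
      trans (∑-triples vs _) (trans
        (∑-cong vs λ u → trans (∑-cong vs λ v → trans (∑-cong vs λ w → trans
            (eq (𝟙 (bad t)) (𝟙 (χ u == a)) (𝟙 (χ v == b)) (𝟙 (χ w == c)) (𝟙 (side₀ t u)) (𝟙 (side₁ t v)) (𝟙 (side₂ t w)) (𝟙 (edgeᵇ H u v w)))
            (sym (cong (𝟙 (bad t) *_) (cong₂ _*_ (restrict (side₀ t u) (χ u == a)) (cong₂ _*_ (restrict (side₁ t v) (χ v == b))
              (cong (_* 𝟙 (edgeᵇ H u v w)) (restrict (side₂ t w) (χ w == c))))))))
          (∑-*ˡ vs (𝟙 (bad t)) _)) (∑-*ˡ vs (𝟙 (bad t)) _))
        (∑-*ˡ vs (𝟙 (bad t)) _)))
      where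
      eq : ∀ m p q r x y z h → p * (q * r) * (m * (x * (y * z)) * h) ≡ m * ((p * x) * ((q * y) * ((r * z) * h)))
      eq = solve-∀

    badVolume-boxes : badVolume ≡ (∑[ (a , b , c) ∈ boxes ] 𝟙 (bad (a , b , c)) *
      (classSize a * (classSize b * classSize c)))
    badVolume-boxes = trans (∑-boxes χ cube (λ t _ → 𝟙 (bad t))) (∑-cong boxes λ t@(a , b , c) →
      trans (∑-*ʳ cube (𝟙 (bad t)) _) (trans (*-comm _ (𝟙 (bad t))) (cong (𝟙 (bad t) *_)
        (trans (∑-triples vs _) (∑-product vs (λ u → 𝟙 (χ u == a)) (λ v → 𝟙 (χ v == b)) (λ w → 𝟙 (χ w == c)))))))

    bad⇒irregular : ∀ t → bad t ≡ true → irregular χ t ≡ true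
    bad⇒irregular t eq with mark t
    ... | false = eq

    sparse-gain : D * gainEdges ≤ gain
    sparse-gain = begin
      D * gainEdges                                                  ≡⟨ cong (D *_) gainEdges-boxes ⟩
      D * (∑[ t ∈ boxes ] 𝟙 (bad t) * boxEdges H (A t) (B t) (C t))  ≡⟨ ∑-*ˡ boxes D _ ⟨
      (∑[ t ∈ boxes ] D * (𝟙 (bad t) * boxEdges H (A t) (B t) (C t))) ≤⟨ ∑-mono boxes (λ t → pointwise t (bad t) (λ eq → witness-sparse t (bad⇒irregular t eq))) ⟩
      (∑[ t ∈ boxes ] 𝟙 (bad t) * (size H (A t) * (size H (B t) * size H (C t)))) ≡⟨ gain-boxes ⟨
      gain ∎
      where
      open ≤-Reasoning
      pointwise : ∀ t b → (b ≡ true → Witnessed t) →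
        D * (𝟙 b * boxEdges H (A t) (B t) (C t)) ≤ 𝟙 b * (size H (A t) * (size H (B t) * size H (C t)))
      pointwise t false _ = ≤-reflexive (*-zeroʳ D)
      pointwise t true s = begin
        D * (1 * boxEdges H (A t) (B t) (C t))                ≡⟨ cong (D *_) (*-identityˡ _) ⟩
        D * boxEdges H (A t) (B t) (C t)                      ≤⟨ proj₂ (proj₂ (proj₂ (s refl))) ⟩
        size H (A t) * (size H (B t) * size H (C t))          ≡⟨ *-identityˡ _ ⟨
        1 * (size H (A t) * (size H (B t) * size H (C t)))    ∎

    -- Each side of a witness is at least a fraction 1/e of its class, so at least a fraction 1/e³
    -- of every bad box becomes marked.
    bad-gain : badVolume ≤ e * (e * e) * gain
    bad-gain = begin
      badVolume ≡⟨ badVolume-boxes ⟩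
      (∑[ (a , b , c) ∈ boxes ] 𝟙 (bad (a , b , c)) *
        (classSize a * (classSize b * classSize c)))
        ≤⟨ ∑-mono boxes (λ t → pointwise t (bad t) (λ eq → witness-sparse t (bad⇒irregular t eq))) ⟩
      (∑[ t ∈ boxes ] e * (e * e) * (𝟙 (bad t) * (size H (A t) * (size H (B t) * size H (C t))))) ≡⟨ ∑-*ˡ boxes (e * (e * e)) _ ⟩
      e * (e * e) * _ ≡⟨ cong (e * (e * e) *_) gain-boxes ⟨
      e * (e * e) * gain ∎
      where
      open ≤-Reasoning
      pointwise : ∀ (t@(a , b , c) : Triple (Fin K)) z → (z ≡ true → Witnessed t) →
        𝟙 z * (classSize a * (classSize b * classSize c)) ≤
        e * (e * e) * (𝟙 z * (size H (A t) * (size H (B t) * size H (C t))))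
      pointwise t false _ = z≤n
      pointwise t@(a , b , c) true s = let pa , pb , pc , _ = s refl in begin
        1 * (classSize a * (classSize b * classSize c)) ≡⟨ *-identityˡ _ ⟩
        classSize a * (classSize b * classSize c) ≤⟨ *-mono-≤ pa (*-mono-≤ pb pc) ⟩
        (e * size H (A t)) * ((e * size H (B t)) * (e * size H (C t))) ≡⟨ eq e (size H (A t)) (size H (B t)) (size H (C t)) ⟩
        e * (e * e) * (1 * (size H (A t) * (size H (B t) * size H (C t)))) ∎
        where
        eq : ∀ e x y z → (e * x) * ((e * y) * (e * z)) ≡ e * (e * e) * (1 * (x * (y * z)))
        eq = solve-∀

    volume′≡ : (∑[ y ∈ cube ] 𝟙 (mark′ (map³ refined y))) ≡ volume + gain
    volume′≡ = trans (∑-cong cube mark′-split) (∑-+ cube _ _)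

    next : Marked (K * 2 ^ N)
    next = record { χ = refined ; mark = mark′ ; sparse = begin
      D * (∑[ y ∈ cube ] 𝟙 (mark′ (map³ refined y)) * 𝟙 (y edge))
        ≡⟨ cong (D *_) (trans (∑-cong cube λ y → trans (cong (_* 𝟙 (y edge)) (mark′-split y)) (*-distribʳ-+ (𝟙 (y edge)) (𝟙 (mark (map³ χ y))) _)) (∑-+ cube _ _)) ⟩
      D * ((∑[ y ∈ cube ] 𝟙 (mark (map³ χ y)) * 𝟙 (y edge)) + gainEdges) ≡⟨ *-distribˡ-+ D _ gainEdges ⟩
      D * (∑[ y ∈ cube ] 𝟙 (mark (map³ χ y)) * 𝟙 (y edge)) + D * gainEdges ≤⟨ +-mono-≤ sparse sparse-gain ⟩
      volume + gain ≡⟨ volume′≡ ⟨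
      (∑[ y ∈ cube ] 𝟙 (mark′ (map³ refined y))) ∎ }
      where open ≤-Reasoning

-- The sum over all stages bounds the number of colours at whichever stage the refinement stops. A
-- stage with K colours splits along three sets for each of the K³ colour triples.
colours : ℕ → ℕ → ℕ
colours zero K = K
colours (suc f) K = K + colours f (K * 2 ^ (3 * (K * (K * K))))

module _ {n : ℕ} (H : 3Graph n) (D e : ℕ) where

  record Partition (bound : ℕ) : Set where
    field
      {K}    : ℕ
      few    : K ≤ bound
      marked : Marked H D e K
      good   : D * Marked.badVolume marked ≤ n³ H D e

  -- While the bad volume exceeds n³/D, each refinement marks at least n³/(D e³) new triples.
  refine : ∀ f {K} (M : Marked H D e K) →
    D * (e * (e * e)) * n³ H D e ≤ f * n³ H D e + D * (e * (e * e)) * Marked.volume M → 0 < D * (e * (e * e)) →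
    Partition (colours f K)
  refine f {K} M inv 0<E with D * Marked.badVolume M ≤? n³ H D e
  refine zero {K} M inv 0<E | yes p = record { few = ≤-refl ; marked = M ; good = p }
  refine (suc f) {K} M inv 0<E | yes p = record { few = m≤m+n K _ ; marked = M ; good = p }
  -- Without fuel the invariant says that all n³ triples are marked, so that no bad volume is left.
  refine zero M inv 0<E | no p = contradiction (≤-trans (≤-reflexive (trans (cong (D *_) none) (*-zeroʳ D))) z≤n) p
    where
    none : Marked.badVolume M ≡ 0
    none = n≤0⇒n≡0 (+-cancelˡ-≤ (Marked.volume M) _ _ (≤-trans (Marked.volume+badVolume≤ M)
      (≤-trans (*-cancelˡ-≤ (D * (e * (e * e))) {{>-nonZero 0<E}} inv) (≤-reflexive (sym (+-identityʳ _))))))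
  refine (suc f) {K} M inv 0<E | no p = record { few = ≤-trans few (m≤n+m _ K) ; marked = marked ; good = good }
    where
    open Step H D e M
    E = D * (e * (e * e))
    step : E * n³ H D e ≤ f * n³ H D e + E * Marked.volume next
    step = begin
      E * n³ H D e                                            ≤⟨ inv ⟩
      n³ H D e + f * n³ H D e + E * Marked.volume M           ≤⟨ +-monoˡ-≤ _ (+-monoˡ-≤ _ (<⇒≤ (≰⇒> p))) ⟩
      D * Marked.badVolume M + f * n³ H D e + E * Marked.volume M ≤⟨ +-monoˡ-≤ _ (+-monoˡ-≤ _ (*-monoʳ-≤ D bad-gain)) ⟩
      D * (e * (e * e) * gain) + f * n³ H D e + E * Marked.volume M ≡⟨ eq D (e * (e * e)) gain (f * n³ H D e) (Marked.volume M) ⟩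
      f * n³ H D e + E * (Marked.volume M + gain)             ≡⟨ cong (λ v → f * n³ H D e + E * v) volume′≡ ⟨
      f * n³ H D e + E * Marked.volume next                   ∎
      where
      open ≤-Reasoning
      eq : ∀ D r g x v → D * (r * g) + x + D * r * v ≡ x + D * r * (v + g)
      eq = solve-∀
    open Partition (refine f next step 0<E) using (few; marked; good)

  abstract
    partition : 0 < D * (e * (e * e)) → Partition (colours (D * (e * (e * e))) 1)
    partition 0<E = refine (D * (e * (e * e))) start (m≤m+n _ _) 0<E
      where
      start : Marked H D e 1
      start = record { χ = λ _ → zero ; mark = λ _ → false
        ; sparse = ≤-trans (≤-reflexive (trans (cong (D *_) (∑-0 (triples (vertices H)))) (*-zeroʳ D))) z≤n }

-- From regular boxes to the edge count

m≤n*[m/n]+n : ∀ m n .{{_ : NonZero n}} → m ≤ n * (m / n) + n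
m≤n*[m/n]+n m n = ≤-trans (≤-reflexive (m≡m%n+[m/n]*n m n)) (≤-trans (+-monoˡ-≤ (m / n * n) (<⇒≤ (m%n<n m n)))
  (≤-reflexive (trans (+-comm n (m / n * n)) (cong (_+ n) (*-comm (m / n) n)))))

-- Changes one coordinate of a box volume. The lost weights `x` cost at most M each, and the change
-- m of the inner sum is paid for a total weight of at most n.
∑-replace : ∀ {A : Set} (cs : List A) (a b x f g : A → ℕ) n X m M → (∀ c → a c ≤ b c + x c) → ∑ cs b ≤ n → ∑ cs x ≤ X →
  (∀ c → f c ≤ g c + m) → (∀ c → f c ≤ M) → (∑[ c ∈ cs ] a c * f c) ≤ (∑[ c ∈ cs ] b c * g c) + (n * m + X * M)
∑-replace cs a b x f g n X m M a≤ b≤ x≤ f≤ f≤M = begin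
  (∑[ c ∈ cs ] a c * f c)
    ≤⟨ ∑-mono cs (λ c → ≤-trans (*-monoˡ-≤ (f c) (a≤ c)) (≤-trans (≤-reflexive (*-distribʳ-+ (f c) (b c) (x c)))
        (+-mono-≤ (≤-trans (*-monoʳ-≤ (b c) (f≤ c)) (≤-reflexive (*-distribˡ-+ (b c) (g c) m))) (*-monoʳ-≤ (x c) (f≤M c))))) ⟩
  (∑[ c ∈ cs ] (b c * g c + b c * m + x c * M))
    ≡⟨ trans (∑-+ cs (λ c → b c * g c + b c * m) (λ c → x c * M)) (cong₂ _+_ (trans (∑-+ cs (λ c → b c * g c) (λ c → b c * m))
        (cong (∑ cs (λ c → b c * g c) +_) (∑-*ʳ cs m b))) (∑-*ʳ cs M x)) ⟩
  (∑[ c ∈ cs ] b c * g c) + ∑ cs b * m + ∑ cs x * M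
    ≤⟨ +-mono-≤ (+-monoʳ-≤ _ (*-monoˡ-≤ m b≤)) (*-monoˡ-≤ M x≤) ⟩
  (∑[ c ∈ cs ] b c * g c) + n * m + X * M ≡⟨ +-assoc _ (n * m) (X * M) ⟩
  (∑[ c ∈ cs ] b c * g c) + (n * m + X * M) ∎
  where open ≤-Reasoning

positive : ℕ → Bool
positive zero = false
positive (suc _) = true

*-cong-≤ : ∀ q {s t} → (T (positive q) → s ≤ t) → q * s ≤ q * t
*-cong-≤ zero _ = z≤n
*-cong-≤ q@(suc _) f = *-monoʳ-≤ q (f _)

-- Bounds what `D * Q c` omits from a class beyond its D-th part: the constant part of the reserve,
-- 1006 overflowing tiles with D vertices each, and the rounding of the division by D.
overhead : ℕ → ℕ
overhead D = 1 + box-size D D + D * 1006 + D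

edgeCount : ∀ {n} → 3Graph n → ℕ
edgeCount H = ∑[ (u , v , w) ∈ triples (vertices H) ] 𝟙 (edgeᵇ H u v w)

maxColours : ℕ → ℕ
maxColours D = colours (D * (D * (D * D))) 1

record Certificate {n : ℕ} (H : 3Graph n) (D : ℕ) : Set where
  field
    {k Z X N} : ℕ
    forest  : ContainsTLF H (k * (3 * D ∸ 2))
    count≤  : D * edgeCount H ≤ n * (n * n) + n * (n * n) + D * (D * (D * D) * N + 3 * (n * n * X))
    N≤      : N ≤ 27 * (k * k * k) ⊎ N ≤ star-bound k Z
    size≤   : D * (3 * k + Z) ≤ n + D * (maxColours D * 1006)
    error≤  : D * X ≤ n + D * (maxColours D * overhead D)

module Assembly {n : ℕ} (H : 3Graph n) (D : ℕ) .{{_ : NonZero D}} (P : Partition H D D (maxColours D)) where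
  open Partition P using (K; few; marked; good)
  open Marked marked using (χ; mark; sparse; bad; badVolume; volume; volume+badVolume≤)
  open Classes H χ

  private
    cs = allFin K
    vs = vertices H

  regular : Triple (Fin K) → Bool
  regular t = not (irregular H D D χ t)

  nc : Fin K → ℕ
  nc = classSize

  -- `Q c` is a capacity in tiles, each of which takes D vertices per colour; the reserve and the
  -- possible overflow by 1006 tiles are set aside beforehand. A colour of capacity 0 gets reserve 0
  -- and so is never `Large`: `room` is then vacuous exactly where the subtraction may have been
  -- truncated.
  full-reserve Q reserve : Fin K → ℕ
  full-reserve c = nc c / D + (1 + box-size D D)
  Q c = (nc c ∸ (full-reserve c + D * 1006)) / D
  reserve c = if positive (Q c) then full-reserve c else 0

  admissible : Triple (Fin K) → Bool
  admissible (a , b , c) = regular (a , b , c) ∧ (positive (Q a) ∧ (positive (Q b) ∧ positive (Q c)))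

  reserve≡ : ∀ c → T (positive (Q c)) → reserve c ≡ full-reserve c
  reserve≡ c = branch (positive (Q c))
    where
    branch : ∀ b → T b → (if b then full-reserve c else 0) ≡ full-reserve c
    branch true _ = refl

  nonzero-reserve : ∀ c → 0 < reserve c → T (positive (Q c))
  nonzero-reserve c = branch (positive (Q c))
    where
    branch : ∀ b → 0 < (if b then full-reserve c else 0) → T b
    branch true _ = _

  DQ≤ : ∀ c → D * Q c ≤ nc c ∸ (full-reserve c + D * 1006)
  DQ≤ c = ≤-trans (≤-reflexive (*-comm D (Q c))) (m/n*n≤m _ D)

  x : Fin K → ℕ
  x c = nc c / D + overhead D

  nc≤ : ∀ c → nc c ≤ D * Q c + x c
  nc≤ c = begin
    nc c                                                   ≤⟨ m≤n+m∸n (nc c) y ⟩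
    y + (nc c ∸ y)                                         ≤⟨ +-monoʳ-≤ y (m≤n*[m/n]+n (nc c ∸ y) D) ⟩
    y + (D * Q c + D)                                      ≡⟨ e (nc c / D) (box-size D D) (D * 1006) (D * Q c) D ⟩
    D * Q c + x c                                          ∎
    where
    open ≤-Reasoning
    y = full-reserve c + D * 1006
    e : ∀ m b t q d → m + (1 + b) + t + (q + d) ≡ q + (m + (1 + b + t + d))
    e = solve-∀

  ∑-colours : ∀ (g : Fin K → ℕ) → (∑[ v ∈ vs ] g (χ v)) ≡ (∑[ c ∈ cs ] nc c * g c)
  ∑-colours g = trans (∑-fibres χ vs (λ c _ → g c)) (∑-cong cs λ c → ∑-*ʳ vs (g c) (λ v → 𝟙 (χ v == c)))

  ∑nc : ∑ cs nc ≡ n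
  ∑nc = trans (∑-cong cs λ c → sym (*-identityʳ (nc c))) (trans (sym (∑-colours (λ _ → 1)))
    (trans (sym (length-∑ vs)) (length-tabulate {n = n} id)))

  X : ℕ
  X = ∑ cs x

  error : D * X ≤ n + D * (maxColours D * overhead D)
  error = begin
    D * X                                                     ≡⟨ cong (D *_) (∑-+ cs (λ c → nc c / D) (λ _ → overhead D)) ⟩
    D * ((∑[ c ∈ cs ] nc c / D) + (∑[ c ∈ cs ] overhead D))   ≡⟨ *-distribˡ-+ D _ _ ⟩
    D * (∑[ c ∈ cs ] nc c / D) + D * (∑[ c ∈ cs ] overhead D) ≤⟨ +-mono-≤ parts (*-monoʳ-≤ D total) ⟩
    n + D * (maxColours D * overhead D)                       ∎
    where
    open ≤-Reasoning
    parts : D * (∑[ c ∈ cs ] nc c / D) ≤ n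
    parts = begin
      D * (∑[ c ∈ cs ] nc c / D)   ≡⟨ ∑-*ˡ cs D (λ c → nc c / D) ⟨
      (∑[ c ∈ cs ] D * (nc c / D)) ≤⟨ ∑-mono cs (λ c → ≤-trans (≤-reflexive (*-comm D (nc c / D))) (m/n*n≤m (nc c) D)) ⟩
      ∑ cs nc                      ≡⟨ ∑nc ⟩
      n                            ∎
    total : (∑[ c ∈ cs ] overhead D) ≤ maxColours D * overhead D
    total = ≤-trans (≤-reflexive (trans (∑-const cs (overhead D)) (cong (_* overhead D) (length-tabulate {n = K} id))))
      (*-monoˡ-≤ (overhead D) few)

  ∑DQ≤ : (∑[ c ∈ cs ] D * Q c) ≤ n
  ∑DQ≤ = ≤-trans (∑-mono cs λ c → ≤-trans (DQ≤ c) (m∸n≤m (nc c) (full-reserve c + D * 1006))) (≤-reflexive ∑nc)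

  regularVolume : ℕ
  regularVolume = ∑[ y ∈ triples vs ] 𝟙 (regular (map³ χ y))

  regularVolume-colours : regularVolume ≡ (∑[ c ∈ cs ] nc c * (∑[ a ∈ cs ] nc a * (∑[ b ∈ cs ] nc b * 𝟙 (regular (a , b , c)))))
  regularVolume-colours = trans (∑-triples vs _) (trans
    (∑-cong vs λ u → ∑-swap vs vs λ v w → 𝟙 (regular (χ u , χ v , χ w))) (trans
    (∑-swap vs vs λ u w → ∑[ v ∈ vs ] 𝟙 (regular (χ u , χ v , χ w))) (trans
    (∑-cong vs λ w → trans (∑-cong vs λ u → ∑-colours λ b → 𝟙 (regular (χ u , b , χ w)))
      (∑-colours λ a → ∑[ b ∈ cs ] nc b * 𝟙 (regular (a , b , χ w))))
    (∑-colours λ c → ∑[ a ∈ cs ] nc a * (∑[ b ∈ cs ] nc b * 𝟙 (regular (a , b , c)))))))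

  ∑-≤n : ∀ (f : Fin K → ℕ) M → (∀ c → f c ≤ M) → (∑[ c ∈ cs ] nc c * f c) ≤ n * M
  ∑-≤n f M p = ≤-trans (∑-mono cs λ c → *-monoʳ-≤ (nc c) (p c)) (≤-reflexive (trans (∑-*ʳ cs M nc) (cong (_* M) ∑nc)))

  regularVolume≤ : regularVolume ≤ (∑[ c ∈ cs ] D * Q c * (∑[ a ∈ cs ] D * Q a * (∑[ b ∈ cs ] D * Q b * 𝟙 (regular (a , b , c))))) + 3 * (n * n * X)
  regularVolume≤ = ≤-trans (≤-reflexive regularVolume-colours) (≤-trans
    (∑-replace cs nc (λ c → D * Q c) x
      (λ c → ∑[ a ∈ cs ] nc a * (∑[ b ∈ cs ] nc b * 𝟙 (regular (a , b , c))))
      (λ c → ∑[ a ∈ cs ] D * Q a * (∑[ b ∈ cs ] D * Q b * 𝟙 (regular (a , b , c)))) n X (n * X + X * n) (n * n) nc≤ ∑DQ≤ ≤-refl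
      (λ c → ≤-trans (∑-replace cs nc (λ c → D * Q c) x
        (λ a → ∑[ b ∈ cs ] nc b * 𝟙 (regular (a , b , c))) (λ a → ∑[ b ∈ cs ] D * Q b * 𝟙 (regular (a , b , c))) n X X n nc≤ ∑DQ≤ ≤-refl
        (λ a → ≤-trans (∑-replace cs nc (λ c → D * Q c) x (λ b → 𝟙 (regular (a , b , c))) (λ b → 𝟙 (regular (a , b , c))) n X 0 1 nc≤ ∑DQ≤ ≤-refl
            (λ b → m≤m+n _ 0) (λ b → 𝟙≤1 (regular (a , b , c))))
          (≤-reflexive (cong ((∑[ b ∈ cs ] D * Q b * 𝟙 (regular (a , b , c))) +_) (e₁ n X))))
        (λ a → in₁ c a))
        ≤-refl)
      (λ c → ∑-≤n (λ a → ∑[ b ∈ cs ] nc b * 𝟙 (regular (a , b , c))) n (in₁ c)))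
    (≤-reflexive (cong ((∑[ c ∈ cs ] D * Q c * (∑[ a ∈ cs ] D * Q a * (∑[ b ∈ cs ] D * Q b * 𝟙 (regular (a , b , c))))) +_) (e₂ n X))))
    where
    in₁ : ∀ c a → (∑[ b ∈ cs ] nc b * 𝟙 (regular (a , b , c))) ≤ n
    in₁ c a = ≤-trans (∑-≤n (λ b → 𝟙 (regular (a , b , c))) 1 λ b → 𝟙≤1 (regular (a , b , c))) (≤-reflexive (*-identityʳ n))
    e₁ : ∀ n X → n * 0 + X * 1 ≡ X
    e₁ = solve-∀
    e₂ : ∀ n X → n * (n * X + X * n) + X * (n * n) ≡ 3 * (n * n * X)
    e₂ = solve-∀

  -- A regular box that is not admissible has a side of capacity 0 and contributes nothing.
  regular-admissible : (∑[ c ∈ cs ] Q c * (∑[ a ∈ cs ] Q a * (∑[ b ∈ cs ] Q b * 𝟙 (regular (a , b , c)))))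
    ≤ (∑[ c ∈ cs ] Q c * (∑[ a ∈ cs ] Q a * (∑[ b ∈ cs ] Q b * 𝟙 (admissible (a , b , c)))))
  regular-admissible = ∑-mono cs λ c → *-cong-≤ (Q c) λ pc → ∑-mono cs λ a → *-cong-≤ (Q a) λ pa → ∑-mono cs λ b → *-cong-≤ (Q b) λ pb →
    all-positive (regular (a , b , c)) (positive (Q a)) (positive (Q b)) (positive (Q c)) pa pb pc
    where
    all-positive : ∀ r p q s → T p → T q → T s → 𝟙 r ≤ 𝟙 (r ∧ (p ∧ (q ∧ s)))
    all-positive false _ _ _ _ _ _ = z≤n
    all-positive true true true true _ _ _ = ≤-refl

  scaled : (∑[ c ∈ cs ] D * Q c * (∑[ a ∈ cs ] D * Q a * (∑[ b ∈ cs ] D * Q b * 𝟙 (regular (a , b , c)))))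
    ≡ D * (D * D) * (∑[ c ∈ cs ] Q c * (∑[ a ∈ cs ] Q a * (∑[ b ∈ cs ] Q b * 𝟙 (regular (a , b , c)))))
  scaled = trans (∑-cong cs λ c → trans (cong (D * Q c *_) (trans (∑-cong cs λ a → trans (cong (D * Q a *_) (pull λ b → 𝟙 (regular (a , b , c))))
      (e D (Q a) D _)) (∑-*ˡ cs (D * D) _))) (e D (Q c) (D * D) _)) (∑-*ˡ cs (D * (D * D)) _)
    where
    e : ∀ d q r s → d * q * (r * s) ≡ d * r * (q * s)
    e = solve-∀
    pull : ∀ g → (∑[ b ∈ cs ] D * Q b * g b) ≡ D * (∑[ b ∈ cs ] Q b * g b)
    pull g = trans (∑-cong cs λ b → *-assoc D (Q b) (g b)) (∑-*ˡ cs D _)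

  -- Every box is marked, bad or regular. Marked boxes contain few edges by `sparse`, bad ones have
  -- small volume by `good`, and in regular boxes all triples are counted as if they were edges.
  edges-split : D * edgeCount H ≤ n * (n * n) + n * (n * n) + D * regularVolume
  edges-split = begin
    D * edgeCount H
      ≤⟨ *-monoʳ-≤ D (∑-mono cube λ y@(u , v , w) → pointwise (mark (map³ χ y)) (irregular H D D χ (map³ χ y)) (edgeᵇ H u v w)) ⟩
    D * (∑[ y@(u , v , w) ∈ cube ] (𝟙 (mark (map³ χ y)) * 𝟙 (edgeᵇ H u v w) + 𝟙 (bad (map³ χ y)) + 𝟙 (regular (map³ χ y))))
      ≡⟨ cong (D *_) (trans (∑-+ cube _ _) (cong (_+ regularVolume) (∑-+ cube _ _))) ⟩
    D * ((∑[ y@(u , v , w) ∈ cube ] 𝟙 (mark (map³ χ y)) * 𝟙 (edgeᵇ H u v w)) + badVolume + regularVolume)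
      ≡⟨ trans (*-distribˡ-+ D _ regularVolume) (cong (_+ D * regularVolume) (*-distribˡ-+ D _ badVolume)) ⟩
    D * (∑[ y@(u , v , w) ∈ cube ] 𝟙 (mark (map³ χ y)) * 𝟙 (edgeᵇ H u v w)) + D * badVolume + D * regularVolume
      ≤⟨ +-monoˡ-≤ (D * regularVolume) (+-mono-≤ (≤-trans sparse (≤-trans (m≤m+n volume badVolume) volume+badVolume≤)) good) ⟩
    n * (n * n) + n * (n * n) + D * regularVolume ∎
    where
    open ≤-Reasoning
    cube = triples vs
    pointwise : ∀ m i h → 𝟙 h ≤ 𝟙 m * 𝟙 h + 𝟙 (not m ∧ i) + 𝟙 (not i)
    pointwise m i false = z≤n
    pointwise true i true = s≤s z≤n
    pointwise false true true = s≤s z≤n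
    pointwise false false true = s≤s z≤n

  module Solved (0<D : 0 < D) (O : LocalSearch.Optimum Q 1006 admissible) where
    open Counting Q admissible O using (k; slack; volume-bound; size-bound; load) renaming (volume to admissibleVolume)
    open LocalSearch.Optimum O using (L; allowed)
    open Packing H χ D D D 0<D using (Large; Forest; pack)

    parts : ∀ {t} → T (admissible t) → let (a , b , c) = t in Regular D D t × Large reserve a × Large reserve b × Large reserve c
    parts {t@(a , b , c)} adm =
      let r , ps = Equivalence.to (T-∧ {regular t}) adm
          pa , qs = Equivalence.to (T-∧ {positive (Q a)}) ps
          pb , pc = Equivalence.to (T-∧ {positive (Q b)}) qs
      in regular⇒Regular H D D χ t (not-T r) , large a pa , large b pb , large c pc
      where
      not-T : ∀ {b} → T (not b) → b ≡ false
      not-T {false} _ = refl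
      large : ∀ c → T (positive (Q c)) → Large reserve c
      large c p = record
        { fraction = subst (λ s → nc c ≤ D * s) (sym (reserve≡ c p)) (begin
            nc c                        ≤⟨ m≤n*[m/n]+n (nc c) D ⟩
            D * (nc c / D) + D          ≡⟨ cong (D * (nc c / D) +_) (*-identityʳ D) ⟨
            D * (nc c / D) + D * 1      ≡⟨ *-distribˡ-+ D (nc c / D) 1 ⟨
            D * (nc c / D + 1)          ≤⟨ *-monoʳ-≤ D (+-monoʳ-≤ (nc c / D) (m≤m+n 1 (box-size D D))) ⟩
            D * full-reserve c          ∎)
        ; enough = ≤-trans (≤-trans (n≤1+n _) (m≤n+m _ (nc c / D))) (≤-reflexive (sym (reserve≡ c p))) }
        where open ≤-Reasoning

    room : ∀ c → Large reserve c → D * count c (flat L) + reserve c ≤ nc c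
    room c large = subst (λ s → D * count c (flat L) + s ≤ nc c) (sym (reserve≡ c p)) (begin
      D * count c (flat L) + full-reserve c             ≤⟨ +-monoˡ-≤ (full-reserve c) (*-monoʳ-≤ D (load c)) ⟩
      D * (Q c + 1006) + full-reserve c                 ≡⟨ e D (Q c) 1006 (full-reserve c) ⟩
      D * Q c + y                                       ≤⟨ +-monoˡ-≤ y (DQ≤ c) ⟩
      (nc c ∸ y) + y                                    ≡⟨ m∸n+n≡m (<⇒≤ (≰⇒> λ le → zero-Q le p)) ⟩
      nc c                                              ∎)
      where
      open ≤-Reasoning
      y = full-reserve c + D * 1006
      e : ∀ d q t r → d * (q + t) + r ≡ d * q + (r + d * t)
      e = solve-∀
      p : T (positive (Q c))
      p = nonzero-reserve c (≤-trans (s≤s z≤n) (Large.enough large))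
      zero-Q : nc c ≤ y → ¬ T (positive (Q c))
      zero-Q le = subst (λ q → ¬ T (positive q)) (sym (trans (cong (_/ D) (m≤n⇒m∸n≡0 le)) (0/n≡0 D))) id

    certificate : Certificate H D
    certificate = record
      { k = k ; Z = slack ; X = X ; N = admissibleVolume
      ; forest = paths , distinct , tight , total
      ; count≤ = ≤-trans edges-split (+-monoʳ-≤ (n * (n * n) + n * (n * n)) (*-monoʳ-≤ D (≤-trans regularVolume≤
          (+-monoˡ-≤ (3 * (n * n * X)) (≤-trans (≤-reflexive scaled) (*-monoʳ-≤ (D * (D * D)) regular-admissible))))))
      ; N≤ = volume-bound
      ; size≤ = begin
          D * (3 * k + slack)                    ≤⟨ *-monoʳ-≤ D size-bound ⟩
          D * ((∑[ c ∈ cs ] Q c) + K * 1006)     ≡⟨ *-distribˡ-+ D _ (K * 1006) ⟩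
          D * (∑[ c ∈ cs ] Q c) + D * (K * 1006) ≡⟨ cong (_+ D * (K * 1006)) (∑-*ˡ cs D Q) ⟨
          (∑[ c ∈ cs ] D * Q c) + D * (K * 1006) ≤⟨ +-mono-≤ ∑DQ≤ (*-monoʳ-≤ D (*-monoˡ-≤ 1006 few)) ⟩
          n + D * (maxColours D * 1006)          ∎
      ; error≤ = error }
      where
      open ≤-Reasoning
      open Forest (pack {reserve} L everything (All.map (λ {t} → parts {t}) allowed) room)

abstract
  certify : ∀ {n} (H : 3Graph n) D → 0 < D → Certificate H D
  certify H D 0<D = Solved.certificate 0<D (LocalSearch.optimum Q 1006 admissible)
    where
    instance
      D≢0 : NonZero D
      D≢0 = >-nonZero 0<D
    0<D⁴ : 0 < D * (D * (D * D))
    0<D⁴ = *-mono-≤ 0<D (*-mono-≤ 0<D (*-mono-≤ 0<D 0<D))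
    open Assembly H D (partition H D D 0<D⁴)

-- Counting each edge by its six orderings

∑-∈? : ∀ {n} (p : Subset n) → (∑[ x ∈ allFin n ] 𝟙 (does (x ∈? p))) ≡ ∣ p ∣
∑-∈? [] = refl
∑-∈? {suc n} (inside ∷ p) = cong suc (trans (∑-tabulate {n = n} suc _) (∑-∈? p))
∑-∈? {suc n} (outside ∷ p) = trans (∑-tabulate {n = n} suc _) (∑-∈? p)

∣p∣≤1+∣p-x∣ : ∀ {n} (p : Subset n) x → ∣ p ∣ ≤ suc ∣ p - x ∣
∣p∣≤1+∣p-x∣ p x = ≤-trans (p⊆q⇒∣p∣≤∣q∣ sub) (≤-trans (∣p∪q∣≤∣p∣+∣q∣ ⁅ x ⁆ (p - x)) (≤-reflexive (cong (_+ ∣ p - x ∣) (∣⁅x⁆∣≡1 x))))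
  where
  sub : p ⊆ ⁅ x ⁆ ∪ (p - x)
  sub {y} y∈ with y F.≟ x
  ... | yes refl = x∈p∪q⁺ (inj₁ (x∈⁅x⁆ x))
  ... | no y≢x = x∈p∪q⁺ (inj₂ (x∈p∧x≢y⇒x∈p-y y∈ y≢x))

∈⇒0<∣p∣ : ∀ {n} {p : Subset n} {x} → x ∈ˢ p → 0 < ∣ p ∣
∈⇒0<∣p∣ x∈ = ≤-trans (s≤s z≤n) (x∈p⇒∣p-x∣<∣p∣ x∈)

triple-covers : ∀ {n} (e : Subset n) {u v w} → ∣ e ∣ ≡ 3 → u ∈ˢ e → v ∈ˢ e - u → w ∈ˢ e - u - v → e ≡ triple u v w
triple-covers e {u} {v} {w} size u∈ v∈ w∈ = ⊆-antisym to from
  where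
  v∈e = p─q⊆p e ⁅ u ⁆ v∈
  w∈e = p─q⊆p e ⁅ u ⁆ (p─q⊆p (e - u) ⁅ v ⁆ w∈)
  from : triple u v w ⊆ e
  from x∈ with x∈p∪q⁻ ⁅ u ⁆ (⁅ v ⁆ ∪ ⁅ w ⁆) x∈
  ... | inj₁ p rewrite x∈⁅y⁆⇒x≡y u p = u∈
  ... | inj₂ q with x∈p∪q⁻ ⁅ v ⁆ ⁅ w ⁆ q
  ...   | inj₁ p rewrite x∈⁅y⁆⇒x≡y v p = v∈e
  ...   | inj₂ p rewrite x∈⁅y⁆⇒x≡y w p = w∈e
  exhausted : ∣ e - u - v - w ∣ ≤ 0
  exhausted = ≤-pred (≤-trans (x∈p⇒∣p-x∣<∣p∣ w∈) (≤-pred (≤-trans (x∈p⇒∣p-x∣<∣p∣ v∈) (≤-pred (≤-trans (x∈p⇒∣p-x∣<∣p∣ u∈) (≤-reflexive size))))))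
  to : e ⊆ triple u v w
  to {x} x∈ with x F.≟ u | x F.≟ v | x F.≟ w
  ... | yes refl | _ | _ = x∈p∪q⁺ (inj₁ (x∈⁅x⁆ u))
  ... | no _ | yes refl | _ = x∈p∪q⁺ (inj₂ (x∈p∪q⁺ (inj₁ (x∈⁅x⁆ v))))
  ... | no _ | no _ | yes refl = x∈p∪q⁺ (inj₂ (x∈p∪q⁺ (inj₂ (x∈⁅x⁆ w))))
  ... | no p | no q | no r = contradiction exhausted (<⇒≱ (∈⇒0<∣p∣ (x∈p∧x≢y⇒x∈p-y (x∈p∧x≢y⇒x∈p-y (x∈p∧x≢y⇒x∈p-y x∈ p) q) r)))

_≟ˢ_ : ∀ {n} (p q : Subset n) → Dec (p ≡ q)
_≟ˢ_ = ≡-dec Bool._≟_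

∑-∈?-≥ : ∀ {n} (p : Subset n) k m (f : Fin n → ℕ) → k ≤ ∣ p ∣ → (∀ x → x ∈ˢ p → m ≤ f x) → k * m ≤ ∑ (allFin n) f
∑-∈?-≥ {n} p k m f k≤ p⇒ = ≤-trans (*-monoˡ-≤ m k≤) (≤-trans (≤-reflexive (trans (cong (_* m) (sym (∑-∈? p))) (sym (∑-*ʳ (allFin n) m _))))
  (∑-mono (allFin n) λ x → pointwise (x ∈? p) (p⇒ x)))
  where
  pointwise : ∀ {P : Set} (d : Dec P) {y} → (P → m ≤ y) → 𝟙 (does d) * m ≤ y
  pointwise (yes q) f = ≤-trans (≤-reflexive (+-identityʳ m)) (f q)
  pointwise (no _) f = z≤n

-- Three choices of u in e, then two of v, then one of w.
six-orderings : ∀ {n} (e : Subset n) → ∣ e ∣ ≡ 3 → 6 ≤ (∑[ u ∈ allFin n ] ∑[ v ∈ allFin n ] ∑[ w ∈ allFin n ] 𝟙 (does (e ≟ˢ triple u v w)))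
six-orderings {n} e size = ∑-∈?-≥ e 3 2 _ (≤-reflexive (sym size)) λ u u∈ →
  ∑-∈?-≥ (e - u) 2 1 _ (remaining e u (≤-reflexive (sym size))) λ v v∈ →
  ∑-∈?-≥ (e - u - v) 1 1 _ (remaining (e - u) v (remaining e u (≤-reflexive (sym size)))) λ w w∈ →
  ≤-reflexive (sym (cong 𝟙 (dec-true (e ≟ˢ triple u v w) (triple-covers e size u∈ v∈ w∈))))
  where
  remaining : ∀ p x {k} → suc k ≤ ∣ p ∣ → k ≤ ∣ p - x ∣
  remaining p x le = ≤-pred (≤-trans le (∣p∣≤1+∣p-x∣ p x))

member-count : ∀ {n} (es : List (Subset n)) → Unique es → ∀ e → (∑[ e′ ∈ es ] 𝟙 (does (e′ ≟ˢ e))) ≤ 𝟙 (does (Any.any? (≡-dec Bool._≟_ e) es))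
member-count es u e with Any.any? (≡-dec Bool._≟_ e) es
... | yes _ = at-most-one es u
  where
  absent : ∀ es → All (λ x → e ≢ x) es → (∑[ e′ ∈ es ] 𝟙 (does (e′ ≟ˢ e))) ≡ 0
  absent [] _ = refl
  absent (x ∷ es) (p ∷ ps) = cong₂ _+_ (cong 𝟙 (dec-false (x ≟ˢ e) (λ q → p (sym q)))) (absent es ps)
  at-most-one : ∀ es → Unique es → (∑[ e′ ∈ es ] 𝟙 (does (e′ ≟ˢ e))) ≤ 1
  at-most-one [] _ = z≤n
  at-most-one (x ∷ es) (p ∷ u) with x ≟ˢ e
  ... | yes refl = ≤-reflexive (cong suc (absent es p))
  ... | no _ = at-most-one es u
... | no e∉ = ≤-reflexive (none es e∉)
  where
  none : ∀ es → ¬ Any (e ≡_) es → (∑[ e′ ∈ es ] 𝟙 (does (e′ ≟ˢ e))) ≡ 0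
  none [] _ = refl
  none (x ∷ es) n = cong₂ _+_ (cong 𝟙 (dec-false (x ≟ˢ e) (λ q → n (here (sym q))))) (none es (λ a → n (there a)))

6*numEdges≤edgeCount : ∀ {n} (H : 3Graph n) → 6 * numEdges H ≤ edgeCount H
6*numEdges≤edgeCount {n} H = begin
  6 * numEdges H                                             ≡⟨ *-comm 6 (numEdges H) ⟩
  numEdges H * 6                                             ≡⟨ ∑-const (edges H) 6 ⟨
  (∑[ e ∈ edges H ] 6)                                       ≤⟨ ∑-mono-∈ (edges H) (λ {e} e∈ → six-orderings e (All.lookup (size3 H) e∈)) ⟩
  (∑[ e ∈ edges H ] ∑[ u ∈ vs ] ∑[ v ∈ vs ] ∑[ w ∈ vs ] 𝟙 (does (e ≟ˢ triple u v w)))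
    ≡⟨ ∑-cong (edges H) (λ e → ∑-triples vs (at e)) ⟨
  (∑[ e ∈ edges H ] ∑ (triples vs) (at e))                   ≡⟨ ∑-swap (edges H) (triples vs) at ⟩
  (∑[ y ∈ triples vs ] ∑[ e ∈ edges H ] at e y)              ≤⟨ ∑-mono (triples vs) (λ (u , v , w) → member-count (edges H) (nodup H) (triple u v w)) ⟩
  edgeCount H                                                ∎
  where
  open ≤-Reasoning
  vs = allFin n
  at : Subset n → _ → ℕ
  at e (u , v , w) = 𝟙 (does (e ≟ˢ triple u v w))

-- Truncating a forest

-- Deleting the first vertex of a path with an edge destroys exactly one edge; paths without edges
-- in front of it are discarded.
drop-edge : ∀ {n} {H : 3Graph n} paths {m} → Unique (concat paths) → All (TightPathIn H) paths → sum (map pathEdges paths) ≡ suc m →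
  ContainsTLF H m
drop-edge ([] ∷ ps) u (_ ∷ t) e = drop-edge ps u t e
drop-edge ((x ∷ []) ∷ ps) (_ ∷ u) (_ ∷ t) e = drop-edge ps u t e
drop-edge ((x ∷ y ∷ []) ∷ ps) (_ ∷ _ ∷ u) (_ ∷ t) e = drop-edge ps u t e
drop-edge ((x ∷ y ∷ z ∷ xs) ∷ ps) (_ ∷ u) ((_ , p) ∷ t) e = (y ∷ z ∷ xs) ∷ ps , u , p ∷ t , suc-injective e

-- The packing may produce more edges than wanted, whereas `ContainsTLF` prescribes their exact
-- number.
shorten : ∀ {n} {H : 3Graph n} {m} r → r ≤ m → ContainsTLF H m → ContainsTLF H r
shorten {H = H} {m} r le F = go (m ∸ r) (subst (ContainsTLF H) (sym (m∸n+n≡m le)) F)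
  where
  go : ∀ k → ContainsTLF H (k + r) → ContainsTLF H r
  go zero F = F
  go (suc k) (paths , u , t , e) = go k (drop-edge paths u t e)

-- Comparison with the binomial bound

nC2-formula : ∀ n → 2 * (n choose 2) + n ≡ n * n
nC2-formula zero = refl
nC2-formula (suc n) = begin
  2 * (suc n choose 2) + suc n               ≡⟨ cong (λ x → 2 * x + suc n) (nCk+nC[k+1]≡[n+1]C[k+1] n 1) ⟨
  2 * (n choose 1 + n choose 2) + suc n           ≡⟨ cong (λ x → 2 * (x + n choose 2) + suc n) (nC1≡n n) ⟩
  2 * (n + n choose 2) + suc n               ≡⟨ e n (n choose 2) ⟩
  (2 * (n choose 2) + n) + (n + suc n)       ≡⟨ cong (_+ (n + suc n)) (nC2-formula n) ⟩
  n * n + (n + suc n)                   ≡⟨ e′ n ⟩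
  suc n * suc n                         ∎
  where
  open ≡-Reasoning
  e : ∀ n b → 2 * (n + b) + suc n ≡ (2 * b + n) + (n + suc n)
  e = solve-∀
  e′ : ∀ n → n * n + (n + suc n) ≡ suc n * suc n
  e′ = solve-∀

-- The expansion n(n - 1)(n - 2) = n³ - 3n² + 2n, arranged without subtraction.
nC3-formula : ∀ n → 6 * (n choose 3) + 3 * (n * n) ≡ n * (n * n) + 2 * n
nC3-formula zero = refl
nC3-formula (suc n) = begin
  6 * (suc n choose 3) + 3 * (suc n * suc n)            ≡⟨ cong (λ x → 6 * x + 3 * (suc n * suc n)) (nCk+nC[k+1]≡[n+1]C[k+1] n 2) ⟨
  6 * (n choose 2 + n choose 3) + 3 * (suc n * suc n)        ≡⟨ e n (n choose 2) (n choose 3) ⟩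
  (6 * (n choose 3) + 3 * (n * n)) + 3 * (2 * (n choose 2) + n) + (3 * n + 3) ≡⟨ cong₂ (λ x y → x + 3 * y + (3 * n + 3)) (nC3-formula n) (nC2-formula n) ⟩
  (n * (n * n) + 2 * n) + 3 * (n * n) + (3 * n + 3) ≡⟨ e′ n ⟩
  suc n * (suc n * suc n) + 2 * suc n              ∎
  where
  open ≡-Reasoning
  e : ∀ n b c → 6 * (b + c) + 3 * (suc n * suc n) ≡ (6 * c + 3 * (n * n)) + 3 * (2 * b + n) + (3 * n + 3)
  e = solve-∀
  e′ : ∀ n → (n * (n * n) + 2 * n) + 3 * (n * n) + (3 * n + 3) ≡ suc n * (suc n * suc n) + 2 * suc n
  e′ = solve-∀

6*nC3≤n³ : ∀ n → 6 * (n choose 3) ≤ n * (n * n)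
6*nC3≤n³ zero = z≤n
6*nC3≤n³ n@(suc n′) = +-cancelʳ-≤ (3 * (n * n)) _ _ (≤-trans (≤-reflexive (nC3-formula n))
  (+-monoʳ-≤ (n * (n * n)) (*-mono-≤ {2} {3} (n≤1+n 2) (m≤m*n n n))))

n³≤6*nC3 : ∀ n → n * (n * n) ≤ 6 * (n choose 3) + 3 * (n * n)
n³≤6*nC3 n = ≤-trans (m≤m+n _ (2 * n)) (≤-reflexive (sym (nC3-formula n)))

-- A perturbation by t changes a cube by O(t M²). The constant is 7 for c = 1 and 19 for c = 2, the
-- two cases that occur below.
cube-+ : ∀ a t M c → a ≤ c * M → t ≤ M → (a + t) * ((a + t) * (a + t)) ≤ a * (a * a) + (3 * (c * c) + 3 * c + 1) * (t * (M * M))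
cube-+ a t M c a≤ t≤ = begin
  (a + t) * ((a + t) * (a + t))                                                   ≡⟨ e a t ⟩
  a * (a * a) + t * (3 * (a * a) + 3 * (a * t) + t * t)                           ≤⟨ +-monoʳ-≤ (a * (a * a)) (*-monoʳ-≤ t (+-mono-≤ (+-mono-≤ (*-monoʳ-≤ 3 (*-mono-≤ a≤ a≤)) (*-monoʳ-≤ 3 (*-mono-≤ a≤ t≤))) (*-mono-≤ t≤ t≤))) ⟩
  a * (a * a) + t * (3 * (c * M * (c * M)) + 3 * (c * M * M) + M * M)              ≡⟨ cong (a * (a * a) +_) (e′ t M c) ⟩
  a * (a * a) + (3 * (c * c) + 3 * c + 1) * (t * (M * M))                         ∎
  where
  open ≤-Reasoning
  e : ∀ a t → (a + t) * ((a + t) * (a + t)) ≡ a * (a * a) + t * (3 * (a * a) + 3 * (a * t) + t * t)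
  e = solve-∀
  e′ : ∀ t M c → t * (3 * (c * M * (c * M)) + 3 * (c * M * M) + M * M) ≡ (3 * (c * c) + 3 * c + 1) * (t * (M * M))
  e′ = solve-∀

cube-mono : ∀ {a b} → a ≤ b → a * (a * a) ≤ b * (b * b)
cube-mono le = *-mono-≤ le (*-mono-≤ le le)

star-bound-monoʳ : ∀ k {Z Z′} → Z ≤ Z′ → star-bound k Z ≤ star-bound k Z′
star-bound-monoʳ k le = +-monoʳ-≤ (19 * (k * k * k)) (+-mono-≤ (*-monoʳ-≤ 15 (*-monoˡ-≤ (k * k) le)) (*-monoʳ-≤ 3 (*-monoˡ-≤ k (*-mono-≤ le le))))

star-bound-cubes : ∀ k Z → star-bound k Z + (2 * k + Z) * ((2 * k + Z) * (2 * k + Z)) ≡ (3 * k + Z) * ((3 * k + Z) * (3 * k + Z))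
star-bound-cubes = e
  where
  e : ∀ k Z → 19 * (k * k * k) + (15 * (Z * (k * k)) + 3 * (Z * Z * k)) + (2 * k + Z) * ((2 * k + Z) * (2 * k + Z)) ≡ (3 * k + Z) * ((3 * k + Z) * (3 * k + Z))
  e = solve-∀

star-bound-scale : ∀ D k Z → D * (D * D) * star-bound k Z ≡ star-bound (D * k) (D * Z)
star-bound-scale = e
  where
  e : ∀ D k Z → D * (D * D) * (19 * (k * k * k) + (15 * (Z * (k * k)) + 3 * (Z * Z * k))) ≡
    19 * (D * k * (D * k) * (D * k)) + (15 * (D * Z * (D * k * (D * k))) + 3 * (D * Z * (D * Z) * (D * k)))
  e = solve-∀

clique≤bound : ∀ n r s t {T} → r ≤ n → t ≤ n → T ≤ (r + t) * ((r + t) * (r + t)) → T ≤ 6 * bound n r s + 3 * (n * n) + 7 * (t * (n * n))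
clique≤bound n r s t {T} r≤ t≤ T≤ = begin
  T                                              ≤⟨ T≤ ⟩
  (r + t) * ((r + t) * (r + t))                  ≤⟨ cube-+ r t n 1 (≤-trans r≤ (≤-reflexive (sym (*-identityˡ n)))) t≤ ⟩
  r * (r * r) + 7 * (t * (n * n))                ≤⟨ +-monoˡ-≤ _ (n³≤6*nC3 r) ⟩
  6 * (r choose 3) + 3 * (r * r) + 7 * (t * (n * n))  ≤⟨ +-monoˡ-≤ _ (+-mono-≤ (*-monoʳ-≤ 6 (m≤m⊔n (r choose 3) _)) (*-monoʳ-≤ 3 (*-mono-≤ r≤ r≤))) ⟩
  6 * bound n r s + 3 * (n * n) + 7 * (t * (n * n)) ∎
  where open ≤-Reasoning

-- Since `star-bound` grows with Z, Z may be enlarged by g until 3k + Z is exactly n + t. The bound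
-- is then the difference of the cubes of n + t and W = n + t - k, and k ≤ s + 2t makes n - s at
-- most W + t. The errors 7 and 19 of the two cubes add up to 26.
star≤bound : ∀ n r s t k Z → t ≤ n → 3 * k + Z ≤ n + t → k ≤ s + 2 * t → star-bound k Z ≤ 6 * bound n r s + 3 * (n * n) + 26 * (t * (n * n))
star≤bound n r s t k Z t≤ size≤ k≤ = +-cancelʳ-≤ W³ _ _ (begin
  star-bound k Z + W³                       ≤⟨ +-monoˡ-≤ W³ (star-bound-monoʳ k (m≤m+n Z g)) ⟩
  star-bound k Z′ + W³                      ≡⟨ star-bound-cubes k Z′ ⟩
  (3 * k + Z′) * ((3 * k + Z′) * (3 * k + Z′)) ≡⟨ cong (λ y → y * (y * y)) total ⟩
  (n + t) * ((n + t) * (n + t))             ≤⟨ cube-+ n t n 1 (≤-reflexive (sym (*-identityˡ n))) t≤ ⟩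
  n * (n * n) + 7 * τ                       ≤⟨ +-monoˡ-≤ (7 * τ) (n³≤6*nC3 n) ⟩
  6 * (n choose 3) + 3 * (n * n) + 7 * τ         ≤⟨ +-monoˡ-≤ (7 * τ) (+-monoˡ-≤ (3 * (n * n)) (*-monoʳ-≤ 6 (m≤n+m∸n (n choose 3) ((n ∸ s) choose 3)))) ⟩
  6 * (((n ∸ s) choose 3) + q) + 3 * (n * n) + 7 * τ ≤⟨ +-monoˡ-≤ (7 * τ) (+-monoˡ-≤ (3 * (n * n)) (*-monoʳ-≤ 6 (+-monoʳ-≤ ((n ∸ s) choose 3) (m≤n⊔m (r choose 3) q)))) ⟩
  6 * (((n ∸ s) choose 3) + bound n r s) + 3 * (n * n) + 7 * τ ≡⟨ e₁ ((n ∸ s) choose 3) (bound n r s) (3 * (n * n)) τ ⟩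
  6 * ((n ∸ s) choose 3) + (6 * bound n r s + 3 * (n * n) + 7 * τ) ≤⟨ +-monoˡ-≤ _ rest ⟩
  (W³ + 19 * τ) + (6 * bound n r s + 3 * (n * n) + 7 * τ) ≡⟨ e₂ W³ (6 * bound n r s + 3 * (n * n)) τ ⟩
  6 * bound n r s + 3 * (n * n) + 26 * τ + W³ ∎)
  where
  open ≤-Reasoning
  g = n + t ∸ (3 * k + Z)
  Z′ = Z + g
  W = 2 * k + Z′
  W³ = W * (W * W)
  τ = t * (n * n)
  q = (n choose 3) ∸ ((n ∸ s) choose 3)
  e₁ : ∀ a b c τ → 6 * (a + b) + c + 7 * τ ≡ 6 * a + (6 * b + c + 7 * τ)
  e₁ = solve-∀
  e₂ : ∀ w b τ → (w + 19 * τ) + (b + 7 * τ) ≡ b + 26 * τ + w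
  e₂ = solve-∀
  total : 3 * k + Z′ ≡ n + t
  total = trans (sym (+-assoc (3 * k) Z g)) (m+[n∸m]≡n size≤)
  W≤ : W ≤ 2 * n
  W≤ = ≤-trans (+-monoˡ-≤ Z′ (*-monoˡ-≤ k (n≤1+n 2))) (≤-trans (≤-reflexive total) (≤-trans (+-monoʳ-≤ n t≤) (≤-reflexive (cong (n +_) (sym (+-identityʳ n))))))
  n∸s≤ : n ∸ s ≤ W + t
  n∸s≤ = m≤n+o⇒m∸n≤o n s (+-cancelʳ-≤ t n _ (begin
    n + t                 ≡⟨ total ⟨
    3 * k + Z′            ≡⟨ e₃ k Z′ ⟩
    k + W                 ≤⟨ +-monoˡ-≤ W k≤ ⟩
    s + 2 * t + W         ≡⟨ e₄ s t W ⟩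
    s + (W + t) + t       ∎))
    where
    e₃ : ∀ k z → 3 * k + z ≡ k + (2 * k + z)
    e₃ = solve-∀
    e₄ : ∀ s t w → s + 2 * t + w ≡ s + (w + t) + t
    e₄ = solve-∀
  rest : 6 * ((n ∸ s) choose 3) ≤ W³ + 19 * τ
  rest = ≤-trans (6*nC3≤n³ (n ∸ s)) (≤-trans (cube-mono n∸s≤) (cube-+ W t n 2 W≤ t≤))

-- All errors are measured in the unit t = n / D, which `big` makes larger than the constants c₁ and
-- c₂. After multiplication by D they sum to 37n³: 2 from marked and bad boxes, 3 + 26 from the
-- binomials and cubes, 6 from X. With D = 40m even 240n³ would be allowed.
upper-arithmetic : ∀ m D n r s E F k Z X N c₁ c₂ → D ≡ 40 * m → 0 < m →
  6 * E ≤ F →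
  D * F ≤ n * (n * n) + n * (n * n) + D * (D * (D * D) * N + 3 * (n * n * X)) →
  N ≤ 27 * (k * k * k) ⊎ N ≤ star-bound k Z →
  D * (3 * k + Z) ≤ n + D * c₁ → D * X ≤ n + D * c₂ →
  k * (3 * D ∸ 2) < r → r ≤ n → r ≤ 3 * s + 3 →
  D * (D * c₁ + c₂ + 2) ≤ n →
  m * E ≤ m * bound n r s + n ^ 3
upper-arithmetic m D n r s E F k Z X N c₁ c₂ D≡ 0<m E≤F count≤ N≤ size≤ X≤ forest r≤n r≤s big = conclusion
  where
  open ≤-Reasoning
  instance
    m≢0 : NonZero m
    m≢0 = >-nonZero 0<m
    D≢0 : NonZero D
    D≢0 = subst NonZero (sym D≡) (m*n≢0 40 m)
  t = n / D
  b = bound n r s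
  τ = t * (n * n)

  Dt≤n : D * t ≤ n
  Dt≤n = ≤-trans (≤-reflexive (*-comm D t)) (m/n*n≤m n D)

  t≤n : t ≤ n
  t≤n = ≤-trans (m≤n*m t D) Dt≤n

  c≤t : D * c₁ + c₂ + 2 ≤ t
  c≤t = ≤-trans (≤-reflexive (sym (m*n/n≡m _ D))) (/-monoˡ-≤ D (≤-trans (≤-reflexive (*-comm _ D)) big))

  Dc₁≤t : D * c₁ ≤ t
  Dc₁≤t = ≤-trans (≤-trans (m≤m+n (D * c₁) c₂) (m≤m+n _ 2)) c≤t

  1≤t : 1 ≤ t
  1≤t = ≤-trans (≤-trans (n≤1+n 1) (m≤n+m 2 (D * c₁ + c₂))) c≤t

  c₂+1≤t : c₂ + 1 ≤ t
  c₂+1≤t = ≤-trans (+-mono-≤ (m≤n+m c₂ (D * c₁)) (n≤1+n 1)) c≤t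

  X≤2t : X ≤ 2 * t
  X≤2t = *-cancelˡ-≤ D (begin
    D * X                   ≤⟨ X≤ ⟩
    n + D * c₂              ≤⟨ +-monoˡ-≤ (D * c₂) (m≤n*[m/n]+n n D) ⟩
    D * t + D + D * c₂      ≡⟨ e D t c₂ ⟩
    D * (t + (c₂ + 1))      ≤⟨ *-monoʳ-≤ D (+-monoʳ-≤ t c₂+1≤t) ⟩
    D * (t + t)             ≡⟨ cong (λ y → D * (t + y)) (+-identityʳ t) ⟨
    D * (2 * t)             ∎)
    where e : ∀ D t c → D * t + D + D * c ≡ D * (t + (c + 1))
          e = solve-∀

  total≤ : 3 * (D * k) + D * Z ≤ n + t
  total≤ = ≤-trans (≤-reflexive (e D k Z)) (≤-trans size≤ (+-monoʳ-≤ n Dc₁≤t))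
    where e : ∀ D k Z → 3 * (D * k) + D * Z ≡ D * (3 * k + Z)
          e = solve-∀

  Dk≤n : D * k ≤ n
  Dk≤n = *-cancelˡ-≤ 3 (begin
    3 * (D * k)           ≤⟨ m≤m+n _ (D * Z) ⟩
    3 * (D * k) + D * Z   ≤⟨ total≤ ⟩
    n + t                 ≤⟨ +-monoʳ-≤ n (≤-trans t≤n (m≤m+n n (n + 0))) ⟩
    3 * n                 ∎)

  k≤t : k ≤ t
  k≤t = ≤-trans (≤-reflexive (sym (m*n/n≡m k D))) (/-monoˡ-≤ D (≤-trans (≤-reflexive (*-comm k D)) Dk≤n))

  -- The k tiles have fewer than r edges in total, and each has only two edges fewer than vertices;
  -- this loss 2k is at most 2t.
  3Dk≤ : 3 * (D * k) ≤ r + 2 * t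
  3Dk≤ = begin
    3 * (D * k)                ≡⟨ e D k ⟩
    k * (3 * D)                ≤⟨ *-monoʳ-≤ k (m≤n+m∸n (3 * D) 2) ⟩
    k * (2 + (3 * D ∸ 2))      ≡⟨ e′ k (3 * D ∸ 2) ⟩
    k * (3 * D ∸ 2) + 2 * k    ≤⟨ +-mono-≤ (<⇒≤ forest) (*-monoʳ-≤ 2 k≤t) ⟩
    r + 2 * t                  ∎
    where
    e : ∀ D k → 3 * (D * k) ≡ k * (3 * D)
    e = solve-∀
    e′ : ∀ k p → k * (2 + p) ≡ k * p + 2 * k
    e′ = solve-∀

  Dk≤ : D * k ≤ s + 2 * t
  Dk≤ = *-cancelˡ-≤ 3 (begin
    3 * (D * k)           ≤⟨ 3Dk≤ ⟩
    r + 2 * t             ≤⟨ +-mono-≤ r≤s ≤-refl ⟩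
    3 * s + 3 + 2 * t     ≡⟨ e s t ⟩
    3 * s + (3 * 1 + 2 * t) ≤⟨ +-monoʳ-≤ (3 * s) (+-mono-≤ (*-monoʳ-≤ 3 1≤t) (*-monoˡ-≤ t (n≤1+n 2))) ⟩
    3 * s + (3 * t + 3 * t) ≡⟨ e′ s t ⟩
    3 * (s + 2 * t)       ∎)
    where
    e : ∀ s t → 3 * s + 3 + 2 * t ≡ 3 * s + (3 * 1 + 2 * t)
    e = solve-∀
    e′ : ∀ s t → 3 * s + (3 * t + 3 * t) ≡ 3 * (s + 2 * t)
    e′ = solve-∀

  2t≤n : 2 * t ≤ n
  2t≤n = ≤-trans (*-monoˡ-≤ t 2≤D) Dt≤n
    where
    2≤D : 2 ≤ D
    2≤D = ≤-trans (≤-trans (m≤m+n 2 38) (m≤m*n 40 m)) (≤-reflexive (sym D≡))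

  clique-case : N ≤ 27 * (k * k * k) → D * (D * D) * N ≤ 6 * b + 3 * (n * n) + 26 * τ
  clique-case p = ≤-trans (*-monoʳ-≤ (D * (D * D)) p) (≤-trans (clique≤bound n r s (2 * t) r≤n 2t≤n
        (≤-trans (≤-reflexive (e D k)) (cube-mono 3Dk≤)))
      (+-monoʳ-≤ (6 * b + 3 * (n * n)) (≤-trans (≤-reflexive (e′ t (n * n))) (*-monoˡ-≤ τ (m≤m+n 14 12)))))
    where
    e : ∀ D k → D * (D * D) * (27 * (k * k * k)) ≡ 3 * (D * k) * (3 * (D * k) * (3 * (D * k)))
    e = solve-∀
    e′ : ∀ t q → 7 * (2 * t * q) ≡ 14 * (t * q)
    e′ = solve-∀

  star-case : N ≤ star-bound k Z → D * (D * D) * N ≤ 6 * b + 3 * (n * n) + 26 * τ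
  star-case p = ≤-trans (*-monoʳ-≤ (D * (D * D)) p) (≤-trans (≤-reflexive (star-bound-scale D k Z))
      (star≤bound n r s t (D * k) (D * Z) t≤n total≤ Dk≤))

  T≤ : D * (D * D) * N ≤ 6 * b + 3 * (n * n) + 26 * τ
  T≤ = [ clique-case , star-case ]′ N≤

  ν = n * (n * n)

  F≤ : D * F ≤ D * (6 * b) + 37 * ν
  F≤ = begin
    D * F
      ≤⟨ count≤ ⟩
    ν + ν + D * (D * (D * D) * N + 3 * (n * n * X))
      ≤⟨ +-monoʳ-≤ (ν + ν) (*-monoʳ-≤ D (+-mono-≤ T≤ (*-monoʳ-≤ 3 (*-monoʳ-≤ (n * n) X≤2t)))) ⟩
    ν + ν + D * (6 * b + 3 * (n * n) + 26 * τ + 3 * (n * n * (2 * t)))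
      ≡⟨ cong (λ y → ν + ν + D * (6 * b + 3 * y + 26 * τ + 3 * (n * n * (2 * t)))) (*-identityˡ (n * n)) ⟨
    ν + ν + D * (6 * b + 3 * (1 * (n * n)) + 26 * τ + 3 * (n * n * (2 * t)))
      ≤⟨ +-monoʳ-≤ (ν + ν) (*-monoʳ-≤ D (+-monoˡ-≤ _ (+-monoˡ-≤ _ (+-monoʳ-≤ (6 * b) (*-monoʳ-≤ 3 (*-monoˡ-≤ (n * n) 1≤t)))))) ⟩
    ν + ν + D * (6 * b + 3 * τ + 26 * τ + 3 * (n * n * (2 * t)))
      ≡⟨ e ν D b t (n * n) ⟩
    D * (6 * b) + (2 * ν + 35 * (D * t * (n * n)))
      ≤⟨ +-monoʳ-≤ (D * (6 * b)) (+-monoʳ-≤ (2 * ν) (*-monoʳ-≤ 35 (*-monoˡ-≤ (n * n) Dt≤n))) ⟩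
    D * (6 * b) + (2 * ν + 35 * ν)
      ≡⟨ cong (D * (6 * b) +_) (*-distribʳ-+ ν 2 35) ⟨
    D * (6 * b) + 37 * ν ∎
    where
    e : ∀ c D b t q → c + c + D * (6 * b + 3 * (t * q) + 26 * (t * q) + 3 * (q * (2 * t))) ≡ D * (6 * b) + (2 * c + 35 * (D * t * q))
    e = solve-∀

  conclusion : m * E ≤ m * b + n ^ 3
  conclusion = *-cancelˡ-≤ 240 (begin
    240 * (m * E)                    ≡⟨ e₁ m E ⟩
    40 * m * (6 * E)                 ≡⟨ cong (_* (6 * E)) D≡ ⟨
    D * (6 * E)                      ≤⟨ *-monoʳ-≤ D E≤F ⟩
    D * F                            ≤⟨ F≤ ⟩
    D * (6 * b) + 37 * ν            ≡⟨ cong (λ y → y * (6 * b) + 37 * ν) D≡ ⟩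
    40 * m * (6 * b) + 37 * ν       ≤⟨ +-monoʳ-≤ (40 * m * (6 * b)) (*-monoˡ-≤ ν (m≤m+n 37 203)) ⟩
    40 * m * (6 * b) + 240 * ν      ≡⟨ e₂ m b n ⟩
    240 * (m * b + n ^ 3)            ∎)
    where
    e₁ : ∀ m E → 240 * (m * E) ≡ 40 * m * (6 * E)
    e₁ = solve-∀
    e₂ : ∀ m b n → 40 * m * (6 * b) + 240 * (n * (n * n)) ≡ 240 * (m * b + n * (n * (n * 1)))
    e₂ = solve-∀

-- Extremal constructions

prefix : ∀ {n} → List (Subset n) → List (Subset n) → List (Subset (suc n))
prefix ps qs = map (inside ∷_) ps ++ map (outside ∷_) qs

length-prefix : ∀ {n} (ps qs : List (Subset n)) → length (prefix ps qs) ≡ length ps + length qs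
length-prefix ps qs = trans (length-++ (map (inside ∷_) ps)) (cong₂ _+_ (length-map _ ps) (length-map _ qs))

All-prefix : ∀ {n} {P : Subset (suc n) → Set} {ps qs : List (Subset n)} →
  All (λ p → P (inside ∷ p)) ps → All (λ q → P (outside ∷ q)) qs → All P (prefix ps qs)
All-prefix al bl = All.++⁺ (All.map⁺ al) (All.map⁺ bl)

Unique-prefix : ∀ {n} {ps qs : List (Subset n)} → Unique ps → Unique qs → Unique (prefix ps qs)
Unique-prefix {ps = ps} {qs} u v = Unique.++⁺ (Unique.map⁺ ∷-injectiveʳ u) (Unique.map⁺ ∷-injectiveʳ v) λ (p , q) →
  let _ , _ , e = ∈-map⁻ (inside ∷_) p
      _ , _ , f = ∈-map⁻ (outside ∷_) q
  in differ (trans (sym e) f)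
  where
  differ : ∀ {n} {p q : Subset n} → _≡_ {A = Subset (suc n)} (inside ∷ p) (outside ∷ q) → ⊥
  differ ()

-- The k-subsets of the first a points, and the k-subsets of all n points that meet the first s. The
-- recursion on the first point is Pascal's rule, so the lengths are binomials.
within meeting : ∀ n → ℕ → ℕ → List (Subset n)
within n a zero = ∅ ∷ []
within zero a (suc k) = []
within (suc n) zero (suc k) = []
within (suc n) (suc a) (suc k) = prefix (within n a k) (within n a (suc k))
meeting n s zero = []
meeting zero s (suc k) = []
meeting (suc n) zero (suc k) = []
meeting (suc n) (suc s) (suc k) = prefix (within n n k) (meeting n s (suc k))

length-within : ∀ n a k → a ≤ n → length (within n a k) ≡ a choose k
length-within n a zero _ = refl
length-within zero zero (suc k) _ = refl
length-within (suc n) zero (suc k) _ = refl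
length-within (suc n) (suc a) (suc k) (s≤s le) = trans (length-prefix (within n a k) _)
  (trans (cong₂ _+_ (length-within n a k le) (length-within n a (suc k) le)) (nCk+nC[k+1]≡[n+1]C[k+1] a k))

length-meeting : ∀ n s k → length (meeting n s k) + (n ∸ s) choose k ≡ n choose k
length-meeting n s zero = refl
length-meeting zero zero (suc k) = refl
length-meeting zero (suc s) (suc k) = refl
length-meeting (suc n) zero (suc k) = refl
length-meeting (suc n) (suc s) (suc k) = trans (cong (_+ (n ∸ s) choose suc k) (length-prefix (within n n k) (meeting n s (suc k))))
  (trans (+-assoc (length (within n n k)) _ _) (trans (cong₂ _+_ (length-within n n k ≤-refl) (length-meeting n s (suc k)))
    (nCk+nC[k+1]≡[n+1]C[k+1] n k)))

within-size : ∀ n a k → All (λ e → ∣ e ∣ ≡ k) (within n a k)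
within-size n a zero = ∣⊥∣≡0 n ∷ []
within-size zero a (suc k) = []
within-size (suc n) zero (suc k) = []
within-size (suc n) (suc a) (suc k) = All-prefix (All.map (cong suc) (within-size n a k)) (within-size n a (suc k))

meeting-size : ∀ n s k → All (λ e → ∣ e ∣ ≡ k) (meeting n s k)
meeting-size n s zero = []
meeting-size zero s (suc k) = []
meeting-size (suc n) zero (suc k) = []
meeting-size (suc n) (suc s) (suc k) = All-prefix (All.map (cong suc) (within-size n n k)) (meeting-size n s (suc k))

within-unique : ∀ n a k → Unique (within n a k)
within-unique n a zero = [] ∷ []
within-unique zero a (suc k) = []
within-unique (suc n) zero (suc k) = []
within-unique (suc n) (suc a) (suc k) = Unique-prefix (within-unique n a k) (within-unique n a (suc k))

meeting-unique : ∀ n s k → Unique (meeting n s k)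
meeting-unique n s zero = []
meeting-unique zero s (suc k) = []
meeting-unique (suc n) zero (suc k) = []
meeting-unique (suc n) (suc s) (suc k) = Unique-prefix (within-unique n n k) (meeting-unique n s (suc k))

within-small : ∀ n a k → All (λ e → ∀ {x} → x ∈ˢ e → toℕ x < a) (within n a k)
within-small n a zero = (λ x∈ → ⊥-elim (∉⊥ x∈)) ∷ []
within-small zero a (suc k) = []
within-small (suc n) zero (suc k) = []
within-small (suc n) (suc a) (suc k) = All-prefix
  (All.map (λ f → λ { here → s≤s z≤n ; (there x∈) → s≤s (f x∈) }) (within-small n a k))
  (All.map (λ f → λ { (there x∈) → s≤s (f x∈) }) (within-small n a (suc k)))

meeting-small : ∀ n s k → All (λ e → ∃ λ x → x ∈ˢ e × toℕ x < s) (meeting n s k)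
meeting-small n s zero = []
meeting-small zero s (suc k) = []
meeting-small (suc n) zero (suc k) = []
meeting-small (suc n) (suc s) (suc k) = All-prefix
  (All.universal (λ _ → zero , here , s≤s z≤n) (within n n k))
  (All.map (λ (x , x∈ , lt) → suc x , there x∈ , s≤s lt) (meeting-small n s (suc k)))

clique star : ∀ n → ℕ → 3Graph n
clique n a = record { edges = within n a 3 ; size3 = within-size n a 3 ; nodup = within-unique n a 3 }
star n s = record { edges = meeting n s 3 ; size3 = meeting-size n s 3 ; nodup = meeting-unique n s 3 }

below : ∀ {n} → ℕ → Fin n → ℕ
below a x = 𝟙 (toℕ x <ᵇ a)

∑-below : ∀ n a → ∑ (allFin n) (below a) ≤ a
∑-below zero a = z≤n
∑-below (suc n) zero = ≤-trans (≤-reflexive (trans (∑-tabulate {n = n} suc (below 0)) (∑-0 (allFin n)))) z≤n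
∑-below (suc n) (suc a) = s≤s (≤-trans (≤-reflexive (∑-tabulate {n = n} suc (below (suc a)))) (∑-below n a))

count≤1 : ∀ {n} (c : Fin n) xs → Unique xs → count c xs ≤ 1
count≤1 c [] _ = z≤n
count≤1 c (x ∷ xs) (p ∷ u) with x F.≟ c
... | no _ = count≤1 c xs u
... | yes refl = ≤-reflexive (cong suc (absent xs p))
  where
  absent : ∀ xs → All (x ≢_) xs → count x xs ≡ 0
  absent [] _ = refl
  absent (y ∷ ys) (q ∷ qs) = cong₂ _+_ (cong 𝟙 (==-≢ (≢-sym q))) (absent ys qs)

∑-unique-≤ : ∀ {n} (xs : List (Fin n)) (f : Fin n → ℕ) → Unique xs → ∑ xs f ≤ ∑ (allFin n) f
∑-unique-≤ {n} xs f u = ≤-trans (≤-reflexive (sym (∑-count xs f)))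
  (∑-mono (allFin n) λ c → ≤-trans (*-monoˡ-≤ (f c) (count≤1 c xs u)) (≤-reflexive (*-identityˡ (f c))))

∑-concat : ∀ {A : Set} (xss : List (List A)) f → ∑ (concat xss) f ≡ (∑[ xs ∈ xss ] ∑ xs f)
∑-concat [] f = refl
∑-concat (xs ∷ xss) f = trans (∑-++ xs (concat xss) f) (cong (∑ xs f +_) (∑-concat xss f))

below-1 : ∀ {n a} {x : Fin n} → toℕ x < a → 1 ≤ below a x
below-1 lt = 𝟙-true (<⇒<ᵇ lt)

-- In a path with an edge every vertex lies on an edge, hence is among the first a points, and there
-- are two more vertices than edges.
clique-path : ∀ {n a} P → TightPathIn (clique n a) P → pathEdges P ≡ 0 ⊎ 2 + pathEdges P ≤ ∑ P (below a)
clique-path [] _ = inj₁ refl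
clique-path (x ∷ []) _ = inj₁ refl
clique-path (x ∷ y ∷ []) _ = inj₁ refl
clique-path {n} {a} (x ∷ y ∷ z ∷ P) t = inj₂ (all-below (x ∷ y ∷ z ∷ P) (s≤s (s≤s (s≤s z≤n))) t)
  where
  corners : ∀ {x y z} → triple x y z ∈ within n a 3 → toℕ x < a × toℕ y < a × toℕ z < a
  corners {x} {y} {z} t = let f = All.lookup (within-small n a 3) t in
    f (x∈p∪q⁺ (inj₁ (x∈⁅x⁆ x))) , f (x∈p∪q⁺ (inj₂ (x∈p∪q⁺ (inj₁ (x∈⁅x⁆ y))))) , f (x∈p∪q⁺ {p = ⁅ x ⁆} (inj₂ (x∈p∪q⁺ {p = ⁅ y ⁆} (inj₂ (x∈⁅x⁆ z)))))
  all-below : ∀ P → 3 ≤ length P → TightPathIn (clique n a) P → length P ≤ ∑ P (below a)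
  all-below (x ∷ y ∷ z ∷ []) _ (t , _) = let p , q , r = corners t in
    +-mono-≤ (below-1 p) (+-mono-≤ (below-1 q) (+-mono-≤ (below-1 r) (z≤n {0})))
  all-below (x ∷ y ∷ z ∷ w ∷ P) _ (t , ts) = +-mono-≤ (below-1 (proj₁ (corners t))) (all-below (y ∷ z ∷ w ∷ P) (s≤s (s≤s (s≤s z≤n))) ts)
  all-below (x ∷ []) (s≤s ()) _
  all-below (x ∷ y ∷ []) (s≤s (s≤s ())) _

-- The surplus of two vertices over edges makes the count strict, so that even a = r points are too
-- few.
clique-free : ∀ {n a r} → 0 < r → a ≤ r → ¬ ContainsTLF (clique n a) r
clique-free {n} {a} 0<r a≤r (paths , u , t , refl) with total paths t
  where
  total : ∀ ps → All (TightPathIn (clique n a)) ps → sum (map pathEdges ps) ≡ 0 ⊎ 2 + sum (map pathEdges ps) ≤ (∑[ P ∈ ps ] ∑ P (below a))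
  total [] _ = inj₁ refl
  total (P ∷ ps) (t ∷ ts) with clique-path P t | total ps ts
  ... | inj₁ p | inj₁ q = inj₁ (cong₂ _+_ p q)
  ... | inj₁ p | inj₂ q rewrite p = inj₂ (≤-trans q (m≤n+m _ _))
  ... | inj₂ p | inj₁ q rewrite q | +-identityʳ (pathEdges P) = inj₂ (≤-trans p (m≤m+n _ _))
  ... | inj₂ p | inj₂ q = inj₂ (≤-trans (+-monoʳ-≤ 2 (+-monoʳ-≤ (pathEdges P) (m≤n+m _ 2))) (+-mono-≤ p q))
... | inj₁ p = <⇒≢ 0<r (sym p)
... | inj₂ p = <⇒≱ (≤-trans (n≤1+n _) p) (≤-trans (≤-reflexive (sym (∑-concat paths (below a))))
  (≤-trans (∑-unique-≤ (concat paths) (below a) u) (≤-trans (∑-below n a) a≤r)))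

star-path : ∀ {n s} P → TightPathIn (star n s) P → pathEdges P ≤ 3 * ∑ P (below s)
star-path [] _ = z≤n
star-path (x ∷ []) _ = z≤n
star-path {n} {s} (x ∷ y ∷ P) t = ≤-trans (m≤m+n _ _) (strengthened x y P t)
  where
  f : Fin n → ℕ
  f = below s
  hit-corner : ∀ {x y z} → triple x y z ∈ meeting n s 3 → 1 ≤ f x + f y + f z
  hit-corner {x} {y} {z} t with All.lookup (meeting-small n s 3) t
  ... | v , v∈ , lt with x∈p∪q⁻ ⁅ x ⁆ (⁅ y ⁆ ∪ ⁅ z ⁆) v∈
  ...   | inj₁ p rewrite x∈⁅y⁆⇒x≡y x p = ≤-trans (below-1 lt) (≤-trans (m≤m+n (f x) (f y)) (m≤m+n _ (f z)))
  ...   | inj₂ q with x∈p∪q⁻ ⁅ y ⁆ ⁅ z ⁆ q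
  ...     | inj₁ p rewrite x∈⁅y⁆⇒x≡y y p = ≤-trans (below-1 lt) (≤-trans (m≤n+m (f y) (f x)) (m≤m+n _ (f z)))
  ...     | inj₂ p rewrite x∈⁅y⁆⇒x≡y z p = ≤-trans (below-1 lt) (m≤n+m (f z) (f x + f y))
  -- A centre lies on at most three edges of the path, but as first vertex on only one and as second
  -- on at most two. The term 2 f x + f y records this surplus and makes the induction work.
  strengthened : ∀ x y P → TightPathIn (star n s) (x ∷ y ∷ P) → length P + (2 * f x + f y) ≤ 3 * ∑ (x ∷ y ∷ P) f
  strengthened x y [] _ = ≤-trans (m≤m+n _ (f x + 2 * f y)) (≤-reflexive (e (f x) (f y)))
    where e : ∀ a b → 2 * a + b + (a + 2 * b) ≡ 3 * (a + (b + 0))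
          e = solve-∀
  strengthened x y (z ∷ P) (t , ts) = begin
    suc (length P) + (2 * f x + f y)                          ≡⟨ e₁ (length P) (f x) (f y) ⟩
    1 + (length P + (2 * f x + f y))                          ≤⟨ +-monoˡ-≤ _ (hit-corner t) ⟩
    f x + f y + f z + (length P + (2 * f x + f y))            ≡⟨ e₂ (length P) (f x) (f y) (f z) ⟩
    3 * f x + (length P + (2 * f y + f z))                    ≤⟨ +-monoʳ-≤ (3 * f x) (strengthened y z P ts) ⟩
    3 * f x + 3 * ∑ (y ∷ z ∷ P) f                             ≡⟨ *-distribˡ-+ 3 (f x) _ ⟨
    3 * ∑ (x ∷ y ∷ z ∷ P) f                                   ∎
    where
    open ≤-Reasoning
    e₁ : ∀ l a b → suc l + (2 * a + b) ≡ 1 + (l + (2 * a + b))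
    e₁ = solve-∀
    e₂ : ∀ l a b c → a + b + c + (l + (2 * a + b)) ≡ 3 * a + (l + (2 * b + c))
    e₂ = solve-∀

star-free : ∀ {n s r} → 3 * s < r → ¬ ContainsTLF (star n s) r
star-free {n} {s} lt (paths , u , t , refl) = <⇒≱ lt (≤-trans (total paths t) (*-monoʳ-≤ 3
  (≤-trans (≤-reflexive (sym (∑-concat paths (below s)))) (≤-trans (∑-unique-≤ (concat paths) (below s) u) (∑-below n s)))))
  where
  total : ∀ ps → All (TightPathIn (star n s)) ps → sum (map pathEdges ps) ≤ 3 * (∑[ P ∈ ps ] ∑ P (below s))
  total [] _ = z≤n
  total (P ∷ ps) (t ∷ ts) = ≤-trans (+-mono-≤ (star-path P t) (total ps ts)) (≤-reflexive (sym (*-distribˡ-+ 3 (∑ P (below s)) _)))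

-- Rounded multiples of a real number

lower<upper : ∀ (c : ℝ) {p q} → Lower c p → Upper c q → p <ℚ q
lower<upper c {p} {q} l u with ℚ.<-cmp p q
... | tri< lt _ _ = lt
... | tri≈ _ refl _ = ⊥-elim (disjoint c l u)
... | tri> _ _ gt = ⊥-elim (disjoint c l (upper-up c gt u))

</-cross : ∀ p i m → p <ℚ i /ℚ suc m → ↥ p ℤ.* pos (suc m) ℤ.< i ℤ.* ↧ p
</-cross p@(mkℚ _ _ _) i m lt = ℚᵘ.drop-*<* (ℚᵘ.<-respʳ-≃ (ℚ.toℚᵘ-fromℚᵘ (mkℚᵘ i m)) (ℚ.toℚᵘ-mono-< {p} {i /ℚ suc m} lt))

/<-cross : ∀ i m p → i /ℚ suc m <ℚ p → i ℤ.* ↧ p ℤ.< ↥ p ℤ.* pos (suc m)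
/<-cross i m p@(mkℚ _ _ _) lt = ℚᵘ.drop-*<* (ℚᵘ.<-respˡ-≃ (ℚ.toℚᵘ-fromℚᵘ (mkℚᵘ i m)) (ℚ.toℚᵘ-mono-< {i /ℚ suc m} {p} lt))

/</-cancel : ∀ i j m → i /ℚ suc m <ℚ j /ℚ suc m → i ℤ.< j
/</-cancel i j m lt = ℤ.*-cancelʳ-<-nonNeg (pos (suc m)) (ℚᵘ.drop-*<* (ℚᵘ.<-respˡ-≃ (ℚ.toℚᵘ-fromℚᵘ (mkℚᵘ i m))
  (ℚᵘ.<-respʳ-≃ (ℚ.toℚᵘ-fromℚᵘ (mkℚᵘ j m)) (ℚ.toℚᵘ-mono-< {i /ℚ suc m} {j /ℚ suc m} lt))))

move-minus : ∀ a b e → pos a ℤ.- pos b ℤ.< pos e → a < e + b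
move-minus a b e lt = ℤ.drop‿+<+ (subst (ℤ._< pos (e + b)) eq (ℤ.+-monoˡ-< (pos b) lt))
  where
  eq : (pos a ℤ.- pos b) ℤ.+ pos b ≡ pos a
  eq = trans (ℤ.+-assoc (pos a) (ℤ.- pos b) (pos b)) (trans (cong (λ x → pos a ℤ.+ x) (ℤ.+-inverseˡ (pos b))) (ℤ.+-identityʳ (pos a)))

module _ (c : ℝ) where

  -- The number c lies above (r - 1)/n and below (3s + 3)/n, and the numerators can be compared.
  r≤3s+3 : ∀ n {r s} → RoundsTo c 1 n r → RoundsTo c 3 n s → r ≤ 3 * s + 3
  r≤3s+3 zero refl refl = z≤n
  r≤3s+3 (suc m) {r} {s} (lr , _) (_ , us) = ≤-pred (subst₂ _<_ (*-identityˡ r) (+-comm (3 * s + 3) 1)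
    (move-minus (1 * r) 1 (3 * s + 3) (/</-cancel _ _ m (lower<upper c lr us))))

  3s≤r+3 : ∀ n {r s} → RoundsTo c 1 n r → RoundsTo c 3 n s → 3 * s ≤ r + 3
  3s≤r+3 zero refl refl = z≤n
  3s≤r+3 (suc m) {r} {s} (_ , ur) (ls , _) = ≤-pred (subst (3 * s <_) (trans (cong (λ x → x + 1 + 3) (*-identityˡ r)) (eq r))
    (move-minus (3 * s) 3 (1 * r + 1) (/</-cancel _ _ m (lower<upper c ls ur))))
    where eq : ∀ r → r + 1 + 3 ≡ suc (r + 3)
          eq = solve-∀

  r≤n : Upper c 1ℚ → ∀ n {r} → RoundsTo c 1 n r → r ≤ n
  r≤n _ zero refl = z≤n
  r≤n c<1 (suc m) {r} (lr , _) = ≤-pred (subst₂ _<_ (*-identityˡ r) (+-comm (suc m) 1)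
    (move-minus (1 * r) 1 (suc m) (subst₂ ℤ._<_ (ℤ.*-identityʳ _) (ℤ.*-identityˡ _) (/<-cross (pos (1 * r) ℤ.- pos 1) m 1ℚ (lower<upper c lr c<1)))))

  -- Openness gives a rational q with 0 < q < c. If r = 0, then c < 1/n, which is below q as soon as
  -- n exceeds the denominator of q.
  0<r-eventually : Lower c 0ℚ → ∃ λ N → ∀ n {r} → N < n → RoundsTo c 1 n r → 0 < r
  0<r-eventually 0<c with lower-open c 0<c
  ... | q@(mkℚ (pos zero) _ _) , 0<q , _ = ⊥-elim (ℤ.<-irrefl refl (ℚ.drop-*<* 0<q))
  ... | q@(mkℚ (ℤ.-[1+ _ ]) _ _) , 0<q , _ = ⊥-elim (negative (ℚ.drop-*<* 0<q))
    where
    negative : ∀ {a} → ¬ (pos 0 ℤ.< ℤ.-[1+ a ])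
    negative ()
  ... | q@(mkℚ (pos (suc a)) b _) , _ , lq = suc b , large
    where
    large : ∀ n {r} → suc b < n → RoundsTo c 1 n r → 0 < r
    large (suc m) {suc r} _ _ = s≤s z≤n
    large (suc m) {zero} lt (_ , ur) = ⊥-elim (<-irrefl refl (<-trans lt
      (≤-<-trans (m≤m+n (suc m) (a * suc m)) (subst (suc a * suc m <_) (*-identityˡ (suc b)) bound<))))
      where
      bound< : suc a * suc m < 1 * suc b
      bound< = ℤ.drop‿+<+ (subst₂ ℤ._<_ (sym (ℤ.pos-* (suc a) (suc m))) (sym (ℤ.pos-* 1 (suc b))) (</-cross q (pos 1) m (lower<upper c lq ur)))

-- The lower bound and the combination of both bounds

nC2≤n² : ∀ n → n choose 2 ≤ n * n
nC2≤n² n = ≤-trans (m≤n*m (n choose 2) 2) (≤-trans (m≤m+n _ n) (≤-reflexive (nC2-formula n)))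

nC3-increment : ∀ a j M → a + j ≤ M → (a + j) choose 3 ≤ a choose 3 + j * (M * M)
nC3-increment a zero M _ = ≤-reflexive (trans (cong (_choose 3) (+-identityʳ a)) (sym (+-identityʳ (a choose 3))))
nC3-increment a (suc j) M le = begin
  (a + suc j) choose 3                      ≡⟨ cong (_choose 3) (+-suc a j) ⟩
  suc (a + j) choose 3                      ≡⟨ nCk+nC[k+1]≡[n+1]C[k+1] (a + j) 2 ⟨
  (a + j) choose 2 + (a + j) choose 3            ≤⟨ +-mono-≤ (≤-trans (nC2≤n² (a + j)) (*-mono-≤ a+j≤M a+j≤M)) (nC3-increment a j M a+j≤M) ⟩
  M * M + (a choose 3 + j * (M * M))        ≡⟨ e (M * M) (a choose 3) (j * (M * M)) ⟩
  a choose 3 + (M * M + j * (M * M))        ∎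
  where
  open ≤-Reasoning
  a+j≤M : a + j ≤ M
  a+j≤M = ≤-trans (+-monoʳ-≤ a (n≤1+n j)) le
  e : ∀ x y z → x + (y + z) ≡ y + (x + z)
  e = solve-∀

lower-bound : ∀ m n r s → 0 < r → r ≤ n → 3 * s ≤ r + 3 → 2 * m ≤ n →
  Σ (3Graph n) λ H → ¬ ContainsTLF H r × m * bound n r s ≤ m * numEdges H + n ^ 3
lower-bound m n r s 0<r r≤n 3s≤ 2m≤n with ⊔-sel (r choose 3) ((n choose 3) ∸ ((n ∸ s) choose 3))
... | inj₁ eq = clique n r , clique-free 0<r ≤-refl ,
  ≤-trans (≤-reflexive (cong (m *_) (trans eq (sym (length-within n r 3 r≤n))))) (m≤m+n _ (n ^ 3))
... | inj₂ eq = star n s′ , star-free 3s′<r , (begin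
  m * bound n r s                        ≡⟨ cong (m *_) eq ⟩
  m * ((n choose 3) ∸ (a choose 3))                ≤⟨ *-monoʳ-≤ m (m≤n+o⇒m∸n≤o (n choose 3) (a choose 3) enough) ⟩
  m * (E + 2 * (n * n))                  ≡⟨ e m E (n * n) ⟩
  m * E + 2 * m * (n * n)                ≤⟨ +-monoʳ-≤ (m * E) (*-monoˡ-≤ (n * n) 2m≤n) ⟩
  m * E + n * (n * n)                    ≡⟨ cong (λ x → m * E + n * (n * x)) (*-identityʳ n) ⟨
  m * E + n ^ 3                          ∎)
  where
  open ≤-Reasoning
  -- Removing one centre would only give 3(s - 1) ≤ r, and `star-free` needs a strict inequality.
  -- Two centres fewer cost at most 2n² edges, which 2m ≤ n absorbs.
  s′ = s ∸ 2
  a = n ∸ s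
  a′ = n ∸ s′
  E = numEdges (star n s′)
  e : ∀ m E q → m * (E + 2 * q) ≡ m * E + 2 * m * q
  e = solve-∀
  3s′<r : 3 * s′ < r
  3s′<r = subst (_< r) (sym (*-distribˡ-∸ 3 s 2)) (m<n+o⇒m∸n<o (3 * s) 6 {{>-nonZero 0<r}}
    (≤-trans (s≤s 3s≤) (≤-trans (≤-reflexive (e′ r)) (+-monoˡ-≤ r (m≤m+n 4 2)))))
    where e′ : ∀ r → suc (r + 3) ≡ 4 + r
          e′ = solve-∀
  a≤a′ : a ≤ a′
  a≤a′ = ∸-monoʳ-≤ n (m∸n≤m s 2)
  a′≤ : a′ ∸ a ≤ 2
  a′≤ = m≤n+o⇒m∸n≤o a′ a (m≤n+o⇒m∸n≤o n s′ (≤-trans (m≤n+m∸n n s) (≤-trans (+-monoˡ-≤ a (m≤n+m∸n s 2)) (≤-reflexive (e″ s′ a)))))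
    where e″ : ∀ s a → 2 + s + a ≡ s + (a + 2)
          e″ = solve-∀
  enough : n choose 3 ≤ a choose 3 + (E + 2 * (n * n))
  enough = begin
    n choose 3                                  ≡⟨ length-meeting n s′ 3 ⟨
    E + a′ choose 3                             ≡⟨ cong (λ x → E + x choose 3) (m+[n∸m]≡n a≤a′) ⟨
    E + (a + (a′ ∸ a)) choose 3                 ≤⟨ +-monoʳ-≤ E (nC3-increment a (a′ ∸ a) n (≤-trans (≤-reflexive (m+[n∸m]≡n a≤a′)) (m∸n≤m n s′))) ⟩
    E + (a choose 3 + (a′ ∸ a) * (n * n))       ≤⟨ +-monoʳ-≤ E (+-monoʳ-≤ (a choose 3) (*-monoˡ-≤ (n * n) a′≤)) ⟩
    E + (a choose 3 + 2 * (n * n))              ≡⟨ e₁ E (a choose 3) (2 * (n * n)) ⟩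
    a choose 3 + (E + 2 * (n * n))              ∎
    where e₁ : ∀ x y z → x + (y + z) ≡ y + (x + z)
          e₁ = solve-∀

threshold : ℕ → ℕ
threshold D = D * (D * (maxColours D * 1006) + maxColours D * overhead D + 2)

upper-bound : ∀ m D → D ≡ 40 * m → 0 < m → 0 < D → ∀ {n r} s → threshold D ≤ n → r ≤ n → r ≤ 3 * s + 3 →
  (H : 3Graph n) → ¬ ContainsTLF H r → m * numEdges H ≤ m * bound n r s + n ^ 3
upper-bound m D D≡ 0<m 0<D {n} {r} s big r≤n r≤ H free =
  upper-arithmetic m D n r s (numEdges H) (edgeCount H) C.k C.Z C.X C.N (maxColours D * 1006) (maxColours D * overhead D) D≡ 0<m
    (6*numEdges≤edgeCount H) C.count≤ C.N≤ C.size≤ C.error≤ (≰⇒> λ le → free (shorten r le C.forest)) r≤n r≤ big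
  where module C = Certificate (certify H D 0<D)

both-bounds : ∀ m D → D ≡ 40 * m → 0 < m → 0 < D → (c : ℝ) → Lower c 0ℚ → Upper c 1ℚ →
  (r s : ℕ → ℕ) → (∀ n → RoundsTo c 1 n (r n)) → (∀ n → RoundsTo c 3 n (s n)) →
  ∃ λ N → ∀ n → N ≤ n →
    ((H : 3Graph n) → ¬ ContainsTLF H (r n) → m * numEdges H ≤ m * bound n (r n) (s n) + n ^ 3)
    × Σ (3Graph n) (λ H → ¬ ContainsTLF H (r n) × m * bound n (r n) (s n) ≤ m * numEdges H + n ^ 3)
both-bounds m D D≡ 0<m 0<D c 0<c c<1 r s r≈ s≈ = threshold D + (suc N₀ + 2 * m) , λ n N≤n →
  (λ H → upper-bound m D D≡ 0<m 0<D (s n) (≤-trans (m≤m+n (threshold D) _) N≤n) (r≤n c c<1 n (r≈ n)) (r≤3s+3 c n (r≈ n) (s≈ n)) H) ,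
  lower-bound m n (r n) (s n) (positive-r n (≤-trans (≤-trans (m≤m+n (suc N₀) (2 * m)) (m≤n+m _ (threshold D))) N≤n) (r≈ n))
    (r≤n c c<1 n (r≈ n)) (3s≤r+3 c n (r≈ n) (s≈ n)) (≤-trans (≤-trans (m≤n+m (2 * m) (suc N₀)) (m≤n+m _ (threshold D))) N≤n)
  where
  N₀ = proj₁ (0<r-eventually c 0<c)
  positive-r = proj₂ (0<r-eventually c 0<c)

-- The term o(n³) is read as an error of at most n³/(d + 1) for every d and all large n, with
-- denominators cleared.
theorem5p2 : (c : ℝ) → Lower c 0ℚ → Upper c 1ℚ →
    (r s : ℕ → ℕ) → (∀ n → RoundsTo c 1 n (r n)) → (∀ n → RoundsTo c 3 n (s n)) →
    (d : ℕ) → ∃ λ N → ∀ n → N ≤ n →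
    ((H : 3Graph n) → ¬ ContainsTLF H (r n) →
    suc d * numEdges H ≤ suc d * bound n (r n) (s n) + n ^ 3)
    × Σ (3Graph n) (λ H → ¬ ContainsTLF H (r n) ×
    suc d * bound n (r n) (s n) ≤ suc d * numEdges H + n ^ 3)
theorem5p2 c 0<c c<1 r s r≈ s≈ d = both-bounds (suc d) (40 * suc d) refl (s≤s z≤n) (s≤s z≤n) c 0<c c<1 r s r≈ s≈
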